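{- Let $p$ be a prime with $p\equiv1\pmod4$, and write $p=a^2+b^2$ with $a,b\in\mathbb Z$ and $a\equiv1\pmod4$. Then $$\sum_{k=0}^{\frac{p-1}4}\frac{\binom{4k}{2k}^2}{16^{2k}}\equiv\frac12+(-1)^{\frac{p-1}4}a-(-1)^{\frac{p-1}4}\frac p{4a}\pmod{p^2}.$$
   Context: Congruences are between rational numbers whose denominators are prime to $p$. -}

module Defs where

open import Data.Integer.Base as ℤ using (ℤ; +_; +[1+_]; -[1+_]; -1ℤ)
open import Data.Nat.Base as ℕ using (ℕ)
open import Data.Nat.Combinatorics using (_C_)
open import Data.Nat.Coprimality using (Coprime)
open import Data.Nat.Properties using (m^n≢0)
open import Data.Product.Base using (_×_; ∃-syntax)
open import Data.Rational.Base as ℚ using (ℚ; _/_; _÷_; _-_; _*_)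
open import Data.Rational.Literals using (fromℤ)
open import Data.Rational.Properties using (+-0-commutativeMonoid)
open import Relation.Binary.PropositionalEquality.Core using (_≡_)

open import Algebra.Properties.CommutativeMonoid.Sum +-0-commutativeMonoid public
  using (sum⁺-syntax)

-- ℚ is in lowest terms, so this says that x lies in ℤ localised at p.
Integral : ℕ → ℚ → Set
Integral p x = Coprime (ℚ.denominatorℕ x) p

-- Congruence modulo p ^ n in ℤ localised at p; both sides are required to
-- lie in that ring.
infix 4 _≡_[mod_^_]
_≡_[mod_^_] : ℚ → ℚ → ℕ → ℕ → Set
x ≡ y [mod p ^ n ] =
  Integral p x × Integral p y ×
  ∃[ z ] Integral p z × x - y ≡ fromℤ (+ (p ℕ.^ n)) * z

[-1]^_ : ℕ → ℚ
[-1]^ n = fromℤ (-1ℤ ℤ.^ n)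

term : ℕ → ℚ
term k = _/_ (+ (((4 ℕ.* k) C (2 ℕ.* k)) ℕ.^ 2)) (16 ℕ.^ (2 ℕ.* k)) {{m^n≢0 16 (2 ℕ.* k)}}

4a-nonZero : ∀ a → a ℤ.%ℕ 4 ≡ 1 → ℚ.NonZero (fromℤ (+ 4 ℤ.* a))
4a-nonZero (+ 0)    ()
4a-nonZero +[1+ _ ] _ = _
4a-nonZero -[1+ _ ] _ = _

-- p / (4 a); the hypothesis on a is used only to see that a ≠ 0.
p/[4a] : ℕ → (a : ℤ) → a ℤ.%ℕ 4 ≡ 1 → ℚ
p/[4a] p a a≡1 = _÷_ (fromℤ (+ p)) (fromℤ (+ 4 ℤ.* a)) {{4a-nonZero a a≡1}}

{-# OPTIONS --safe #-}
-- Let p = 4n + 1, ε = (-1)ⁿ and m = 2n, and compute modulo p². Because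
-- 16ʲ binom(m,j) binom(m+j,j) ≡ (-1)ʲ binom(2j,j)², twice the sum is 1 + D with
-- D = Σⱼ binom(m,j) binom(m+j,j), and comparing coefficients in
-- (1 + x)ᵐ (1 - x)⁻ᵐ⁻¹ = (1 - x²)ᵐ (1 - x)⁻ᵖ gives
-- 2D ≡ ε (3 binom(2n,n) - binom(6n+1,n)).
--
-- On the other side stands the Jacobsthal sum J(r) = Σₓ ψ(x) ψ(x² - r), ψ the
-- Legendre symbol. A second-moment computation gives J(1)² + J(g)² = 4p for a
-- nonresidue g, so J(1) = -2εa by uniqueness of p = a² + b² and a sign
-- determined modulo 4. Modulo p² one may take x Teichmüller and replace ψ(y) by
-- (3yᵐ - y³ᵐ)/2; expanding, only exponents divisible by p - 1 survive, and J(r)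
-- becomes a combination of binom(2n,n), binom(6n,n) and W = binom(6n,3n) ≡ 0 (mod p).
-- The norm equation turns the W-term into p/(4a), which yields D ≡ ε (2a - p/(2a)).
module Submission where

open import Data.Integer.Base as ℤ using (ℤ; +_; -[1+_]; 0ℤ; 1ℤ; -1ℤ; _%ℕ_)
import Data.Integer.DivMod as ℤ
import Data.Integer.Properties as ℤ
open import Data.Integer.Divisibility.Signed using (_∣_; _∣?_; divides; ∣⇒∣ᵤ; ∣ᵤ⇒∣)
open import Data.Integer.Tactic.RingSolver using (solve-∀)
open import Data.Nat.Base as ℕ using (ℕ; zero; suc; _∸_; _%_)
open import Data.Nat.Combinatorics using (_C_; nCk+nC[k+1]≡[n+1]C[k+1]; nCk≡nC[n∸k]; nCn≡1; k>n⇒nCk≡0)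
import Data.Nat.Divisibility as ℕ
import Data.Nat.DivMod as ℕ
import Data.Nat.Induction as ℕ
open import Data.Nat.Primality using (Prime; ¬prime[1]; euclidsLemma; prime⇒irreducible)
import Data.Nat.Properties as ℕ
import Data.Nat.Tactic.RingSolver as ℕSolver
open import Data.Product.Base using (_×_; _,_; proj₁; proj₂; ∃-syntax)
open import Data.Sum.Base as Sum using (_⊎_; inj₁; inj₂)
open import Function.Base using (_∘_; id)
open import Relation.Binary.Definitions using (tri<; tri≈; tri>)
open import Relation.Binary.PropositionalEquality
  using (_≡_; refl; sym; trans; cong; cong₂; subst; module ≡-Reasoning)
open import Relation.Nullary.Decidable using (Dec; yes; no; map′; _×-dec_; ¬?)
open import Relation.Nullary.Negation using (¬_; contradiction)

-- For a Teichmüller x the value y = x² - r is no longer Teichmüller, so y^m gives ψ(y) only modulo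
-- p. One Newton step repairs this, and the cube in it is what raises the exponents to 3m and the
-- upper index of the binomials to 6n. Expanding J(1) alone gives 4a ≡ V - W, where V ≡ 2εD and W is
-- known only to vanish modulo p. The nonresidue supplies a second equation: in J(1) and J(g) the
-- term W has opposite signs, and the common factors outside have squares 1 and -1. The norm
-- equation thus becomes a difference of squares, (U - W)² - (U + W)² with U ≡ V (mod p), which
-- isolates the product UW. Together with W² ≡ 0 (mod p²) this forces 4aW ≡ -4p, that is W ≡ -p/a.
-- All of this takes place in ℤ: a division is a cancellation of a factor prime to p, and the final
-- integer congruence is kept multiplied by 4a. Rational numbers enter only when the result is
-- transferred.

module IntegerCongruences where

  open import Algebra.Bundles using (CommutativeRing)
  open import Algebra.Properties.Semiring.Sum (CommutativeRing.semiring ℤ.+-*-commutativeRing)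
    using (sum; ∑-comm; ∑-distrib-+; *-distribˡ-sum)
  open import Data.Fin.Base using (toℕ)
  open import Data.Integer.Base using (_+_; _-_; _*_; -_; _^_)
  open import Level using (0ℓ)
  open import Relation.Binary.Bundles using (Setoid)
  import Relation.Binary.Reasoning.Setoid as SetoidReasoning

  -- Congruences

  infix 4 _≈_[_]

  record _≈_[_] (x y N : ℤ) : Set where
    constructor mod
    field
      quotient : ℤ
      equality : x - y ≡ quotient * N

  module _ {N : ℤ} where

    ≈-linear : ∀ {x y x₁ y₁} c → x - y ≡ c * (x₁ - y₁) →
               x₁ ≈ y₁ [ N ] → x ≈ y [ N ]
    ≈-linear c e (mod q e₁) =
      mod (c * q) (trans e (trans (cong (c *_) e₁) (sym (ℤ.*-assoc c q N))))

    ≈-linear₂ : ∀ {x y x₁ y₁ x₂ y₂} c₁ c₂ →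
                x - y ≡ c₁ * (x₁ - y₁) + c₂ * (x₂ - y₂) →
                x₁ ≈ y₁ [ N ] → x₂ ≈ y₂ [ N ] → x ≈ y [ N ]
    ≈-linear₂ c₁ c₂ e (mod q₁ e₁) (mod q₂ e₂) =
      mod (c₁ * q₁ + c₂ * q₂)
        (trans e (trans (cong₂ (λ u v → c₁ * u + c₂ * v) e₁ e₂) (distr c₁ q₁ c₂ q₂ N)))
      where
      distr : ∀ c₁ q₁ c₂ q₂ N → c₁ * (q₁ * N) + c₂ * (q₂ * N) ≡ (c₁ * q₁ + c₂ * q₂) * N
      distr = solve-∀

    ≈-linear₃ : ∀ {x y x₁ y₁ x₂ y₂ x₃ y₃} c₁ c₂ c₃ →
                x - y ≡ c₁ * (x₁ - y₁) + c₂ * (x₂ - y₂) + c₃ * (x₃ - y₃) →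
                x₁ ≈ y₁ [ N ] → x₂ ≈ y₂ [ N ] → x₃ ≈ y₃ [ N ] → x ≈ y [ N ]
    ≈-linear₃ c₁ c₂ c₃ e (mod q₁ e₁) (mod q₂ e₂) (mod q₃ e₃) =
      mod (c₁ * q₁ + c₂ * q₂ + c₃ * q₃)
        (trans e (trans (cong₂ _+_ (cong₂ (λ u v → c₁ * u + c₂ * v) e₁ e₂) (cong (c₃ *_) e₃))
                        (distr c₁ q₁ c₂ q₂ c₃ q₃ N)))
      where
      distr : ∀ c₁ q₁ c₂ q₂ c₃ q₃ N →
              c₁ * (q₁ * N) + c₂ * (q₂ * N) + c₃ * (q₃ * N) ≡ (c₁ * q₁ + c₂ * q₂ + c₃ * q₃) * N
      distr = solve-∀

    ≈-reflexive : ∀ {x y} → x ≡ y → x ≈ y [ N ]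
    ≈-reflexive {x} refl = mod 0ℤ (ℤ.+-inverseʳ x)

    ≈-refl : ∀ {x} → x ≈ x [ N ]
    ≈-refl = ≈-reflexive refl

    ≈-sym : ∀ {x y} → x ≈ y [ N ] → y ≈ x [ N ]
    ≈-sym {x} {y} = ≈-linear -1ℤ (eq x y)
      where
      eq : ∀ x y → y - x ≡ -1ℤ * (x - y)
      eq = solve-∀

    ≈-trans : ∀ {x y z} → x ≈ y [ N ] → y ≈ z [ N ] → x ≈ z [ N ]
    ≈-trans {x} {y} {z} = ≈-linear₂ 1ℤ 1ℤ (eq x y z)
      where
      eq : ∀ x y z → x - z ≡ 1ℤ * (x - y) + 1ℤ * (y - z)
      eq = solve-∀

    +-cong : ∀ {x y u v} → x ≈ y [ N ] → u ≈ v [ N ] → x + u ≈ y + v [ N ]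
    +-cong {x} {y} {u} {v} = ≈-linear₂ 1ℤ 1ℤ (eq x y u v)
      where
      eq : ∀ x y u v → x + u - (y + v) ≡ 1ℤ * (x - y) + 1ℤ * (u - v)
      eq = solve-∀

    *-cong : ∀ {x y u v} → x ≈ y [ N ] → u ≈ v [ N ] → x * u ≈ y * v [ N ]
    *-cong {x} {y} {u} {v} = ≈-linear₂ u y (eq x y u v)
      where
      eq : ∀ x y u v → x * u - y * v ≡ u * (x - y) + y * (u - v)
      eq = solve-∀

    *-congˡ : ∀ c {x y} → x ≈ y [ N ] → c * x ≈ c * y [ N ]
    *-congˡ c = *-cong (≈-refl {c})

    *-congʳ : ∀ c {x y} → x ≈ y [ N ] → x * c ≈ y * c [ N ]
    *-congʳ c e = *-cong e (≈-refl {c})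

    neg-cong : ∀ {x y} → x ≈ y [ N ] → - x ≈ - y [ N ]
    neg-cong {x} {y} = ≈-linear -1ℤ (eq x y)
      where
      eq : ∀ x y → - x - (- y) ≡ -1ℤ * (x - y)
      eq = solve-∀

    minus-cong : ∀ {x y u v} → x ≈ y [ N ] → u ≈ v [ N ] → x - u ≈ y - v [ N ]
    minus-cong e f = +-cong e (neg-cong f)

    ^-cong : ∀ {x y} k → x ≈ y [ N ] → x ^ k ≈ y ^ k [ N ]
    ^-cong zero    e = ≈-refl
    ^-cong (suc k) e = *-cong e (^-cong k e)

    ∣⇒≈0 : ∀ {x} → N ∣ x → x ≈ 0ℤ [ N ]
    ∣⇒≈0 {x} (divides q e) = mod q (trans (ℤ.+-identityʳ x) e)

    ≈0⇒∣ : ∀ {x} → x ≈ 0ℤ [ N ] → N ∣ x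
    ≈0⇒∣ {x} (mod q e) = divides q (trans (sym (ℤ.+-identityʳ x)) e)

    ≈⇒∣ : ∀ {x y} → x ≈ y [ N ] → N ∣ x - y
    ≈⇒∣ (mod q e) = divides q e

    ∣⇒≈ : ∀ {x y} → N ∣ x - y → x ≈ y [ N ]
    ∣⇒≈ (divides q e) = mod q e

    multiple≈0 : ∀ c → c * N ≈ 0ℤ [ N ]
    multiple≈0 c = ∣⇒≈0 (divides c refl)

  modulus≈0 : ∀ N → N ≈ 0ℤ [ N ]
  modulus≈0 N = mod 1ℤ (trans (ℤ.+-identityʳ N) (sym (ℤ.*-identityˡ N)))

  ≈-setoid : ℤ → Setoid 0ℓ 0ℓ
  ≈-setoid N = record
    { _≈_           = _≈_[ N ]
    ; isEquivalence = record { refl = ≈-refl ; sym = ≈-sym ; trans = ≈-trans }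
    }

  module ≈-Reasoning (N : ℤ) = SetoidReasoning (≈-setoid N)

  -- Modulus 0 makes congruence into equality, so a lemma proved for an arbitrary modulus also
  -- yields exact identities.
  ≈[0]⇒≡ : ∀ {x y} → x ≈ y [ 0ℤ ] → x ≡ y
  ≈[0]⇒≡ (mod q e) = ℤ.i-j≡0⇒i≡j _ _ (trans e (ℤ.*-zeroʳ q))

  ≈-divisor : ∀ {M N x y} c → N ≡ c * M → x ≈ y [ N ] → x ≈ y [ M ]
  ≈-divisor {M} c refl (mod q e) = mod (q * c) (trans e (sym (ℤ.*-assoc q c M)))

  *-cong-scale : ∀ {N x y} c → x ≈ y [ N ] → c * x ≈ c * y [ c * N ]
  *-cong-scale {N} {x} {y} c (mod q e) =
    mod q (trans (eq₁ c x y) (trans (cong (c *_) e) (eq₂ c q N)))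
    where
    eq₁ : ∀ c x y → c * x - c * y ≡ c * (x - y)
    eq₁ = solve-∀
    eq₂ : ∀ c q N → c * (q * N) ≡ q * (c * N)
    eq₂ = solve-∀

  -- Finite sums

  opaque
    ∑ : ℕ → (ℕ → ℤ) → ℤ
    ∑ n f = sum {n} (f ∘ toℕ)

    ∑-0 : ∀ f → ∑ 0 f ≡ 0ℤ
    ∑-0 f = refl

    ∑-suc : ∀ n f → ∑ (suc n) f ≡ f 0 + ∑ n (f ∘ suc)
    ∑-suc n f = refl

    ∑-+ : ∀ n f g → ∑ n (λ k → f k + g k) ≡ ∑ n f + ∑ n g
    ∑-+ n f g = ∑-distrib-+ {n} (f ∘ toℕ) (g ∘ toℕ)

    ∑-*ˡ : ∀ n c f → ∑ n (λ k → c * f k) ≡ c * ∑ n f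
    ∑-*ˡ n c f = sym (*-distribˡ-sum {n} c (f ∘ toℕ))

    ∑-swap : ∀ m n (f : ℕ → ℕ → ℤ) → ∑ m (λ i → ∑ n (f i)) ≡ ∑ n (λ j → ∑ m (λ i → f i j))
    ∑-swap m n f = ∑-comm {m} {n} λ i j → f (toℕ i) (toℕ j)

    ∑-cong-< : ∀ {N} n {f g} → (∀ k → k ℕ.< n → f k ≈ g k [ N ]) → ∑ n f ≈ ∑ n g [ N ]
    ∑-cong-< zero    e = ≈-refl
    ∑-cong-< (suc n) e = +-cong (e 0 ℕ.z<s) (∑-cong-< n λ k k<n → e (suc k) (ℕ.s<s k<n))

  ∑-cong : ∀ {N} n {f g} → (∀ k → f k ≈ g k [ N ]) → ∑ n f ≈ ∑ n g [ N ]
  ∑-cong n e = ∑-cong-< n λ k _ → e k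

  ∑-cong-≡-< : ∀ n {f g} → (∀ k → k ℕ.< n → f k ≡ g k) → ∑ n f ≡ ∑ n g
  ∑-cong-≡-< n e = ≈[0]⇒≡ (∑-cong-< n λ k k<n → ≈-reflexive (e k k<n))

  ∑-cong-≡ : ∀ n {f g} → (∀ k → f k ≡ g k) → ∑ n f ≡ ∑ n g
  ∑-cong-≡ n e = ∑-cong-≡-< n λ k _ → e k

  ∑-*ʳ : ∀ n c f → ∑ n (λ k → f k * c) ≡ ∑ n f * c
  ∑-*ʳ n c f = trans (∑-cong-≡ n λ k → ℤ.*-comm (f k) c) (trans (∑-*ˡ n c f) (ℤ.*-comm c _))

  ∑-neg : ∀ n f → ∑ n (λ k → - f k) ≡ - ∑ n f
  ∑-neg n f = trans (∑-cong-≡ n λ k → sym (ℤ.-1*i≡-i (f k)))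
                    (trans (∑-*ˡ n -1ℤ f) (ℤ.-1*i≡-i _))

  ∑-minus : ∀ n f g → ∑ n (λ k → f k - g k) ≡ ∑ n f - ∑ n g
  ∑-minus n f g = trans (∑-+ n f (λ k → - g k)) (cong (_+_ (∑ n f)) (∑-neg n g))

  ∑-const : ∀ n c → ∑ n (λ _ → c) ≡ + n * c
  ∑-const zero    c = ∑-0 (λ _ → c)
  ∑-const (suc n) c = trans (∑-suc n _) (trans (cong (_+_ c) (∑-const n c)) (eq c (+ n)))
    where
    eq : ∀ c ν → c + ν * c ≡ (1ℤ + ν) * c
    eq = solve-∀

  ∑-zero : ∀ n → ∑ n (λ _ → 0ℤ) ≡ 0ℤ
  ∑-zero n = trans (∑-const n 0ℤ) (ℤ.*-zeroʳ (+ n))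

  ∑-last : ∀ n f → ∑ (suc n) f ≡ ∑ n f + f n
  ∑-last zero    f = trans (∑-suc 0 f) (trans (cong (_+_ (f 0)) (∑-0 (f ∘ suc)))
    (trans (ℤ.+-comm (f 0) 0ℤ) (cong (_+ f 0) (sym (∑-0 f)))))
  ∑-last (suc n) f = trans (∑-suc (suc n) f) (trans (cong (_+_ (f 0)) (∑-last n (f ∘ suc)))
    (trans (sym (ℤ.+-assoc (f 0) _ _)) (cong (_+ f (suc n)) (sym (∑-suc n f)))))

  ∑-split : ∀ m n f → ∑ (m ℕ.+ n) f ≡ ∑ m f + ∑ n (λ k → f (m ℕ.+ k))
  ∑-split zero    n f = sym (trans (cong (_+ ∑ n f) (∑-0 f)) (ℤ.+-identityˡ _))
  ∑-split (suc m) n f = trans (∑-suc (m ℕ.+ n) f) (trans (cong (_+_ (f 0)) (∑-split m n (f ∘ suc)))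
    (trans (sym (ℤ.+-assoc (f 0) _ _)) (cong (_+ ∑ n (λ k → f (suc m ℕ.+ k))) (sym (∑-suc m f)))))

  ∑-single : ∀ {N} n r {f} → r ℕ.< n → (∀ k → k ℕ.< n → ¬ k ≡ r → f k ≈ 0ℤ [ N ]) →
             ∑ n f ≈ f r [ N ]
  ∑-single (suc n) zero    {f} _ e = ≈-trans (≈-reflexive (∑-suc n f)) (≈-trans
    (+-cong (≈-refl {x = f 0}) (≈-trans (∑-cong-< n λ k k<n → e (suc k) (ℕ.s<s k<n) λ ())
                            (≈-reflexive (∑-zero n))))
    (≈-reflexive (ℤ.+-identityʳ (f 0))))
  ∑-single (suc n) (suc r) {f} (ℕ.s≤s r<n) e = ≈-trans (≈-reflexive (∑-suc n f)) (≈-trans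
    (+-cong (e 0 ℕ.z<s λ ()) (∑-single n r r<n λ k k<n k≢r → e (suc k) (ℕ.s<s k<n) (k≢r ∘ ℕ.suc-injective)))
    (≈-reflexive (ℤ.+-identityˡ (f (suc r)))))

  -- Binomial coefficients and binomial sums

  opaque
    binom : ℕ → ℕ → ℤ
    binom n k = + (n C k)

    binom≡C : ∀ n k → binom n k ≡ + (n C k)
    binom≡C n k = refl

    binom-0 : ∀ n → binom n 0 ≡ 1ℤ
    binom-0 n = cong +_ (trans (nCk≡nC[n∸k] {0} {n} ℕ.z≤n) (nCn≡1 n))

    binom-> : ∀ {n k} → n ℕ.< k → binom n k ≡ 0ℤ
    binom-> n<k = cong +_ (k>n⇒nCk≡0 n<k)

    pascal : ∀ n k → binom (suc n) (suc k) ≡ binom n k + binom n (suc k)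
    pascal n k = cong +_ (sym (nCk+nC[k+1]≡[n+1]C[k+1] n k))

  binom-absorb : ∀ n k → (1ℤ + + k) * binom (suc n) (suc k) ≡ (1ℤ + + n) * binom n k
  binom-absorb zero zero = cong (1ℤ *_) (trans (pascal 0 0)
    (trans (cong (_+_ (binom 0 0)) (binom-> {0} {1} ℕ.z<s)) (ℤ.+-identityʳ _)))
  binom-absorb zero (suc k) = trans
    (cong ((1ℤ + + suc k) *_) (binom-> {1} {suc (suc k)} (ℕ.s<s ℕ.z<s)))
    (trans (ℤ.*-zeroʳ (1ℤ + + suc k)) (sym (trans (ℤ.*-identityˡ _) (binom-> {0} {suc k} ℕ.z<s))))
  binom-absorb (suc n) zero = begin
    1ℤ * binom (suc (suc n)) 1                 ≡⟨ cong (1ℤ *_) (pascal (suc n) 0) ⟩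
    1ℤ * (binom (suc n) 0 + binom (suc n) 1)   ≡⟨ eq₁ (binom (suc n) 0) (binom (suc n) 1) ⟩
    binom (suc n) 0 + 1ℤ * binom (suc n) 1     ≡⟨ cong₂ _+_ (binom-0 (suc n)) (binom-absorb n 0) ⟩
    1ℤ + (1ℤ + + n) * binom n 0                ≡⟨ cong (λ b → 1ℤ + (1ℤ + + n) * b) (binom-0 n) ⟩
    1ℤ + (1ℤ + + n) * 1ℤ                       ≡⟨ eq₂ (+ n) ⟩
    (1ℤ + + suc n) * 1ℤ                        ≡⟨ cong ((1ℤ + + suc n) *_) (sym (binom-0 (suc n))) ⟩
    (1ℤ + + suc n) * binom (suc n) 0           ∎
    where
    open ≡-Reasoning
    eq₁ : ∀ a b → 1ℤ * (a + b) ≡ a + 1ℤ * b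
    eq₁ = solve-∀
    eq₂ : ∀ ν → 1ℤ + (1ℤ + ν) * 1ℤ ≡ (1ℤ + (1ℤ + ν)) * 1ℤ
    eq₂ = solve-∀
  binom-absorb (suc n) (suc k) = begin
    (1ℤ + + suc k) * binom (suc (suc n)) (suc (suc k))
      ≡⟨ cong ((1ℤ + + suc k) *_) (pascal (suc n) (suc k)) ⟩
    (1ℤ + + suc k) * (b + binom (suc n) (suc (suc k)))
      ≡⟨ eq₁ (+ k) b (binom (suc n) (suc (suc k))) ⟩
    (1ℤ + + k) * b + b + (1ℤ + + suc k) * binom (suc n) (suc (suc k))
      ≡⟨ cong₂ (λ u v → u + b + v) (binom-absorb n k) (binom-absorb n (suc k)) ⟩
    (1ℤ + + n) * binom n k + b + (1ℤ + + n) * binom n (suc k)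
      ≡⟨ eq₂ (+ n) (binom n k) (binom n (suc k)) b ⟩
    (1ℤ + + n) * (binom n k + binom n (suc k)) + b
      ≡⟨ cong (λ u → (1ℤ + + n) * u + b) (sym (pascal n k)) ⟩
    (1ℤ + + n) * b + b
      ≡⟨ eq₃ (+ n) b ⟩
    (1ℤ + + suc n) * b ∎
    where
    open ≡-Reasoning
    b = binom (suc n) (suc k)
    eq₁ : ∀ κ b d → (1ℤ + (1ℤ + κ)) * (b + d) ≡ (1ℤ + κ) * b + b + (1ℤ + (1ℤ + κ)) * d
    eq₁ = solve-∀
    eq₂ : ∀ ν c d b → (1ℤ + ν) * c + b + (1ℤ + ν) * d ≡ (1ℤ + ν) * (c + d) + b
    eq₂ = solve-∀
    eq₃ : ∀ ν b → (1ℤ + ν) * b + b ≡ (1ℤ + (1ℤ + ν)) * b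
    eq₃ = solve-∀

  binom-suc-upper : ∀ n k → (1ℤ + + n - + k) * binom (suc n) k ≡ (1ℤ + + n) * binom n k
  binom-suc-upper n zero = cong₂ _*_ (ℤ.+-identityʳ (1ℤ + + n)) (trans (binom-0 (suc n)) (sym (binom-0 n)))
  binom-suc-upper n (suc k) = begin
    (1ℤ + + n - + suc k) * binom (suc n) (suc k)
      ≡⟨ eq₁ (+ n) (+ k) (binom (suc n) (suc k)) ⟩
    (1ℤ + + n) * binom (suc n) (suc k) - (1ℤ + + k) * binom (suc n) (suc k)
      ≡⟨ cong₂ (λ u v → (1ℤ + + n) * u - v) (pascal n k) (binom-absorb n k) ⟩
    (1ℤ + + n) * (binom n k + binom n (suc k)) - (1ℤ + + n) * binom n k
      ≡⟨ eq₂ (+ n) (binom n k) (binom n (suc k)) ⟩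
    (1ℤ + + n) * binom n (suc k) ∎
    where
    open ≡-Reasoning
    eq₁ : ∀ ν κ b → (1ℤ + ν - (1ℤ + κ)) * b ≡ (1ℤ + ν) * b - (1ℤ + κ) * b
    eq₁ = solve-∀
    eq₂ : ∀ ν c d → (1ℤ + ν) * (c + d) - (1ℤ + ν) * c ≡ (1ℤ + ν) * d
    eq₂ = solve-∀

  opaque
    binomSum : ℕ → (ℕ → ℤ) → ℤ
    binomSum m h = ∑ (suc m) λ i → binom m i * h i

    binomSum≡∑ : ∀ m h → binomSum m h ≡ ∑ (suc m) (λ i → binom m i * h i)
    binomSum≡∑ m h = refl

    binomSum-0 : ∀ h → binomSum 0 h ≡ h 0
    binomSum-0 h = trans (trans (∑-suc 0 _) (cong (_+_ (binom 0 0 * h 0)) (∑-0 _))) (trans (ℤ.+-identityʳ _) (trans (cong (_* h 0) (binom-0 0)) (ℤ.*-identityˡ (h 0))))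

    binomSum-cong-< : ∀ {N} m {g h} → (∀ i → i ℕ.≤ m → g i ≈ h i [ N ]) → binomSum m g ≈ binomSum m h [ N ]
    binomSum-cong-< m {g} {h} e = ∑-cong-< (suc m) λ i i<m → *-congˡ (binom m i) (e i (ℕ.s≤s⁻¹ i<m))

    binomSum-cong-≡ : ∀ m {g h} → (∀ i → g i ≡ h i) → binomSum m g ≡ binomSum m h
    binomSum-cong-≡ m e = ∑-cong-≡ (suc m) λ i → cong (binom m i *_) (e i)

    binomSum-+ : ∀ m g h → binomSum m (λ i → g i + h i) ≡ binomSum m g + binomSum m h
    binomSum-+ m g h = trans (∑-cong-≡ (suc m) λ i → ℤ.*-distribˡ-+ (binom m i) (g i) (h i))
                             (∑-+ (suc m) (λ i → binom m i * g i) (λ i → binom m i * h i))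

    binomSum-*ˡ : ∀ m c h → binomSum m (λ i → c * h i) ≡ c * binomSum m h
    binomSum-*ˡ m c h = trans (∑-cong-≡ (suc m) λ i → eq (binom m i) c (h i))
                              (∑-*ˡ (suc m) c (λ i → binom m i * h i))
      where
      eq : ∀ b c x → b * (c * x) ≡ c * (b * x)
      eq = solve-∀

    -- Pascal's rule as an operator: raising m by one replaces h by h + h ∘ suc. The inductions on m
    -- below use the binomials only through this step.
    binomSum-suc : ∀ m h → binomSum (suc m) h ≡ binomSum m (λ i → h i + h (suc i))
    binomSum-suc m h = begin
      ∑ (suc (suc m)) (λ i → binom (suc m) i * h i)
        ≡⟨ ∑-suc (suc m) _ ⟩
      binom (suc m) 0 * h 0 + ∑ (suc m) (λ i → binom (suc m) (suc i) * h (suc i))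
        ≡⟨ cong₂ (λ u v → u * h 0 + v) (trans (binom-0 (suc m)) (sym (binom-0 m)))
             (trans (∑-cong-≡ (suc m) λ i → trans (cong (_* h (suc i)) (pascal m i))
                                                  (ℤ.*-distribʳ-+ (h (suc i)) (binom m i) (binom m (suc i))))
                    (∑-+ (suc m) (λ i → binom m i * h (suc i)) _)) ⟩
      binom m 0 * h 0 + (binomSum m (h ∘ suc) + ∑ (suc m) (λ i → binom m (suc i) * h (suc i)))
        ≡⟨ eq (binom m 0 * h 0) (binomSum m (h ∘ suc)) _ ⟩
      binom m 0 * h 0 + ∑ (suc m) (λ i → binom m (suc i) * h (suc i)) + binomSum m (h ∘ suc)
        ≡⟨ cong (_+ binomSum m (h ∘ suc)) (sym (∑-suc (suc m) _)) ⟩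
      ∑ (suc (suc m)) (λ i → binom m i * h i) + binomSum m (h ∘ suc)
        ≡⟨ cong (_+ binomSum m (h ∘ suc)) (∑-last (suc m) (λ i → binom m i * h i)) ⟩
      binomSum m h + binom m (suc m) * h (suc m) + binomSum m (h ∘ suc)
        ≡⟨ cong (λ u → binomSum m h + u * h (suc m) + binomSum m (h ∘ suc)) (binom-> {m} {suc m} ℕ.≤-refl) ⟩
      binomSum m h + 0ℤ + binomSum m (h ∘ suc)
        ≡⟨ cong (_+ binomSum m (h ∘ suc)) (ℤ.+-identityʳ (binomSum m h)) ⟩
      binomSum m h + binomSum m (h ∘ suc)
        ≡⟨ sym (binomSum-+ m h (h ∘ suc)) ⟩
      binomSum m (λ i → h i + h (suc i)) ∎
      where
      open ≡-Reasoning
      eq : ∀ a b c → a + (b + c) ≡ a + c + b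
      eq = solve-∀

  binomial-theorem : ∀ m x y → (x + y) ^ m ≡ binomSum m (λ i → x ^ i * y ^ (m ℕ.∸ i))
  binomial-theorem zero    x y = sym (binomSum-0 (λ i → x ^ i * y ^ (0 ℕ.∸ i)))
  binomial-theorem (suc m) x y = begin
    (x + y) * (x + y) ^ m
      ≡⟨ cong ((x + y) *_) (binomial-theorem m x y) ⟩
    (x + y) * binomSum m (λ i → x ^ i * y ^ (m ℕ.∸ i))
      ≡⟨ sym (binomSum-*ˡ m (x + y) _) ⟩
    binomSum m (λ i → (x + y) * (x ^ i * y ^ (m ℕ.∸ i)))
      ≡⟨ ≈[0]⇒≡ (binomSum-cong-< m λ i i≤m → ≈-reflexive (trans (eq x y (x ^ i) (y ^ (m ℕ.∸ i)))
           (cong (λ e → x ^ i * y ^ e + x ^ suc i * y ^ (m ℕ.∸ i)) (sym (ℕ.+-∸-assoc 1 i≤m))))) ⟩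
    binomSum m (λ i → x ^ i * y ^ (suc m ℕ.∸ i) + x ^ suc i * y ^ (m ℕ.∸ i))
      ≡⟨ sym (binomSum-suc m (λ i → x ^ i * y ^ (suc m ℕ.∸ i))) ⟩
    binomSum (suc m) (λ i → x ^ i * y ^ (suc m ℕ.∸ i)) ∎
    where
    open ≡-Reasoning
    eq : ∀ x y a b → (x + y) * (a * b) ≡ a * (y * b) + x * a * b
    eq = solve-∀

  -- coeff a is the sequence of coefficients of (1 + x) ^ a, and invCoeff t
  -- that of (1 - x) ^ (- (1 + t)), both indexed by ℤ.
  coeff : ℕ → ℤ → ℤ
  coeff a (+ k)    = binom a k
  coeff a -[1+ k ] = 0ℤ

  invCoeff : ℕ → ℤ → ℤ
  invCoeff t (+ k)    = binom (t ℕ.+ k) k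
  invCoeff t -[1+ k ] = 0ℤ

  -- Multiplication by 1 + x. Because the sequence is extended by zero to negative indices, Pascal's
  -- rule also covers the passage from index -1 to 0.
  coeff-suc : ∀ a z → coeff (suc a) (1ℤ + z) ≡ coeff a z + coeff a (1ℤ + z)
  coeff-suc a (+ k)          = pascal a k
  coeff-suc a -[1+ zero ]    = trans (binom-0 (suc a)) (sym (trans (ℤ.+-identityˡ (binom a 0)) (binom-0 a)))
  coeff-suc a -[1+ suc k ]   = refl

  invCoeff-suc : ∀ t z → invCoeff (suc t) (1ℤ + z) ≡ invCoeff (suc t) z + invCoeff t (1ℤ + z)
  invCoeff-suc t (+ k) = trans (pascal (t ℕ.+ suc k) k)
    (cong (λ a → binom a k + binom (t ℕ.+ suc k) (suc k)) (ℕ.+-suc t k))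
  invCoeff-suc t -[1+ zero ]  =
    trans (binom-0 (suc t ℕ.+ 0)) (sym (trans (ℤ.+-identityˡ (binom (t ℕ.+ 0) 0)) (binom-0 (t ℕ.+ 0))))
  invCoeff-suc t -[1+ suc k ] = refl

  vandermonde : ∀ m a z → binomSum m (λ i → coeff a (z - + i)) ≡ coeff (m ℕ.+ a) z
  vandermonde zero    a z = trans (binomSum-0 _) (cong (coeff a) (ℤ.+-identityʳ z))
  vandermonde (suc m) a z = begin
    binomSum (suc m) (λ i → coeff a (z - + i))
      ≡⟨ binomSum-suc m _ ⟩
    binomSum m (λ i → coeff a (z - + i) + coeff a (z - + suc i))
      ≡⟨ binomSum-cong-≡ m (λ i → trans (ℤ.+-comm (coeff a (z - + i)) (coeff a (z - + suc i))) (trans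
           (cong (λ u → coeff a (z - + suc i) + coeff a u) (eq z (+ i)))
           (trans (sym (coeff-suc a (z - + suc i))) (cong (coeff (suc a)) (sym (eq z (+ i))))))) ⟩
    binomSum m (λ i → coeff (suc a) (z - + i))
      ≡⟨ vandermonde m (suc a) z ⟩
    coeff (m ℕ.+ suc a) z
      ≡⟨ cong (λ b → coeff b z) (ℕ.+-suc m a) ⟩
    coeff (suc m ℕ.+ a) z ∎
    where
    open ≡-Reasoning
    eq : ∀ z ι → z - ι ≡ 1ℤ + (z - (1ℤ + ι))
    eq = solve-∀

  -- (1 + x) ^ m (1 - x) ^ (- 1 - t) = (1 - x²) ^ m (1 - x) ^ (- 1 - t - m)
  binomSum-invCoeff : ∀ m t z →
    binomSum m (λ j → invCoeff t (z + + j)) ≡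
    binomSum m (λ i → -1ℤ ^ i * invCoeff (t ℕ.+ m) (z + + m - (+ i + + i)))
  binomSum-invCoeff zero    t z = trans (binomSum-0 _) (sym (trans (binomSum-0 _)
    (trans (ℤ.*-identityˡ _) (cong₂ invCoeff (ℕ.+-identityʳ t) (eq z)))))
    where
    eq : ∀ z → z + 0ℤ - (0ℤ + 0ℤ) ≡ z + 0ℤ
    eq = solve-∀
  binomSum-invCoeff (suc m) t z = begin
    binomSum (suc m) (λ j → invCoeff t (z + + j))
      ≡⟨ binomSum-suc m _ ⟩
    binomSum m (λ j → invCoeff t (z + + j) + invCoeff t (z + + suc j))
      ≡⟨ binomSum-cong-≡ m (λ j → cong (λ u → invCoeff t (z + + j) + invCoeff t u) (eq₁ z (+ j))) ⟩
    binomSum m (λ j → invCoeff t (z + + j) + invCoeff t (1ℤ + z + + j))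
      ≡⟨ binomSum-+ m _ _ ⟩
    binomSum m (λ j → invCoeff t (z + + j)) + binomSum m (λ j → invCoeff t (1ℤ + z + + j))
      ≡⟨ cong₂ _+_ (binomSum-invCoeff m t z) (binomSum-invCoeff m t (1ℤ + z)) ⟩
    binomSum m (λ i → -1ℤ ^ i * q (y z i)) + binomSum m (λ i → -1ℤ ^ i * q (y (1ℤ + z) i))
      ≡⟨ sym (binomSum-+ m _ _) ⟩
    binomSum m (λ i → -1ℤ ^ i * q (y z i) + -1ℤ ^ i * q (y (1ℤ + z) i))
      ≡⟨ binomSum-cong-≡ m pointwise ⟩
    binomSum m (λ i → -1ℤ ^ i * q⁺ (y⁺ i) + -1ℤ ^ suc i * q⁺ (y⁺ (suc i)))
      ≡⟨ sym (binomSum-suc m (λ i → -1ℤ ^ i * q⁺ (y⁺ i))) ⟩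
    binomSum (suc m) (λ i → -1ℤ ^ i * q⁺ (y⁺ i))
      ≡⟨ binomSum-cong-≡ (suc m) (λ i → cong (λ s → -1ℤ ^ i * invCoeff s (y⁺ i)) (sym (ℕ.+-suc t m))) ⟩
    binomSum (suc m) (λ i → -1ℤ ^ i * invCoeff (t ℕ.+ suc m) (z + + suc m - (+ i + + i))) ∎
    where
    open ≡-Reasoning
    q q⁺ : ℤ → ℤ
    q  = invCoeff (t ℕ.+ m)
    q⁺ = invCoeff (suc (t ℕ.+ m))
    y : ℤ → ℕ → ℤ
    y z i = z + + m - (+ i + + i)
    y⁺ : ℕ → ℤ
    y⁺ i = z + + suc m - (+ i + + i)

    eq₁ : ∀ z ι → z + (1ℤ + ι) ≡ 1ℤ + z + ι
    eq₁ = solve-∀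
    eq₂ : ∀ z μ ι → z + (1ℤ + μ) - (ι + ι) ≡ 1ℤ + (z + μ - (ι + ι))
    eq₂ = solve-∀
    eq₃ : ∀ z μ ι → 1ℤ + z + μ - (ι + ι) ≡ 1ℤ + (z + μ - (ι + ι))
    eq₃ = solve-∀
    eq₄ : ∀ z μ ι → z + μ - (ι + ι) ≡ 1ℤ + (z + (1ℤ + μ) - ((1ℤ + ι) + (1ℤ + ι)))
    eq₄ = solve-∀
    eq₅ : ∀ s a b c → s * (a + b + c) + -1ℤ * s * a ≡ s * b + s * c
    eq₅ = solve-∀

    pointwise : ∀ i → -1ℤ ^ i * q (y z i) + -1ℤ ^ i * q (y (1ℤ + z) i) ≡
                      -1ℤ ^ i * q⁺ (y⁺ i) + -1ℤ ^ suc i * q⁺ (y⁺ (suc i))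
    pointwise i = sym (begin
      s * q⁺ (y⁺ i) + -1ℤ * s * q⁺ (y⁺ (suc i))
        ≡⟨ cong (λ u → s * u + -1ℤ * s * q⁺ (y⁺ (suc i))) (begin
             q⁺ (y⁺ i)                            ≡⟨ cong q⁺ (eq₂ z (+ m) (+ i)) ⟩
             q⁺ (1ℤ + y z i)                      ≡⟨ invCoeff-suc (t ℕ.+ m) (y z i) ⟩
             q⁺ (y z i) + q (1ℤ + y z i)          ≡⟨ cong₂ _+_
               (trans (cong q⁺ (eq₄ z (+ m) (+ i)))
                 (trans (invCoeff-suc (t ℕ.+ m) (y⁺ (suc i)))
                   (cong (λ u → q⁺ (y⁺ (suc i)) + q u) (sym (eq₄ z (+ m) (+ i))))))
               (cong q (sym (eq₃ z (+ m) (+ i)))) ⟩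
             q⁺ (y⁺ (suc i)) + q (y z i) + q (y (1ℤ + z) i) ∎) ⟩
      s * (q⁺ (y⁺ (suc i)) + q (y z i) + q (y (1ℤ + z) i)) + -1ℤ * s * q⁺ (y⁺ (suc i))
        ≡⟨ eq₅ s (q⁺ (y⁺ (suc i))) (q (y z i)) (q (y (1ℤ + z) i)) ⟩
      s * q (y z i) + s * q (y (1ℤ + z) i) ∎)
      where s = -1ℤ ^ i

  -- Both sides are the coefficient of x^(z + m) in (x - 1)^m (1 - x)^(-1 - t - m) = (-1)^m (1 -
  -- x)^(-1 - t).
  binomSum-signed-invCoeff : ∀ m t z →
    binomSum m (λ j → -1ℤ ^ j * invCoeff (t ℕ.+ m) (z + + j)) ≡ -1ℤ ^ m * invCoeff t (z + + m)
  binomSum-signed-invCoeff zero    t z =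
    trans (binomSum-0 _) (cong (λ s → 1ℤ * invCoeff s (z + 0ℤ)) (ℕ.+-identityʳ t))
  binomSum-signed-invCoeff (suc m) t z = begin
    binomSum (suc m) (λ j → -1ℤ ^ j * invCoeff (t ℕ.+ suc m) (z + + j))
      ≡⟨ binomSum-cong-≡ (suc m) (λ j → cong (λ s → -1ℤ ^ j * invCoeff s (z + + j)) (ℕ.+-suc t m)) ⟩
    binomSum (suc m) (λ j → -1ℤ ^ j * q⁺ (z + + j))
      ≡⟨ binomSum-suc m _ ⟩
    binomSum m (λ j → -1ℤ ^ j * q⁺ (z + + j) + -1ℤ ^ suc j * q⁺ (z + + suc j))
      ≡⟨ binomSum-cong-≡ m pointwise ⟩
    binomSum m (λ j → -1ℤ * (-1ℤ ^ j * q (1ℤ + z + + j)))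
      ≡⟨ binomSum-*ˡ m -1ℤ _ ⟩
    -1ℤ * binomSum m (λ j → -1ℤ ^ j * q (1ℤ + z + + j))
      ≡⟨ cong (-1ℤ *_) (binomSum-signed-invCoeff m t (1ℤ + z)) ⟩
    -1ℤ * (-1ℤ ^ m * invCoeff t (1ℤ + z + + m))
      ≡⟨ sym (ℤ.*-assoc -1ℤ (-1ℤ ^ m) _) ⟩
    -1ℤ ^ suc m * invCoeff t (1ℤ + z + + m)
      ≡⟨ cong (λ u → -1ℤ ^ suc m * invCoeff t u) (eq₁ z (+ m)) ⟩
    -1ℤ ^ suc m * invCoeff t (z + + suc m) ∎
    where
    open ≡-Reasoning
    q q⁺ : ℤ → ℤ
    q  = invCoeff (t ℕ.+ m)
    q⁺ = invCoeff (suc (t ℕ.+ m))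
    eq₁ : ∀ z ι → 1ℤ + z + ι ≡ z + (1ℤ + ι)
    eq₁ = solve-∀
    eq₂ : ∀ z ι → z + (1ℤ + ι) ≡ 1ℤ + (z + ι)
    eq₂ = solve-∀
    eq₃ : ∀ z ι → 1ℤ + (z + ι) ≡ 1ℤ + z + ι
    eq₃ = solve-∀
    eq₄ : ∀ s a b → s * a + -1ℤ * s * (a + b) ≡ -1ℤ * (s * b)
    eq₄ = solve-∀
    pointwise : ∀ j → -1ℤ ^ j * q⁺ (z + + j) + -1ℤ ^ suc j * q⁺ (z + + suc j) ≡
                      -1ℤ * (-1ℤ ^ j * q (1ℤ + z + + j))
    pointwise j = trans
      (cong (λ u → -1ℤ ^ j * q⁺ (z + + j) + -1ℤ ^ suc j * u)
        (trans (cong q⁺ (eq₂ z (+ j)))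
          (trans (invCoeff-suc (t ℕ.+ m) (z + + j)) (cong (λ u → q⁺ (z + + j) + q u) (eq₃ z (+ j))))))
      (eq₄ (-1ℤ ^ j) (q⁺ (z + + j)) (q (1ℤ + z + + j)))

  binom-self : ∀ n → binom n n ≡ 1ℤ
  binom-self n = trans (binom≡C n n) (cong +_ (nCn≡1 n))

  binom-suc-lower : ∀ n k → (1ℤ + + k) * binom n (suc k) ≡ (+ n - + k) * binom n k
  binom-suc-lower n k = begin
    (1ℤ + + k) * binom n (suc k)
      ≡⟨ eq₁ (+ k) (binom n k) (binom n (suc k)) ⟩
    (1ℤ + + k) * (binom n k + binom n (suc k)) - (1ℤ + + k) * binom n k
      ≡⟨ cong (λ b → (1ℤ + + k) * b - (1ℤ + + k) * binom n k) (sym (pascal n k)) ⟩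
    (1ℤ + + k) * binom (suc n) (suc k) - (1ℤ + + k) * binom n k
      ≡⟨ cong (_- (1ℤ + + k) * binom n k) (binom-absorb n k) ⟩
    (1ℤ + + n) * binom n k - (1ℤ + + k) * binom n k
      ≡⟨ eq₂ (+ n) (+ k) (binom n k) ⟩
    (+ n - + k) * binom n k ∎
    where
    open ≡-Reasoning
    eq₁ : ∀ κ b d → (1ℤ + κ) * d ≡ (1ℤ + κ) * (b + d) - (1ℤ + κ) * b
    eq₁ = solve-∀
    eq₂ : ∀ ν κ b → (1ℤ + ν) * b - (1ℤ + κ) * b ≡ (ν - κ) * b
    eq₂ = solve-∀

  central-binom-suc : ∀ j → (1ℤ + + j) * binom (suc j ℕ.+ suc j) (suc j) ≡
                            + 2 * (1ℤ + (+ j + + j)) * binom (j ℕ.+ j) j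
  central-binom-suc j = ℤ.*-cancelˡ-≡ (1ℤ + + j) _ _ (begin
    (1ℤ + + j) * ((1ℤ + + j) * binom (suc j ℕ.+ suc j) (suc j))
      ≡⟨ cong (λ k → (1ℤ + + j) * ((1ℤ + + j) * binom (suc k) (suc j))) (ℕ.+-suc j j) ⟩
    (1ℤ + + j) * ((1ℤ + + j) * binom (suc (suc (j ℕ.+ j))) (suc j))
      ≡⟨ cong ((1ℤ + + j) *_) (binom-absorb (suc (j ℕ.+ j)) j) ⟩
    (1ℤ + + j) * ((1ℤ + (1ℤ + (+ j + + j))) * binom (suc (j ℕ.+ j)) j)
      ≡⟨ eq₁ (+ j) (binom (suc (j ℕ.+ j)) j) ⟩
    + 2 * (1ℤ + + j) * ((1ℤ + (+ j + + j) - + j) * binom (suc (j ℕ.+ j)) j)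
      ≡⟨ cong (+ 2 * (1ℤ + + j) *_) (binom-suc-upper (j ℕ.+ j) j) ⟩
    + 2 * (1ℤ + + j) * ((1ℤ + (+ j + + j)) * binom (j ℕ.+ j) j)
      ≡⟨ eq₂ (+ j) (binom (j ℕ.+ j) j) ⟩
    (1ℤ + + j) * (+ 2 * (1ℤ + (+ j + + j)) * binom (j ℕ.+ j) j) ∎)
    where
    open ≡-Reasoning
    eq₁ : ∀ ι b → (1ℤ + ι) * ((1ℤ + (1ℤ + (ι + ι))) * b) ≡ + 2 * (1ℤ + ι) * ((1ℤ + (ι + ι) - ι) * b)
    eq₁ = solve-∀
    eq₂ : ∀ ι b → + 2 * (1ℤ + ι) * ((1ℤ + (ι + ι)) * b) ≡ (1ℤ + ι) * (+ 2 * (1ℤ + (ι + ι)) * b)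
    eq₂ = solve-∀

  -1^n*-1^n≡1 : ∀ n → -1ℤ ^ n * -1ℤ ^ n ≡ 1ℤ
  -1^n*-1^n≡1 zero    = refl
  -1^n*-1^n≡1 (suc n) = trans (eq (-1ℤ ^ n)) (-1^n*-1^n≡1 n)
    where
    eq : ∀ s → -1ℤ * s * (-1ℤ * s) ≡ s * s
    eq = solve-∀

  -- The binomials of the theorem correspond to even j = 2k only; this filter recovers them from
  -- sums over all j, which have closed forms.
  ∑-even-terms : ∀ n (w : ℕ → ℤ) → ∑ (suc (n ℕ.+ n)) (λ j → (1ℤ + -1ℤ ^ j) * w j) ≡
                         + 2 * ∑ (suc n) (λ k → w (k ℕ.+ k))
  ∑-even-terms zero    w = trans (∑-suc 0 _) (trans (cong (_+_ (+ 2 * w 0)) (∑-0 _))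
    (trans (eq (w 0)) (cong (+ 2 *_) (sym (trans (∑-suc 0 _) (cong (_+_ (w 0)) (∑-0 _)))))))
    where
    eq : ∀ u → + 2 * u + 0ℤ ≡ + 2 * (u + 0ℤ)
    eq = solve-∀
  ∑-even-terms (suc n) w = begin
    ∑ (suc (suc n ℕ.+ suc n)) (λ j → (1ℤ + -1ℤ ^ j) * w j)
      ≡⟨ cong (λ k → ∑ (suc (suc k)) (λ j → (1ℤ + -1ℤ ^ j) * w j)) (ℕ.+-suc n n) ⟩
    ∑ (suc (suc (suc (n ℕ.+ n)))) (λ j → (1ℤ + -1ℤ ^ j) * w j)
      ≡⟨ trans (∑-suc (suc (suc (n ℕ.+ n))) _) (cong (_+_ (+ 2 * w 0)) (∑-suc (suc (n ℕ.+ n)) _)) ⟩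
    + 2 * w 0 + (0ℤ * w 1 + ∑ (suc (n ℕ.+ n)) (λ j → (1ℤ + -1ℤ ^ suc (suc j)) * w (suc (suc j))))
      ≡⟨ cong (λ u → + 2 * w 0 + (0ℤ * w 1 + u))
           (∑-cong-≡ (suc (n ℕ.+ n)) λ j → eq₁ (-1ℤ ^ j) (w (suc (suc j)))) ⟩
    + 2 * w 0 + (0ℤ * w 1 + ∑ (suc (n ℕ.+ n)) (λ j → (1ℤ + -1ℤ ^ j) * w (suc (suc j))))
      ≡⟨ cong (λ u → + 2 * w 0 + (0ℤ * w 1 + u)) (∑-even-terms n (w ∘ suc ∘ suc)) ⟩
    + 2 * w 0 + (0ℤ * w 1 + + 2 * ∑ (suc n) (λ k → w (suc (suc (k ℕ.+ k)))))
      ≡⟨ eq₂ (w 0) (w 1) _ ⟩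
    + 2 * (w 0 + ∑ (suc n) (λ k → w (suc (suc (k ℕ.+ k)))))
      ≡⟨ cong (λ u → + 2 * (w 0 + u)) (∑-cong-≡ (suc n) λ k → cong (w ∘ suc) (sym (ℕ.+-suc k k))) ⟩
    + 2 * (w 0 + ∑ (suc n) (λ k → w (suc k ℕ.+ suc k)))
      ≡⟨ cong (+ 2 *_) (sym (∑-suc (suc n) _)) ⟩
    + 2 * ∑ (suc (suc n)) (λ k → w (k ℕ.+ k)) ∎
    where
    open ≡-Reasoning
    eq₁ : ∀ s u → (1ℤ + -1ℤ * (-1ℤ * s)) * u ≡ (1ℤ + s) * u
    eq₁ = solve-∀
    eq₂ : ∀ a b c → + 2 * a + (0ℤ * b + + 2 * c) ≡ + 2 * (a + c)
    eq₂ = solve-∀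

  -- Arithmetic modulo a prime and its square

  module PrimeModulus (p-1 : ℕ) (prime : Prime (suc p-1)) where

    private
      p = suc p-1

    P P² : ℤ
    P  = + p
    P² = P * P

    P∣*⇒P∣⊎P∣ : ∀ {x y} → P ∣ x * y → P ∣ x ⊎ P ∣ y
    P∣*⇒P∣⊎P∣ {x} {y} P∣xy = Sum.map ∣ᵤ⇒∣ ∣ᵤ⇒∣
      (euclidsLemma ℤ.∣ x ∣ ℤ.∣ y ∣ prime (subst (p ℕ.∣_) (ℤ.abs-* x y) (∣⇒∣ᵤ P∣xy)))

    P∣*⇒P∣ : ∀ {c x} → ¬ P ∣ c → P ∣ c * x → P ∣ x
    P∣*⇒P∣ {c} {x} P∤c P∣cx with P∣*⇒P∣⊎P∣ {c} {x} P∣cx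
    ... | inj₁ P∣c = contradiction P∣c P∤c
    ... | inj₂ P∣x = P∣x

    P∤* : ∀ {x y} → ¬ P ∣ x → ¬ P ∣ y → ¬ P ∣ x * y
    P∤* P∤x P∤y P∣xy = P∤y (P∣*⇒P∣ P∤x P∣xy)

    P∣x∧P∣y⇒P∣x+c*y : ∀ {x y} c → P ∣ x → P ∣ y → P ∣ x + c * y
    P∣x∧P∣y⇒P∣x+c*y {x} {y} c P∣x P∣y = ≈0⇒∣ (≈-linear₂ 1ℤ c (eq x y c) (∣⇒≈0 P∣x) (∣⇒≈0 P∣y))
      where
      eq : ∀ x y c → x + c * y - 0ℤ ≡ 1ℤ * (x - 0ℤ) + c * (y - 0ℤ)
      eq = solve-∀

    P∣x*x⇒P∣x : ∀ {x} → P ∣ x * x → P ∣ x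
    P∣x*x⇒P∣x {x} = Sum.[ id , id ]′ ∘ P∣*⇒P∣⊎P∣ {x} {x}

    P∣⇒P∣* : ∀ c {x} → P ∣ x → P ∣ c * x
    P∣⇒P∣* c (divides q refl) = divides (c * q) (sym (ℤ.*-assoc c q P))

    P∤small : ∀ k → suc k ℕ.< p → ¬ P ∣ + suc k
    P∤small k k<p P∣k = ℕ.<⇒≱ k<p (ℕ.∣⇒≤ (∣⇒∣ᵤ P∣k))

    P∤1 : ¬ P ∣ 1ℤ
    P∤1 P∣1 = ¬prime[1] (subst Prime (ℕ.∣1⇒≡1 (∣⇒∣ᵤ P∣1)) prime)

    P∤-resp-≈ : ∀ {x y} → x ≈ y [ P ] → ¬ P ∣ x → ¬ P ∣ y
    P∤-resp-≈ x≈y P∤x P∣y = P∤x (≈0⇒∣ (≈-trans x≈y (∣⇒≈0 P∣y)))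

    P∤^ : ∀ {x} k → ¬ P ∣ x → ¬ P ∣ x ^ k
    P∤^ zero    P∤x = P∤1
    P∤^ (suc k) P∤x = P∤* P∤x (P∤^ k P∤x)

    private
      *-distribˡ-minus : ∀ c x y → c * (x - y) ≡ c * x - c * y
      *-distribˡ-minus = solve-∀

    ≈P-cancelˡ : ∀ {c x y} → ¬ P ∣ c → c * x ≈ c * y [ P ] → x ≈ y [ P ]
    ≈P-cancelˡ {c} {x} {y} P∤c e =
      ∣⇒≈ (P∣*⇒P∣ P∤c (subst (P ∣_) (sym (*-distribˡ-minus c x y)) (≈⇒∣ e)))

    ≈P²⇒≈P : ∀ {x y} → x ≈ y [ P² ] → x ≈ y [ P ]
    ≈P²⇒≈P = ≈-divisor P refl

    -- Cancelling modulo p first gives x - y = uP. Then c u P = q P², so P divides c u and hence u.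
    ≈P²-cancelˡ : ∀ {c x y} → ¬ P ∣ c → c * x ≈ c * y [ P² ] → x ≈ y [ P² ]
    ≈P²-cancelˡ {c} {x} {y} P∤c e@(mod q eq) =
      let mod u x-y≡uP = ≈P-cancelˡ {c} P∤c (≈P²⇒≈P e)
          divides v u≡vP = P∣*⇒P∣ {c} {u} P∤c (divides q (cu≡qP u x-y≡uP))
      in mod v (trans x-y≡uP (trans (cong (_* P) u≡vP) (ℤ.*-assoc v P P)))
      where
      open ≡-Reasoning
      cu≡qP : ∀ u → x - y ≡ u * P → c * u ≡ q * P
      cu≡qP u x-y≡uP = ℤ.*-cancelʳ-≡ _ _ P (begin
        c * u * P       ≡⟨ ℤ.*-assoc c u P ⟩
        c * (u * P)     ≡⟨ cong (c *_) (sym x-y≡uP) ⟩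
        c * (x - y)     ≡⟨ *-distribˡ-minus c x y ⟩
        c * x - c * y   ≡⟨ eq ⟩
        q * (P * P)     ≡⟨ sym (ℤ.*-assoc q P P) ⟩
        q * P * P ∎)

    ≈P⇒*P≈P² : ∀ {x y} → x ≈ y [ P ] → P * x ≈ P * y [ P² ]
    ≈P⇒*P≈P² = *-cong-scale P

    -- Since (x - y)² ≡ 0, the expansion of x^p around y stops at the linear term, which carries one
    -- factor p from the exponent and another from x - y.
    ^P-lift : ∀ {x y} → x ≈ y [ P ] → x ^ p ≈ y ^ p [ P² ]
    ^P-lift {x} {y} (mod q e) = begin
      x ^ p                            ≈⟨ first-order p-1 ⟩
      y ^ p + P * (x - y) * y ^ p-1    ≡⟨ cong (λ d → y ^ p + P * d * y ^ p-1) e ⟩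
      y ^ p + P * (q * P) * y ^ p-1    ≈⟨ ≈-linear (q * y ^ p-1) (eq₁ (y ^ p) q P (y ^ p-1)) (modulus≈0 P²) ⟩
      y ^ p ∎
      where
      open ≈-Reasoning P²
      eq₁ : ∀ a q P b → a + P * (q * P) * b - a ≡ q * b * (P * P - 0ℤ)
      eq₁ = solve-∀
      eq₂ : ∀ x y → x * 1ℤ ≡ y * 1ℤ + 1ℤ * (x - y) * 1ℤ
      eq₂ = solve-∀
      [x-y]²≈0 : (x - y) * (x - y) ≈ 0ℤ [ P² ]
      [x-y]²≈0 = ≈-trans (≈-reflexive (trans (cong₂ _*_ e e) (eq₃ q P))) (multiple≈0 (q * q))
        where
        eq₃ : ∀ q P → q * P * (q * P) ≡ q * q * (P * P)
        eq₃ = solve-∀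
      eq₄ : ∀ x y κ a b → x * a - (y * (y * b) + (1ℤ + (1ℤ + κ)) * (x - y) * (y * b)) ≡
            x * (a - (y * b + (1ℤ + κ) * (x - y) * b)) + (1ℤ + κ) * b * ((x - y) * (x - y) - 0ℤ)
      eq₄ = solve-∀
      first-order : ∀ k → x ^ suc k ≈ y ^ suc k + (1ℤ + + k) * (x - y) * y ^ k [ P² ]
      first-order zero    = ≈-reflexive (eq₂ x y)
      first-order (suc k) = ≈-linear₂ x ((1ℤ + + k) * y ^ k) (eq₄ x y (+ k) (x ^ suc k) (y ^ k))
        (first-order k) [x-y]²≈0

    binom-p≈0 : ∀ k → suc k ℕ.< p → binom p (suc k) ≈ 0ℤ [ P ]
    binom-p≈0 k k<p = ≈P-cancelˡ (P∤small k k<p) (∣⇒≈ (divides (binom p-1 k) (begin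
      (1ℤ + + k) * binom p (suc k) - (1ℤ + + k) * 0ℤ  ≡⟨ eq (1ℤ + + k) (binom p (suc k)) ⟩
      (1ℤ + + k) * binom p (suc k)                    ≡⟨ binom-absorb p-1 k ⟩
      P * binom p-1 k                                 ≡⟨ ℤ.*-comm P (binom p-1 k) ⟩
      binom p-1 k * P ∎)))
      where
      open ≡-Reasoning
      eq : ∀ c b → c * b - c * 0ℤ ≡ c * b
      eq = solve-∀

    binom-[p-1]≈ : ∀ k → k ℕ.< p → binom p-1 k ≈ -1ℤ ^ k [ P ]
    binom-[p-1]≈ zero    _   = ≈-reflexive (binom-0 p-1)
    binom-[p-1]≈ (suc k) k<p = ≈-linear₂ 1ℤ -1ℤ
      (trans (eq (binom p-1 k) (binom p-1 (suc k)) (-1ℤ ^ k))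
        (cong (λ b → 1ℤ * (b - 0ℤ) + -1ℤ * (binom p-1 k - -1ℤ ^ k)) (sym (pascal p-1 k))))
      (binom-p≈0 k k<p) (binom-[p-1]≈ k (ℕ.<-trans (ℕ.n<1+n k) k<p))
      where
      eq : ∀ a b s → b - -1ℤ * s ≡ 1ℤ * (a + b - 0ℤ) + -1ℤ * (a - s)
      eq = solve-∀

    -- The factor p in front means that binom(p - 1, k) matters only modulo p.
    k*binom-p≈ : ∀ k → suc k ℕ.< p → (1ℤ + + k) * binom p (suc k) ≈ -1ℤ ^ k * P [ P² ]
    k*binom-p≈ k k<p = begin
      (1ℤ + + k) * binom p (suc k)  ≡⟨ binom-absorb p-1 k ⟩
      P * binom p-1 k               ≈⟨ ≈P⇒*P≈P² (binom-[p-1]≈ k (ℕ.<-trans (ℕ.n<1+n k) k<p)) ⟩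
      P * -1ℤ ^ k                   ≡⟨ ℤ.*-comm P (-1ℤ ^ k) ⟩
      -1ℤ ^ k * P ∎
      where open ≈-Reasoning P²

    -- The case of Lucas' theorem with top digit 1 and bottom digit 0
    binom-p+≈ : ∀ s k → k ℕ.< p → binom (p ℕ.+ s) k ≈ binom s k [ P ]
    binom-p+≈ s       zero    _   = ≈-reflexive (trans (binom-0 (p ℕ.+ s)) (sym (binom-0 s)))
    binom-p+≈ zero    (suc k) k<p = ≈-trans (≈-reflexive (cong (λ a → binom a (suc k)) (ℕ.+-identityʳ p)))
      (≈-trans (binom-p≈0 k k<p) (≈-reflexive (sym (binom-> {0} {suc k} ℕ.z<s))))
    binom-p+≈ (suc s) (suc k) k<p = begin
      binom (p ℕ.+ suc s) (suc k)                      ≡⟨ cong (λ a → binom a (suc k)) (ℕ.+-suc p s) ⟩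
      binom (suc (p ℕ.+ s)) (suc k)                    ≡⟨ pascal (p ℕ.+ s) k ⟩
      binom (p ℕ.+ s) k + binom (p ℕ.+ s) (suc k)
        ≈⟨ +-cong (binom-p+≈ s k (ℕ.<-trans (ℕ.n<1+n k) k<p)) (binom-p+≈ s (suc k) k<p) ⟩
      binom s k + binom s (suc k)                      ≡⟨ sym (pascal s k) ⟩
      binom (suc s) (suc k) ∎
      where open ≈-Reasoning P

    -- Like `k*binom-p≈`, this evaluates a coefficient as p/(k + 1) modulo p², here up to no sign.
    -- So coefficients of (1 - x)^(-p) can be traded for those of (1 + x)^p.
    k*invCoeff≈ : ∀ k → suc k ℕ.< p → (1ℤ + + k) * invCoeff p-1 (+ suc k) ≈ P [ P² ]
    k*invCoeff≈ k k<p = begin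
      (1ℤ + + k) * binom (p-1 ℕ.+ suc k) (suc k)
        ≡⟨ cong (λ a → (1ℤ + + k) * binom a (suc k)) (ℕ.+-suc p-1 k) ⟩
      (1ℤ + + k) * binom (p ℕ.+ k) (suc k)      ≡⟨ binom-suc-lower (p ℕ.+ k) k ⟩
      (P + + k - + k) * binom (p ℕ.+ k) k       ≡⟨ cong (_* binom (p ℕ.+ k) k) (eq P (+ k)) ⟩
      P * binom (p ℕ.+ k) k                     ≈⟨ ≈P⇒*P≈P² (binom-p+≈ k k (ℕ.<-trans (ℕ.n<1+n k) k<p)) ⟩
      P * binom k k                             ≡⟨ cong (P *_) (binom-self k) ⟩
      P * 1ℤ                                    ≡⟨ ℤ.*-identityʳ P ⟩
      P ∎
      where
      open ≈-Reasoning P²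
      eq : ∀ P κ → P + κ - κ ≡ P
      eq = solve-∀

  -1^[n+n]≡1 : ∀ n → -1ℤ ^ (n ℕ.+ n) ≡ 1ℤ
  -1^[n+n]≡1 n = trans (ℤ.^-distribˡ-+-* -1ℤ n n) (-1^n*-1^n≡1 n)

  -- The truncated sum and the central Delannoy number modulo p²

  module Delannoy (n : ℕ) (prime : Prime (suc ((n ℕ.+ n) ℕ.+ (n ℕ.+ n)))) where

    private
      m = n ℕ.+ n
      p = suc (m ℕ.+ m)

    open PrimeModulus (m ℕ.+ m) prime

    m<p : m ℕ.< p
    m<p = ℕ.s≤s (ℕ.m≤m+n m m)

    weight : ℕ → ℤ
    weight j = binom m j * invCoeff m (+ j)

    -- Compare the ratios of consecutive terms: 4 (m - j)(m + j + 1) = p² - (2j + 1)², so modulo p²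
    -- the left ratio 16 (m - j)(m + j + 1)/(j + 1)² equals -(2 (2j + 1)/(j + 1))², the right one.
    16^j*weight≈ : ∀ j → j ℕ.≤ m →
                   (+ 16) ^ j * weight j ≈ -1ℤ ^ j * (binom (j ℕ.+ j) j * binom (j ℕ.+ j) j) [ P² ]
    16^j*weight≈ zero    _   = ≈-reflexive (begin
      1ℤ * (binom m 0 * binom (m ℕ.+ 0) 0)  ≡⟨ cong₂ (λ a b → 1ℤ * (a * b)) (binom-0 m) (binom-0 (m ℕ.+ 0)) ⟩
      1ℤ                                    ≡⟨ cong₂ (λ a b → 1ℤ * (a * b)) (binom-0 0) (binom-0 0) ⟨
      1ℤ * (binom 0 0 * binom 0 0) ∎)
      where open ≡-Reasoning
    16^j*weight≈ (suc j) j<m = ≈P²-cancelˡ {c = (1ℤ + + j) * (1ℤ + + j)} (P∤* P∤1+j P∤1+j) (begin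
      (1ℤ + + j) * (1ℤ + + j) * (+ 16 * (+ 16) ^ j * (binom m (suc j) * binom (m ℕ.+ suc j) (suc j)))
        ≡⟨ cong (λ k → (1ℤ + + j) * (1ℤ + + j) * (+ 16 * (+ 16) ^ j * (binom m (suc j) * binom k (suc j)))) (ℕ.+-suc m j) ⟩
      (1ℤ + + j) * (1ℤ + + j) * (+ 16 * (+ 16) ^ j * (binom m (suc j) * binom (suc (m ℕ.+ j)) (suc j)))
        ≡⟨ eq₁ (1ℤ + + j) ((+ 16) ^ j) (binom m (suc j)) (binom (suc (m ℕ.+ j)) (suc j)) ⟩
      + 16 * (+ 16) ^ j * ((1ℤ + + j) * binom m (suc j) * ((1ℤ + + j) * binom (suc (m ℕ.+ j)) (suc j)))
        ≡⟨ cong₂ (λ a b → + 16 * (+ 16) ^ j * (a * b)) (binom-suc-lower m j) (binom-absorb (m ℕ.+ j) j) ⟩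
      + 16 * (+ 16) ^ j * ((+ m - + j) * binom m j * ((1ℤ + (+ m + + j)) * binom (m ℕ.+ j) j))
        ≈⟨ ≈-linear₂ (+ 4 * ((+ 16) ^ j * weight j)) (- (+ 4 * ((1ℤ + (+ j + + j)) * (1ℤ + (+ j + + j)))))
             (eq₂ ((+ 16) ^ j) (+ m) (+ j) (binom m j) (binom (m ℕ.+ j) j) (-1ℤ ^ j) B)
             (modulus≈0 P²) (16^j*weight≈ j (ℕ.<⇒≤ j<m)) ⟩
      -1ℤ * -1ℤ ^ j * (+ 2 * (1ℤ + (+ j + + j)) * B * (+ 2 * (1ℤ + (+ j + + j)) * B))
        ≡⟨ cong (λ b → -1ℤ * -1ℤ ^ j * (b * b)) (sym (central-binom-suc j)) ⟩
      -1ℤ * -1ℤ ^ j * ((1ℤ + + j) * B′ * ((1ℤ + + j) * B′))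
        ≡⟨ eq₃ (-1ℤ ^ j) (1ℤ + + j) B′ ⟩
      (1ℤ + + j) * (1ℤ + + j) * (-1ℤ * -1ℤ ^ j * (B′ * B′)) ∎)
      where
      open ≈-Reasoning P²
      B  = binom (j ℕ.+ j) j
      B′ = binom (suc j ℕ.+ suc j) (suc j)
      P∤1+j = P∤small j (ℕ.≤-<-trans j<m m<p)
      eq₁ : ∀ u s a b → u * u * (+ 16 * s * (a * b)) ≡ + 16 * s * (u * a * (u * b))
      eq₁ = solve-∀
      eq₂ : ∀ s μ ι a b ε B →
        + 16 * s * ((μ - ι) * a * ((1ℤ + (μ + ι)) * b)) -
        -1ℤ * ε * (+ 2 * (1ℤ + (ι + ι)) * B * (+ 2 * (1ℤ + (ι + ι)) * B)) ≡
        + 4 * (s * (a * b)) * ((1ℤ + (μ + μ)) * (1ℤ + (μ + μ)) - 0ℤ) +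
        (- (+ 4 * ((1ℤ + (ι + ι)) * (1ℤ + (ι + ι))))) * (s * (a * b) - ε * (B * B))
      eq₂ = solve-∀
      eq₃ : ∀ ε u B → -1ℤ * ε * (u * B * (u * B)) ≡ u * u * (-1ℤ * ε * (B * B))
      eq₃ = solve-∀

    -- The central Delannoy number of index m, which is the Legendre polynomial of degree m at 3.
    delannoy : ℤ
    delannoy = binomSum m (λ j → invCoeff m (+ j))

    -- The 1 is the alternating sum, `binomSum-signed-invCoeff` at t = z = 0, whose value (-1)^m is
    -- 1 because m = 2n.
    2*∑-weight : + 2 * ∑ (suc n) (λ k → weight (k ℕ.+ k)) ≡ 1ℤ + delannoy
    2*∑-weight = begin
      + 2 * ∑ (suc n) (λ k → weight (k ℕ.+ k))
        ≡⟨ sym (∑-even-terms n weight) ⟩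
      ∑ (suc m) (λ j → (1ℤ + -1ℤ ^ j) * weight j)
        ≡⟨ ∑-cong-≡ (suc m) (λ j → eq (-1ℤ ^ j) (binom m j) (invCoeff m (+ j))) ⟩
      ∑ (suc m) (λ j → binom m j * (-1ℤ ^ j * invCoeff m (+ j)) + weight j)
        ≡⟨ ∑-+ (suc m) _ _ ⟩
      ∑ (suc m) (λ j → binom m j * (-1ℤ ^ j * invCoeff m (+ j))) + ∑ (suc m) weight
        ≡⟨ cong₂ _+_ (sym (binomSum≡∑ m _)) (sym (binomSum≡∑ m _)) ⟩
      binomSum m (λ j → -1ℤ ^ j * invCoeff m (+ j)) + delannoy
        ≡⟨ cong (_+ delannoy) (trans (binomSum-signed-invCoeff m 0 0ℤ)
             (cong₂ _*_ (-1^[n+n]≡1 n) (binom-self m))) ⟩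
      1ℤ + delannoy ∎
      where
      open ≡-Reasoning
      eq : ∀ s a b → (1ℤ + s) * (a * b) ≡ a * (s * b) + a * b
      eq = solve-∀

    -- After multiplication by k + 1 both sides are p: on the left 2 (k + 1) is the index of the
    -- coefficient, on the right the two signs cancel.
    2*invCoeff≈ : ∀ k → suc k ℕ.+ suc k ℕ.< p →
                  + 2 * invCoeff (m ℕ.+ m) (+ (suc k ℕ.+ suc k)) ≈ -1ℤ ^ k * binom p (suc k) [ P² ]
    2*invCoeff≈ k 2k<p = ≈P²-cancelˡ {c = 1ℤ + + k} (P∤small k k<p) (begin
      (1ℤ + + k) * (+ 2 * invCoeff (m ℕ.+ m) (+ (suc k ℕ.+ suc k)))
        ≡⟨ eq₁ (+ k) (invCoeff (m ℕ.+ m) (+ (suc k ℕ.+ suc k))) ⟩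
      (1ℤ + (+ k + + suc k)) * invCoeff (m ℕ.+ m) (+ (suc k ℕ.+ suc k))
        ≈⟨ k*invCoeff≈ (k ℕ.+ suc k) 2k<p ⟩
      P
        ≡⟨ trans (sym (ℤ.*-identityˡ P)) (trans (cong (_* P) (sym (-1^n*-1^n≡1 k))) (ℤ.*-assoc (-1ℤ ^ k) (-1ℤ ^ k) P)) ⟩
      -1ℤ ^ k * (-1ℤ ^ k * P)
        ≈⟨ *-congˡ (-1ℤ ^ k) (≈-sym (k*binom-p≈ k k<p)) ⟩
      -1ℤ ^ k * ((1ℤ + + k) * binom p (suc k))
        ≡⟨ eq₂ (-1ℤ ^ k) (1ℤ + + k) (binom p (suc k)) ⟩
      (1ℤ + + k) * (-1ℤ ^ k * binom p (suc k)) ∎)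
      where
      open ≈-Reasoning P²
      k<p : suc k ℕ.< p
      k<p = ℕ.≤-<-trans (ℕ.m≤m+n (suc k) (suc k)) 2k<p
      eq₁ : ∀ κ b → (1ℤ + κ) * (+ 2 * b) ≡ (1ℤ + (κ + (1ℤ + κ))) * b
      eq₁ = solve-∀
      eq₂ : ∀ s c b → s * (c * b) ≡ c * (s * b)
      eq₂ = solve-∀

    -- For i < n the coefficient of index 2 (n - i) becomes one of index n - i in (1 + x)^p, and the
    -- signs combine to -(-1)^n whatever i is. At i = n this pattern would give -1 where the true
    -- factor is 2; the term `+ 3 * coeff 0`, supported at i = n, makes up the difference.
    2*signed-invCoeff≈ : ∀ i →
      + 2 * (-1ℤ ^ i * invCoeff (m ℕ.+ m) (+ m - (+ i + + i))) ≈
      -1ℤ ^ n * (+ 3 * coeff 0 (+ n - + i) - coeff p (+ n - + i)) [ P² ]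
    2*signed-invCoeff≈ i with ℕ.compare n i
    ... | ℕ.less _ k = ≈-reflexive (begin
      + 2 * (-1ℤ ^ suc (n ℕ.+ k) * invCoeff (m ℕ.+ m) (+ m - (+ suc (n ℕ.+ k) + + suc (n ℕ.+ k))))
        ≡⟨ cong (λ z → + 2 * (-1ℤ ^ suc (n ℕ.+ k) * invCoeff (m ℕ.+ m) z)) (eq₁ (+ n) (+ k)) ⟩
      + 2 * (-1ℤ ^ suc (n ℕ.+ k) * 0ℤ)
        ≡⟨ eq₃ (-1ℤ ^ suc (n ℕ.+ k)) (-1ℤ ^ n) ⟩
      -1ℤ ^ n * (+ 3 * 0ℤ - 0ℤ)
        ≡⟨ cong (λ z → -1ℤ ^ n * (+ 3 * coeff 0 z - coeff p z)) (sym (eq₂ (+ n) (+ k))) ⟩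
      -1ℤ ^ n * (+ 3 * coeff 0 (+ n - + suc (n ℕ.+ k)) - coeff p (+ n - + suc (n ℕ.+ k))) ∎)
      where
      open ≡-Reasoning
      eq₁ : ∀ ν κ → ν + ν - (1ℤ + (ν + κ) + (1ℤ + (ν + κ))) ≡ - (1ℤ + (1ℤ + (κ + κ)))
      eq₁ = solve-∀
      eq₂ : ∀ ν κ → ν - (1ℤ + (ν + κ)) ≡ - (1ℤ + κ)
      eq₂ = solve-∀
      eq₃ : ∀ s t → + 2 * (s * 0ℤ) ≡ t * (+ 3 * 0ℤ - 0ℤ)
      eq₃ = solve-∀
    ... | ℕ.equal _ = ≈-reflexive (begin
      + 2 * (-1ℤ ^ n * invCoeff (m ℕ.+ m) (+ m - (+ n + + n)))
        ≡⟨ cong (λ z → + 2 * (-1ℤ ^ n * invCoeff (m ℕ.+ m) z)) (ℤ.+-inverseʳ (+ m)) ⟩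
      + 2 * (-1ℤ ^ n * binom (m ℕ.+ m ℕ.+ 0) 0)
        ≡⟨ cong (λ b → + 2 * (-1ℤ ^ n * b)) (binom-0 (m ℕ.+ m ℕ.+ 0)) ⟩
      + 2 * (-1ℤ ^ n * 1ℤ)
        ≡⟨ eq (-1ℤ ^ n) ⟩
      -1ℤ ^ n * (+ 3 * 1ℤ - 1ℤ)
        ≡⟨ cong₂ (λ a b → -1ℤ ^ n * (+ 3 * a - b)) (sym (binom-0 0)) (sym (binom-0 p)) ⟩
      -1ℤ ^ n * (+ 3 * coeff 0 0ℤ - coeff p 0ℤ)
        ≡⟨ cong (λ z → -1ℤ ^ n * (+ 3 * coeff 0 z - coeff p z)) (sym (ℤ.+-inverseʳ (+ n))) ⟩
      -1ℤ ^ n * (+ 3 * coeff 0 (+ n - + n) - coeff p (+ n - + n)) ∎)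
      where
      open ≡-Reasoning
      eq : ∀ s → + 2 * (s * 1ℤ) ≡ s * (+ 3 * 1ℤ - 1ℤ)
      eq = solve-∀
    ... | ℕ.greater _ k = begin
      + 2 * (-1ℤ ^ i * q (+ m - (+ i + + i)))
        ≡⟨ cong (λ z → + 2 * (-1ℤ ^ i * q z)) (eq₁ (+ i) (+ k)) ⟩
      + 2 * (-1ℤ ^ i * q (+ (suc k ℕ.+ suc k)))
        ≡⟨ eq₂ (-1ℤ ^ i) (q (+ (suc k ℕ.+ suc k))) ⟩
      -1ℤ ^ i * (+ 2 * q (+ (suc k ℕ.+ suc k)))
        ≈⟨ *-congˡ (-1ℤ ^ i) (2*invCoeff≈ k 2k<p) ⟩
      -1ℤ ^ i * (-1ℤ ^ k * binom p (suc k))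
        ≡⟨ eq₃ (-1ℤ ^ i) (-1ℤ ^ k) (binom p (suc k)) ⟩
      -1ℤ * (-1ℤ ^ i * -1ℤ ^ k) * (+ 3 * 0ℤ - binom p (suc k))
        ≡⟨ cong₂ (λ s b → s * (+ 3 * b - binom p (suc k)))
             (cong (-1ℤ *_) (sym (ℤ.^-distribˡ-+-* -1ℤ i k))) (sym (binom-> {0} {suc k} ℕ.z<s)) ⟩
      -1ℤ ^ suc (i ℕ.+ k) * (+ 3 * coeff 0 (+ suc k) - coeff p (+ suc k))
        ≡⟨ cong (λ z → -1ℤ ^ suc (i ℕ.+ k) * (+ 3 * coeff 0 z - coeff p z)) (sym (eq₄ (+ i) (+ k))) ⟩
      -1ℤ ^ suc (i ℕ.+ k) * (+ 3 * coeff 0 (+ suc (i ℕ.+ k) - + i) - coeff p (+ suc (i ℕ.+ k) - + i)) ∎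
      where
      open ≈-Reasoning P²
      q = invCoeff (m ℕ.+ m)
      2k<p : suc k ℕ.+ suc k ℕ.< p
      2k<p = ℕ.≤-<-trans (ℕ.+-mono-≤ k≤n k≤n) m<p
        where
        k≤n : suc k ℕ.≤ suc (i ℕ.+ k)
        k≤n = ℕ.s≤s (ℕ.m≤n+m k i)
      eq₁ : ∀ ι κ → 1ℤ + (ι + κ) + (1ℤ + (ι + κ)) - (ι + ι) ≡ 1ℤ + κ + (1ℤ + κ)
      eq₁ = solve-∀
      eq₂ : ∀ s b → + 2 * (s * b) ≡ s * (+ 2 * b)
      eq₂ = solve-∀
      eq₃ : ∀ s t b → s * (t * b) ≡ -1ℤ * (s * t) * (+ 3 * 0ℤ - b)
      eq₃ = solve-∀
      eq₄ : ∀ ι κ → 1ℤ + (ι + κ) - ι ≡ 1ℤ + κ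
      eq₄ = solve-∀

    2*delannoy≈ : + 2 * delannoy ≈ -1ℤ ^ n * (+ 3 * binom m n - binom (m ℕ.+ p) n) [ P² ]
    2*delannoy≈ = begin
      + 2 * delannoy
        ≡⟨ cong (+ 2 *_) (binomSum-invCoeff m m 0ℤ) ⟩
      + 2 * binomSum m (λ i → -1ℤ ^ i * invCoeff (m ℕ.+ m) (+ m - (+ i + + i)))
        ≡⟨ sym (binomSum-*ˡ m (+ 2) _) ⟩
      binomSum m (λ i → + 2 * (-1ℤ ^ i * invCoeff (m ℕ.+ m) (+ m - (+ i + + i))))
        ≈⟨ binomSum-cong-< m (λ i _ → 2*signed-invCoeff≈ i) ⟩
      binomSum m (λ i → -1ℤ ^ n * (+ 3 * coeff 0 (+ n - + i) - coeff p (+ n - + i)))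
        ≡⟨ binomSum-*ˡ m (-1ℤ ^ n) _ ⟩
      -1ℤ ^ n * binomSum m (λ i → + 3 * coeff 0 (+ n - + i) - coeff p (+ n - + i))
        ≡⟨ cong (-1ℤ ^ n *_) (trans
             (binomSum-cong-≡ m λ i → cong (_+_ (+ 3 * coeff 0 (+ n - + i))) (sym (ℤ.-1*i≡-i (coeff p (+ n - + i)))))
             (trans (binomSum-+ m _ _) (cong₂ _+_
               (trans (binomSum-*ˡ m (+ 3) _) (cong (+ 3 *_) (vandermonde m 0 (+ n))))
               (trans (binomSum-*ˡ m -1ℤ _) (trans (cong (-1ℤ *_) (vandermonde m p (+ n))) (ℤ.-1*i≡-i _)))))) ⟩
      -1ℤ ^ n * (+ 3 * binom (m ℕ.+ 0) n - binom (m ℕ.+ p) n)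
        ≡⟨ cong (λ a → -1ℤ ^ n * (+ 3 * binom a n - binom (m ℕ.+ p) n)) (ℕ.+-identityʳ m) ⟩
      -1ℤ ^ n * (+ 3 * binom m n - binom (m ℕ.+ p) n) ∎
      where open ≈-Reasoning P²

  -- Sums over the residues modulo p

  infix 4 _≈?_[_]
  opaque
    _≈?_[_] : ∀ x y N → Dec (x ≈ y [ N ])
    x ≈? y [ N ] = map′ ∣⇒≈ ≈⇒∣ (N ∣? x - y)

  ^-distrib-* : ∀ x y k → (x * y) ^ k ≡ x ^ k * y ^ k
  ^-distrib-* x y zero    = refl
  ^-distrib-* x y (suc k) = trans (cong (x * y *_) (^-distrib-* x y k)) (eq x y (x ^ k) (y ^ k))
    where
    eq : ∀ x y a b → x * y * (a * b) ≡ x * a * (y * b)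
    eq = solve-∀

  ^-swap : ∀ x j k → (x ^ j) ^ k ≡ (x ^ k) ^ j
  ^-swap x j k = trans (ℤ.^-*-assoc x j k)
    (trans (cong (x ^_) (ℕ.*-comm j k)) (sym (ℤ.^-*-assoc x k j)))

  module ResidueSums (p-1 : ℕ) (prime : Prime (suc p-1)) where

    open PrimeModulus p-1 prime

    private
      p = suc p-1

    p-1≢0 : ¬ p-1 ≡ 0
    p-1≢0 refl = ¬prime[1] prime

    residue : ℤ → ℕ
    residue x = x ℤ.%ℕ p

    residue<p : ∀ x → residue x ℕ.< p
    residue<p x = ℤ.n%ℕd<d x p

    ≈residue : ∀ x → x ≈ + residue x [ P ]
    ≈residue x = mod (x ℤ./ℕ p) (trans (cong (_- + residue x) (ℤ.a≡a%ℕn+[a/ℕn]*n x p)) (eq (+ residue x) (x ℤ./ℕ p * P)))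
      where
      eq : ∀ r q → r + q - r ≡ q
      eq = solve-∀

    P∣0 : P ∣ 0ℤ
    P∣0 = divides 0ℤ refl

    small-≈⇒≡ : ∀ {j k} → j ℕ.< p → k ℕ.< p → + j ≈ + k [ P ] → j ≡ k
    small-≈⇒≡ {j} {k} j<p k<p e with ℕ.compare j k
    ... | ℕ.equal _     = refl
    ... | ℕ.less _ d    = contradiction
      (subst (P ∣_) (eq (+ j) (+ d)) (≈⇒∣ (≈-sym e))) (P∤small d (ℕ.≤-<-trans (ℕ.s≤s (ℕ.m≤n+m d j)) k<p))
      where
      eq : ∀ ι δ → 1ℤ + (ι + δ) - ι ≡ 1ℤ + δ
      eq = solve-∀
    ... | ℕ.greater _ d = contradiction
      (subst (P ∣_) (eq (+ k) (+ d)) (≈⇒∣ e)) (P∤small d (ℕ.≤-<-trans (ℕ.s≤s (ℕ.m≤n+m d k)) j<p))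
      where
      eq : ∀ ι δ → 1ℤ + (ι + δ) - ι ≡ 1ℤ + δ
      eq = solve-∀

    private
      [+k]^p≈ : ∀ k → (+ k) ^ p ≈ + k [ P ]
      [+k]^p≈ zero    = ≈-refl
      [+k]^p≈ (suc k) = begin
        (+ suc k) ^ p
          ≡⟨ cong (_^ p) (ℤ.+-comm 1ℤ (+ k)) ⟩
        (+ k + 1ℤ) ^ p
          ≡⟨ trans (binomial-theorem p (+ k) 1ℤ) (trans (binomSum≡∑ p term) (∑-last p (λ i → binom p i * term i))) ⟩
        ∑ p (λ i → binom p i * term i) + binom p p * ((+ k) ^ p * 1ℤ ^ (p ℕ.∸ p))
          ≈⟨ +-cong (∑-single p 0 ℕ.z<s middle≈0)
               (≈-trans (≈-reflexive (trans (cong₂ (λ b c → b * ((+ k) ^ p * c)) (binom-self p) (ℤ.^-zeroˡ (p ℕ.∸ p)))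
                 (eq ((+ k) ^ p)))) ([+k]^p≈ k)) ⟩
        binom p 0 * (1ℤ * 1ℤ ^ p) + + k
          ≡⟨ cong₂ (λ b c → b * (1ℤ * c) + + k) (binom-0 p) (ℤ.^-zeroˡ p) ⟩
        + suc k ∎
        where
        open ≈-Reasoning P
        term : ℕ → ℤ
        term i = (+ k) ^ i * 1ℤ ^ (p ℕ.∸ i)
        eq : ∀ a → 1ℤ * (a * 1ℤ) ≡ a
        eq = solve-∀
        middle≈0 : ∀ i → i ℕ.< p → ¬ i ≡ 0 → binom p i * term i ≈ 0ℤ [ P ]
        middle≈0 zero    _   i≢0 = contradiction refl i≢0
        middle≈0 (suc i) i<p _   = ≈-trans (*-congʳ (term (suc i)) (binom-p≈0 i i<p)) (≈-reflexive (ℤ.*-zeroˡ (term (suc i))))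

    x^p≈x : ∀ x → x ^ p ≈ x [ P ]
    x^p≈x x = ≈-trans (^-cong p (≈residue x)) (≈-trans ([+k]^p≈ (residue x)) (≈-sym (≈residue x)))

    x^[p-1]≈1 : ∀ {x} → ¬ P ∣ x → x ^ p-1 ≈ 1ℤ [ P ]
    x^[p-1]≈1 {x} P∤x = ≈P-cancelˡ {x} P∤x (≈-trans (x^p≈x x) (≈-reflexive (sym (ℤ.*-identityʳ x))))

    infix 4 P∣?_
    opaque
      P∣?_ : ∀ x → Dec (P ∣ x)
      P∣? x = P ∣? x

    opaque
      -- The witness is x^(p - 2), split off from Fermat's x^(p - 1) ≡ 1.
      inverse : ∀ {x} → ¬ P ∣ x → ∃[ y ] x * y ≈ 1ℤ [ P ]
      inverse {x} P∤x = root p-1 p-1≢0 (x^[p-1]≈1 P∤x)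
        where
        root : ∀ k → ¬ k ≡ 0 → x ^ k ≈ 1ℤ [ P ] → ∃[ y ] x * y ≈ 1ℤ [ P ]
        root zero    k≢0 _ = contradiction refl k≢0
        root (suc k) _   e = x ^ k , e

    opaque
      δ : ℤ → ℤ
      δ x with P∣? x
      ... | yes _ = 1ℤ
      ... | no  _ = 0ℤ

      δ-∣ : ∀ {x} → P ∣ x → δ x ≡ 1ℤ
      δ-∣ {x} P∣x with P∣? x
      ... | yes _   = refl
      ... | no  P∤x = contradiction P∣x P∤x

      δ-∤ : ∀ {x} → ¬ P ∣ x → δ x ≡ 0ℤ
      δ-∤ {x} P∤x with P∣? x
      ... | yes P∣x = contradiction P∣x P∤x
      ... | no  _   = refl

    δ-⇔ : ∀ {x y} → (P ∣ x → P ∣ y) → (P ∣ y → P ∣ x) → δ x ≡ δ y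
    δ-⇔ {x} {y} f g with P∣? x
    ... | yes P∣x = trans (δ-∣ P∣x) (sym (δ-∣ (f P∣x)))
    ... | no  P∤x = trans (δ-∤ P∤x) (sym (δ-∤ (P∤x ∘ g)))

    ∑ₚ : (ℤ → ℤ) → ℤ
    ∑ₚ h = ∑ p (h ∘ +_)

    ∑ₚδ : ∀ z → ∑ₚ (λ x → δ (x - z)) ≡ 1ℤ
    ∑ₚδ z = trans
      (≈[0]⇒≡ (∑-single p (residue z) (residue<p z) λ k k<p k≢r → ≈-reflexive (δ-∤ λ P∣k-z →
        k≢r (small-≈⇒≡ k<p (residue<p z) (≈-trans (∣⇒≈ P∣k-z) (≈residue z))))))
      (δ-∣ (≈⇒∣ (≈-sym (≈residue z))))

    -- The modulus N of the values is independent of p: N = 0 is used for exact character sums, N =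
    -- P for power sums and N = P² for Teichmüller sums.
    Periodic : ℤ → (ℤ → ℤ) → Set
    Periodic N h = ∀ {x y} → x ≈ y [ P ] → h x ≈ h y [ N ]

    ∑ₚ-*δ : ∀ {N h} → Periodic N h → ∀ z → ∑ₚ (λ x → h x * δ (x - z)) ≈ h z [ N ]
    ∑ₚ-*δ {N} {h} periodic z = begin
      ∑ₚ (λ x → h x * δ (x - z))  ≈⟨ ∑-cong p (λ k → pointwise (+ k)) ⟩
      ∑ₚ (λ x → h z * δ (x - z))  ≡⟨ ∑-*ˡ p (h z) _ ⟩
      h z * ∑ₚ (λ x → δ (x - z))  ≡⟨ trans (cong (h z *_) (∑ₚδ z)) (ℤ.*-identityʳ (h z)) ⟩
      h z ∎
      where
      open ≈-Reasoning N
      pointwise : ∀ x → h x * δ (x - z) ≈ h z * δ (x - z) [ N ]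
      pointwise x with P∣? x - z
      ... | yes P∣x-z = *-congʳ (δ (x - z)) (periodic (∣⇒≈ P∣x-z))
      ... | no  P∤x-z = ≈-reflexive (trans (cong (h x *_) (δ-∤ P∤x-z))
        (trans (trans (ℤ.*-zeroʳ (h x)) (sym (ℤ.*-zeroʳ (h z)))) (cong (h z *_) (sym (δ-∤ P∤x-z)))))

    -- Reindexing along σ, with inverse τ, by expanding h (σ x) over its values
    -- and exchanging the two sums
    ∑ₚ-reindex : ∀ {N h} → Periodic N h → (σ τ : ℤ → ℤ) →
                 (∀ x y → P ∣ y - σ x → P ∣ x - τ y) → (∀ x y → P ∣ x - τ y → P ∣ y - σ x) →
                 ∑ₚ (h ∘ σ) ≈ ∑ₚ h [ N ]
    ∑ₚ-reindex {N} {h} periodic σ τ σ⇒τ τ⇒σ = begin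
      ∑ₚ (h ∘ σ)
        ≈⟨ ∑-cong p (λ k → ≈-sym (∑ₚ-*δ periodic (σ (+ k)))) ⟩
      ∑ₚ (λ x → ∑ₚ (λ y → h y * δ (y - σ x)))
        ≡⟨ ∑-swap p p _ ⟩
      ∑ₚ (λ y → ∑ₚ (λ x → h y * δ (y - σ x)))
        ≡⟨ ∑-cong-≡ p (λ k → trans (∑-*ˡ p (h (+ k)) _) (cong (h (+ k) *_)
             (trans (∑-cong-≡ p λ j → δ-⇔ (σ⇒τ (+ j) (+ k)) (τ⇒σ (+ j) (+ k))) (∑ₚδ (τ (+ k)))))) ⟩
      ∑ₚ (λ y → h y * 1ℤ)
        ≡⟨ ∑-cong-≡ p (λ k → ℤ.*-identityʳ (h (+ k))) ⟩
      ∑ₚ h ∎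
      where open ≈-Reasoning N

    ∑ₚ-shift : ∀ {N h} → Periodic N h → ∀ c → ∑ₚ (λ x → h (x + c)) ≈ ∑ₚ h [ N ]
    ∑ₚ-shift periodic c = ∑ₚ-reindex periodic (_+ c) (_- c)
      (λ x y d → ≈⇒∣ {x = x} {y - c} (≈-linear -1ℤ (eq₁ x y c) (∣⇒≈ {x = y} {x + c} d)))
      (λ x y d → ≈⇒∣ {x = y} {x + c} (≈-linear -1ℤ (eq₂ x y c) (∣⇒≈ {x = x} {y - c} d)))
      where
      eq₁ : ∀ x y c → x - (y - c) ≡ -1ℤ * (y - (x + c))
      eq₁ = solve-∀
      eq₂ : ∀ x y c → y - (x + c) ≡ -1ℤ * (x - (y - c))
      eq₂ = solve-∀

    ∑ₚ-scale : ∀ {N h} → Periodic N h → ∀ {u} → ¬ P ∣ u → ∑ₚ (λ x → h (u * x)) ≈ ∑ₚ h [ N ]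
    ∑ₚ-scale {N} {h} periodic {u} P∤u =
      let v , uv≈1 = inverse P∤u in
      ∑ₚ-reindex {N} {h} periodic (u *_) (v *_)
        (λ x y d → ≈⇒∣ {x = x} {v * y} (≈-linear₂ (- v) (- x) (eq₁ x y u v) (∣⇒≈ {x = y} {u * x} d) uv≈1))
        (λ x y d → ≈⇒∣ {x = y} {u * x} (≈-linear₂ (- u) (- y) (eq₂ x y u v) (∣⇒≈ {x = x} {v * y} d) uv≈1))
      where
      eq₁ : ∀ x y u v → x - v * y ≡ (- v) * (y - u * x) + (- x) * (u * v - 1ℤ)
      eq₁ = solve-∀
      eq₂ : ∀ x y u v → y - u * x ≡ (- u) * (x - v * y) + (- y) * (u * v - 1ℤ)
      eq₂ = solve-∀

    -- The shift x ↦ x + 1 does not change the sum of x^(s + 1). Expanding (x + 1)^(s + 1) therefore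
    -- leaves (s + 1) times the sum of x^s plus lower power sums, which vanish by induction, and s +
    -- 1 is invertible.
    ∑ₚ^≈0 : ∀ s → s ℕ.< p-1 → ∑ₚ (_^ s) ≈ 0ℤ [ P ]
    ∑ₚ^≈0 = ℕ.<-rec _ step
      where
      step : ∀ s → (∀ {i} → i ℕ.< s → i ℕ.< p-1 → ∑ₚ (_^ i) ≈ 0ℤ [ P ]) →
             s ℕ.< p-1 → ∑ₚ (_^ s) ≈ 0ℤ [ P ]
      step s rec s<p-1 = ≈P-cancelˡ (P∤small s (ℕ.s<s s<p-1)) (≈-trans
        (≈-linear 1ℤ (eq₃ (1ℤ + + s) (∑ₚ (_^ s)) (∑ₚ (_^ suc s))) shifted)
        (≈-reflexive (sym (ℤ.*-zeroʳ (1ℤ + + s)))))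
        where
        open ≈-Reasoning P
        term : ℤ → ℕ → ℤ
        term x i = binom (suc s) i * x ^ i
        eq₁ : ∀ b a → b * (a * 1ℤ) ≡ b * a
        eq₁ = solve-∀
        eq₂ : ∀ b σ → (1ℤ + σ - σ) * b ≡ b
        eq₂ = solve-∀
        eq₃ : ∀ c a b → c * a - 0ℤ ≡ 1ℤ * (0ℤ + c * a + b - b)
        eq₃ = solve-∀
        binom≡1+s : binom (suc s) s ≡ 1ℤ + + s
        binom≡1+s = trans (sym (eq₂ (binom (suc s) s) (+ s))) (trans (binom-suc-upper s s)
          (trans (cong ((1ℤ + + s) *_) (binom-self s)) (ℤ.*-identityʳ (1ℤ + + s))))
        expand : ∀ x → (x + 1ℤ) ^ suc s ≡ ∑ s (term x) + (1ℤ + + s) * x ^ s + x ^ suc s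
        expand x = trans (binomial-theorem (suc s) x 1ℤ) (trans (binomSum≡∑ (suc s) _)
          (trans (∑-cong-≡ (suc (suc s)) λ i →
                   trans (cong (λ u → binom (suc s) i * (x ^ i * u)) (ℤ.^-zeroˡ (suc s ℕ.∸ i)))
                         (eq₁ (binom (suc s) i) (x ^ i)))
          (trans (∑-last (suc s) (term x)) (cong₂ _+_
            (trans (∑-last s (term x)) (cong (λ b → ∑ s (term x) + b * x ^ s) binom≡1+s))
            (trans (cong (_* x ^ suc s) (binom-self (suc s))) (ℤ.*-identityˡ (x ^ suc s)))))))
        lower≈0 : ∑ₚ (λ x → ∑ s (term x)) ≈ 0ℤ [ P ]
        lower≈0 = begin
          ∑ₚ (λ x → ∑ s (term x))
            ≡⟨ ∑-swap p s _ ⟩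
          ∑ s (λ i → ∑ₚ (λ x → binom (suc s) i * x ^ i))
            ≡⟨ ∑-cong-≡ s (λ i → ∑-*ˡ p (binom (suc s) i) _) ⟩
          ∑ s (λ i → binom (suc s) i * ∑ₚ (_^ i))
            ≈⟨ ∑-cong-< s (λ i i<s → ≈-trans (*-congˡ (binom (suc s) i) (rec i<s (ℕ.<-trans i<s s<p-1)))
                 (≈-reflexive (ℤ.*-zeroʳ (binom (suc s) i)))) ⟩
          ∑ s (λ i → 0ℤ)
            ≡⟨ ∑-zero s ⟩
          0ℤ ∎
        shifted : 0ℤ + (1ℤ + + s) * ∑ₚ (_^ s) + ∑ₚ (_^ suc s) ≈ ∑ₚ (_^ suc s) [ P ]
        shifted = begin
          0ℤ + (1ℤ + + s) * ∑ₚ (_^ s) + ∑ₚ (_^ suc s)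
            ≈⟨ +-cong (+-cong (≈-sym lower≈0) (≈-refl {x = (1ℤ + + s) * ∑ₚ (_^ s)})) (≈-refl {x = ∑ₚ (_^ suc s)}) ⟩
          ∑ₚ (λ x → ∑ s (term x)) + (1ℤ + + s) * ∑ₚ (_^ s) + ∑ₚ (_^ suc s)
            ≡⟨ cong (λ u → ∑ₚ (λ x → ∑ s (term x)) + u + ∑ₚ (_^ suc s)) (∑-*ˡ p (1ℤ + + s) _) ⟨
          ∑ₚ (λ x → ∑ s (term x)) + ∑ₚ (λ x → (1ℤ + + s) * x ^ s) + ∑ₚ (_^ suc s)
            ≡⟨ trans (∑-+ p _ _) (cong (_+ ∑ₚ (_^ suc s)) (∑-+ p _ _)) ⟨
          ∑ₚ (λ x → ∑ s (term x) + (1ℤ + + s) * x ^ s + x ^ suc s)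
            ≡⟨ ∑-cong-≡ p (λ k → sym (expand (+ k))) ⟩
          ∑ₚ (λ x → (x + 1ℤ) ^ suc s)
            ≈⟨ ∑ₚ-shift {h = _^ suc s} (^-cong (suc s)) 1ℤ ⟩
          ∑ₚ (_^ suc s) ∎

    opaque
      -- Takes the place of a primitive root. If every unit satisfied y^(s + 1) ≡ 1, the power sum
      -- would be p - 1 ≡ -1, against `∑ₚ^≈0`; the search over residues is finite and decidable.
      nonroot : ∀ s → suc s ℕ.< p-1 → ∃[ y ] (¬ P ∣ y × ¬ y ^ suc s ≈ 1ℤ [ P ])
      nonroot s s<p-1 with ℕ.anyUpTo? (λ k → ¬? (P∣? + k) ×-dec ¬? ((+ k) ^ suc s ≈? 1ℤ [ P ])) p
      ... | yes (k , _ , P∤k , k^s≉1) = + k , P∤k , k^s≉1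
      ... | no  none                  = contradiction (≈0⇒∣ 1≈0) P∤1
        where
        all-roots : ∀ k → suc k ℕ.< p → (+ suc k) ^ suc s ≈ 1ℤ [ P ]
        all-roots k k<p with (+ suc k) ^ suc s ≈? 1ℤ [ P ]
        ... | yes e = e
        ... | no ¬e = contradiction (suc k , k<p , P∤small k k<p , ¬e) none
        open ≈-Reasoning P
        eq : ∀ x → 1ℤ + x * 1ℤ ≡ 1ℤ + x
        eq = solve-∀
        1≈0 : 1ℤ ≈ 0ℤ [ P ]
        1≈0 = ≈-linear₂ 1ℤ -1ℤ refl (begin
          1ℤ + 0ℤ                                             ≈⟨ +-cong (≈-refl {x = 1ℤ}) (≈-sym (∑ₚ^≈0 (suc s) s<p-1)) ⟩
          1ℤ + ∑ₚ (_^ suc s)                                  ≡⟨ cong (_+_ 1ℤ) (∑-suc p-1 _) ⟩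
          1ℤ + (0ℤ + ∑ p-1 (λ k → (+ suc k) ^ suc s))
            ≈⟨ +-cong (≈-refl {x = 1ℤ}) (+-cong (≈-refl {x = 0ℤ}) (∑-cong-< p-1 λ k k<p-1 → all-roots k (ℕ.s<s k<p-1))) ⟩
          1ℤ + (0ℤ + ∑ p-1 (λ _ → 1ℤ))                        ≡⟨ cong (_+_ 1ℤ) (trans (ℤ.+-identityˡ _) (∑-const p-1 1ℤ)) ⟩
          1ℤ + + p-1 * 1ℤ                                     ≡⟨ eq (+ p-1) ⟩
          P                                                   ≈⟨ modulus≈0 P ⟩
          0ℤ ∎) (≈-refl {x = 0ℤ})

    -- x ^ p is the Teichmüller representative of x modulo p².
    teichmüllerSum : ℕ → ℤ
    teichmüllerSum r = ∑ₚ (λ x → (x ^ p) ^ r)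

    teichmüllerSum-multiple : ∀ q → teichmüllerSum (suc q ℕ.* p-1) ≈ + p-1 [ P² ]
    teichmüllerSum-multiple q = begin
      ∑ₚ (λ x → (x ^ p) ^ (suc q ℕ.* p-1))
        ≡⟨ ∑-suc p-1 _ ⟩
      (0ℤ ^ p) ^ (suc q ℕ.* p-1) + ∑ p-1 (λ k → ((+ suc k) ^ p) ^ (suc q ℕ.* p-1))
        ≈⟨ +-cong (≈-reflexive (trans (cong ((0ℤ ^ p) ^_) (ℕ.*-comm (suc q) p-1))
             (trans (sym (ℤ.^-*-assoc (0ℤ ^ p) p-1 (suc q))) (0^≡0 p-1 p-1≢0)))) (∑-cong-< p-1 unit) ⟩
      0ℤ + ∑ p-1 (λ _ → 1ℤ)
        ≡⟨ trans (ℤ.+-identityˡ _) (trans (∑-const p-1 1ℤ) (ℤ.*-identityʳ (+ p-1))) ⟩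
      + p-1 ∎
      where
      open ≈-Reasoning P²
      0^≡0 : ∀ k → ¬ k ≡ 0 → (0ℤ ^ k) ^ suc q ≡ 0ℤ
      0^≡0 zero    k≢0 = contradiction refl k≢0
      0^≡0 (suc k) _   = refl
      unit : ∀ k → k ℕ.< p-1 → ((+ suc k) ^ p) ^ (suc q ℕ.* p-1) ≈ 1ℤ [ P² ]
      unit k k<p-1 = begin
        (x ^ p) ^ (suc q ℕ.* p-1)      ≡⟨ cong ((x ^ p) ^_) (ℕ.*-comm (suc q) p-1) ⟩
        (x ^ p) ^ (p-1 ℕ.* suc q)      ≡⟨ sym (ℤ.^-*-assoc (x ^ p) p-1 (suc q)) ⟩
        ((x ^ p) ^ p-1) ^ suc q        ≡⟨ cong (_^ suc q) (^-swap x p p-1) ⟩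
        ((x ^ p-1) ^ p) ^ suc q        ≈⟨ ^-cong (suc q) (^P-lift (x^[p-1]≈1 (P∤small k (ℕ.s<s k<p-1)))) ⟩
        (1ℤ ^ p) ^ suc q               ≡⟨ trans (cong (_^ suc q) (ℤ.^-zeroˡ p)) (ℤ.^-zeroˡ (suc q)) ⟩
        1ℤ ∎
        where x = + suc k

    -- Replacing x by y x multiplies the sum by y^(p r) without changing it. For y from `nonroot`
    -- this factor is y^(s + 1) modulo p, so factor - 1 is prime to p and cancels even modulo p².
    teichmüllerSum-nonmultiple : ∀ s q → suc s ℕ.< p-1 → teichmüllerSum (suc s ℕ.+ q ℕ.* p-1) ≈ 0ℤ [ P² ]
    teichmüllerSum-nonmultiple s q s<p-1 =
      ≈P²-cancelˡ {c = h y - 1ℤ} P∤hy-1 (≈-linear 1ℤ (eq (h y) (∑ₚ h)) scaled)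
      where
      y = proj₁ (nonroot s s<p-1)
      P∤y = proj₁ (proj₂ (nonroot s s<p-1))
      y^s≉1 = proj₂ (proj₂ (nonroot s s<p-1))
      open ≈-Reasoning P
      r = suc s ℕ.+ q ℕ.* p-1
      h : ℤ → ℤ
      h x = (x ^ p) ^ r
      eq : ∀ c t → (c - 1ℤ) * t - (c - 1ℤ) * 0ℤ ≡ 1ℤ * (c * t - t)
      eq = solve-∀
      h-* : ∀ x → h (y * x) ≡ h y * h x
      h-* x = trans (cong (_^ r) (^-distrib-* y x p)) (^-distrib-* (y ^ p) (x ^ p) r)
      scaled : h y * ∑ₚ h ≈ ∑ₚ h [ P² ]
      scaled = ≈-trans
        (≈-reflexive (sym (trans (∑-cong-≡ p λ k → h-* (+ k)) (∑-*ˡ p (h y) _))))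
        (∑ₚ-scale {h = h} (^-cong r ∘ ^P-lift) P∤y)
      hy≈y^s : h y ≈ y ^ suc s [ P ]
      hy≈y^s = begin
        (y ^ p) ^ r                          ≈⟨ ^-cong r (x^p≈x y) ⟩
        y ^ (suc s ℕ.+ q ℕ.* p-1)            ≡⟨ ℤ.^-distribˡ-+-* y (suc s) (q ℕ.* p-1) ⟩
        y ^ suc s * y ^ (q ℕ.* p-1)          ≡⟨ cong (λ e → y ^ suc s * y ^ e) (ℕ.*-comm q p-1) ⟩
        y ^ suc s * y ^ (p-1 ℕ.* q)          ≡⟨ cong (y ^ suc s *_) (sym (ℤ.^-*-assoc y p-1 q)) ⟩
        y ^ suc s * (y ^ p-1) ^ q            ≈⟨ *-congˡ (y ^ suc s) (^-cong q (x^[p-1]≈1 P∤y)) ⟩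
        y ^ suc s * 1ℤ ^ q                   ≡⟨ trans (cong (y ^ suc s *_) (ℤ.^-zeroˡ q)) (ℤ.*-identityʳ (y ^ suc s)) ⟩
        y ^ suc s ∎
      P∤hy-1 : ¬ P ∣ h y - 1ℤ
      P∤hy-1 P∣hy-1 = y^s≉1 (≈-trans (≈-sym hy≈y^s) (∣⇒≈ P∣hy-1))

  -- The Legendre symbol and its autocorrelation

  module LegendreSymbol (n : ℕ) (prime : Prime (suc ((n ℕ.+ n) ℕ.+ (n ℕ.+ n)))) where

    private
      m = n ℕ.+ n
      p = suc (m ℕ.+ m)

    open PrimeModulus (m ℕ.+ m) prime
    open ResidueSums (m ℕ.+ m) prime

    0<n : 0 ℕ.< n
    0<n = ℕ.n≢0⇒n>0 λ { refl → ¬prime[1] prime }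

    2<p : 2 ℕ.< p
    2<p = ℕ.s<s (ℕ.≤-trans (ℕ.+-mono-≤ 0<n 0<n) (ℕ.m≤m+n m m))

    P∤2 : ¬ P ∣ + 2
    P∤2 = P∤small 1 2<p

    data Ternary : ℤ → Set where
      zero  : Ternary 0ℤ
      one   : Ternary 1ℤ
      minus : Ternary -1ℤ

    ternary-* : ∀ {u v} → Ternary u → Ternary v → Ternary (u * v)
    ternary-* zero  v     = zero
    ternary-* one   zero  = zero
    ternary-* one   one   = one
    ternary-* one   minus = minus
    ternary-* minus zero  = zero
    ternary-* minus one   = minus
    ternary-* minus minus = one

    -- As p > 2, the values 0, 1 and -1 are pairwise incongruent. Euler's criterion, a congruence,
    -- thus determines ψ exactly, and multiplicativity is inherited from powers.
    ternary-≈⇒≡ : ∀ {u v} → Ternary u → Ternary v → u ≈ v [ P ] → u ≡ v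
    ternary-≈⇒≡ zero  zero  _ = refl
    ternary-≈⇒≡ one   one   _ = refl
    ternary-≈⇒≡ minus minus _ = refl
    ternary-≈⇒≡ one   zero  e = contradiction (≈⇒∣ e) P∤1
    ternary-≈⇒≡ zero  one   e = contradiction (≈⇒∣ (≈-sym e)) P∤1
    ternary-≈⇒≡ zero  minus e = contradiction (≈⇒∣ e) P∤1
    ternary-≈⇒≡ minus zero  e = contradiction (≈⇒∣ (≈-sym e)) P∤1
    ternary-≈⇒≡ one   minus e = contradiction (≈⇒∣ e) P∤2
    ternary-≈⇒≡ minus one   e = contradiction (≈⇒∣ (≈-sym e)) P∤2

    opaque
      x^m≈±1 : ∀ {x} → ¬ P ∣ x → x ^ m ≈ 1ℤ [ P ] ⊎ x ^ m ≈ -1ℤ [ P ]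
      x^m≈±1 {x} P∤x = Sum.map ∣⇒≈ (∣⇒≈ {x = x ^ m} {y = -1ℤ}) (P∣*⇒P∣⊎P∣ {x ^ m - 1ℤ} {x ^ m + 1ℤ}
        (≈0⇒∣ (≈-linear 1ℤ (eq (x ^ m)) (≈-trans (≈-reflexive (sym (ℤ.^-distribˡ-+-* x m m))) (x^[p-1]≈1 P∤x)))))
        where
        eq : ∀ a → (a - 1ℤ) * (a + 1ℤ) - 0ℤ ≡ 1ℤ * (a * a - 1ℤ)
        eq = solve-∀

    opaque
      -- Euler's criterion is taken as the definition; the link with square roots enters later,
      -- through `rootCount≡2`.
      ψ : ℤ → ℤ
      ψ x with P∣? x | x ^ m ≈? 1ℤ [ P ]
      ... | yes _ | _     = 0ℤ
      ... | no  _ | yes _ = 1ℤ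
      ... | no  _ | no  _ = -1ℤ

      ψ-ternary : ∀ x → Ternary (ψ x)
      ψ-ternary x with P∣? x | x ^ m ≈? 1ℤ [ P ]
      ... | yes _ | _     = zero
      ... | no  _ | yes _ = one
      ... | no  _ | no  _ = minus

      ψ≈^m : ∀ x → ψ x ≈ x ^ m [ P ]
      ψ≈^m x with P∣? x | x ^ m ≈? 1ℤ [ P ]
      ... | yes P∣x | _     = ≈-sym (∣⇒^≈0 m (ℕ.≤-trans 0<n (ℕ.m≤m+n n n)))
        where
        ∣⇒^≈0 : ∀ k → 0 ℕ.< k → x ^ k ≈ 0ℤ [ P ]
        ∣⇒^≈0 (suc k) _ = ≈-trans (*-congʳ (x ^ k) (∣⇒≈0 P∣x)) (≈-reflexive (ℤ.*-zeroˡ (x ^ k)))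
      ... | no  _   | yes e = ≈-sym e
      ... | no  P∤x | no ¬e = ≈-sym (Sum.[ (λ e → contradiction e ¬e) , id ]′ (x^m≈±1 P∤x))

    ψ-unique : ∀ x {u} → Ternary u → x ^ m ≈ u [ P ] → ψ x ≡ u
    ψ-unique x t e = ternary-≈⇒≡ (ψ-ternary x) t (≈-trans (ψ≈^m x) e)

    ψ-cong : ∀ {x y} → x ≈ y [ P ] → ψ x ≡ ψ y
    ψ-cong {x} {y} e = ψ-unique x (ψ-ternary y) (≈-trans (^-cong m e) (≈-sym (ψ≈^m y)))

    ψ-* : ∀ x y → ψ (x * y) ≡ ψ x * ψ y
    ψ-* x y = ψ-unique (x * y) (ternary-* (ψ-ternary x) (ψ-ternary y))
      (≈-trans (≈-reflexive (^-distrib-* x y m)) (*-cong (≈-sym (ψ≈^m x)) (≈-sym (ψ≈^m y))))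

    ψ-∣ : ∀ {x} → P ∣ x → ψ x ≡ 0ℤ
    ψ-∣ {x} P∣x = trans (ψ-cong (∣⇒≈0 P∣x)) (ψ-unique 0ℤ zero (≈-reflexive (0^k≡0 m (ℕ.≤-trans 0<n (ℕ.m≤m+n n n)))))
      where
      0^k≡0 : ∀ k → 0 ℕ.< k → 0ℤ ^ k ≡ 0ℤ
      0^k≡0 (suc k) _ = refl

    ψ-1 : ψ 1ℤ ≡ 1ℤ
    ψ-1 = ψ-unique 1ℤ one (≈-reflexive (ℤ.^-zeroˡ m))

    ψ--1 : ψ -1ℤ ≡ 1ℤ
    ψ--1 = ψ-unique -1ℤ one (≈-reflexive (-1^[n+n]≡1 n))

    ψ-neg : ∀ x → ψ (- x) ≡ ψ x
    ψ-neg x = trans (cong ψ (sym (ℤ.-1*i≡-i x))) (trans (ψ-* -1ℤ x)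
      (trans (cong (_* ψ x) ψ--1) (ℤ.*-identityˡ (ψ x))))

    opaque
      ψ-∤ : ∀ {x} → ¬ P ∣ x → ψ x ≡ 1ℤ ⊎ ψ x ≡ -1ℤ
      ψ-∤ {x} P∤x = Sum.map (ψ-unique x one) (ψ-unique x minus) (x^m≈±1 P∤x)

    ψ*ψ≡1 : ∀ {x} → ¬ P ∣ x → ψ x * ψ x ≡ 1ℤ
    ψ*ψ≡1 P∤x = Sum.[ (λ e → cong₂ _*_ e e) , (λ e → cong₂ _*_ e e) ]′ (ψ-∤ P∤x)

    ψ*ψ≡1-δ : ∀ x → ψ x * ψ x ≡ 1ℤ - δ x
    ψ*ψ≡1-δ x with P∣? x
    ... | yes P∣x = trans (cong (λ u → u * u) (ψ-∣ P∣x)) (cong (_-_ 1ℤ) (sym (δ-∣ P∣x)))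
    ... | no  P∤x = trans (ψ*ψ≡1 P∤x) (cong (_-_ 1ℤ) (sym (δ-∤ P∤x)))

    opaque
      -- `nonroot` at the exponent m, which is strictly below p - 1 = 2m.
      nonresidue : ∃[ g ] ψ g ≡ -1ℤ
      nonresidue = go m (ℕ.≤-trans 0<n (ℕ.m≤m+n n n)) (ℕ.m<m+n m (ℕ.≤-trans 0<n (ℕ.m≤m+n n n))) refl
        where
        not-root : ∀ {k g} → k ≡ m → ¬ P ∣ g → ¬ g ^ k ≈ 1ℤ [ P ] → ψ g ≡ -1ℤ
        not-root {g = g} refl P∤g g^m≉1 =
          Sum.[ (λ e → contradiction (≈-trans (≈-sym (ψ≈^m g)) (≈-reflexive e)) g^m≉1) , id ]′ (ψ-∤ P∤g)
        go : ∀ k → 0 ℕ.< k → k ℕ.< m ℕ.+ m → k ≡ m → ∃[ g ] ψ g ≡ -1ℤ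
        go (suc k) _ k<p-1 k≡m = let g , P∤g , g^k≉1 = nonroot k k<p-1 in g , not-root k≡m P∤g g^k≉1

    ψ≡-1⇒∤ : ∀ {g} → ψ g ≡ -1ℤ → ¬ P ∣ g
    ψ≡-1⇒∤ e P∣g = contradiction (trans (sym e) (ψ-∣ P∣g)) λ ()

    ∑ₚ-reflect : ∀ {N h} → Periodic N h → ∀ c → ∑ₚ (λ x → h (c - x)) ≈ ∑ₚ h [ N ]
    ∑ₚ-reflect periodic c = ∑ₚ-reindex periodic (λ x → c - x) (λ y → c - y)
      (λ x y → subst (P ∣_) (eq x y c)) (λ x y → subst (P ∣_) (sym (eq x y c)))
      where
      eq : ∀ x y c → y - (c - x) ≡ x - (c - y)
      eq = solve-∀

    ∑ₚ-* : ∀ f h → ∑ₚ f * ∑ₚ h ≡ ∑ₚ (λ x → ∑ₚ (λ y → f x * h y))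
    ∑ₚ-* f h = trans (sym (∑-*ʳ p (∑ₚ h) (f ∘ +_))) (∑-cong-≡ p λ k → sym (∑-*ˡ p (f (+ k)) _))

    ∑ₚ-δ-filter : ∀ {h} → Periodic 0ℤ h → ∀ z → ∑ₚ (λ x → h x * δ (x - z)) ≡ h z
    ∑ₚ-δ-filter periodic z = ≈[0]⇒≡ (∑ₚ-*δ periodic z)

    periodic-≡ : ∀ {h} → (∀ {x y} → x ≈ y [ P ] → h x ≡ h y) → Periodic 0ℤ h
    periodic-≡ e = ≈-reflexive ∘ e

    ≡-periodic : ∀ {h : ℤ → ℤ} → Periodic 0ℤ h → ∀ {x y} → x ≈ y [ P ] → h x ≡ h y
    ≡-periodic periodic = ≈[0]⇒≡ ∘ periodic

    ψ-periodic : Periodic 0ℤ ψ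
    ψ-periodic = periodic-≡ ψ-cong

    -- Scaling x by a nonresidue both preserves the sum and changes its sign.
    ∑ₚψ≡0 : ∑ₚ ψ ≡ 0ℤ
    ∑ₚψ≡0 = ℤ.*-cancelˡ-≡ (+ 2) (∑ₚ ψ) 0ℤ (begin
      + 2 * ∑ₚ ψ               ≡⟨ eq (∑ₚ ψ) ⟩
      ∑ₚ ψ - (-1ℤ * ∑ₚ ψ)      ≡⟨ cong (λ u → ∑ₚ ψ - u * ∑ₚ ψ) (sym ψg≡-1) ⟩
      ∑ₚ ψ - (ψ g * ∑ₚ ψ)      ≡⟨ cong (_-_ (∑ₚ ψ)) (trans (sym (∑-*ˡ p (ψ g) _))
                                    (∑-cong-≡ p λ k → sym (ψ-* g (+ k)))) ⟩
      ∑ₚ ψ - ∑ₚ (λ x → ψ (g * x))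
        ≡⟨ cong (_-_ (∑ₚ ψ)) (≈[0]⇒≡ (∑ₚ-scale {h = ψ} ψ-periodic (ψ≡-1⇒∤ ψg≡-1))) ⟩
      ∑ₚ ψ - ∑ₚ ψ              ≡⟨ ℤ.+-inverseʳ (∑ₚ ψ) ⟩
      0ℤ ∎)
      where
      open ≡-Reasoning
      g = proj₁ nonresidue
      ψg≡-1 = proj₂ nonresidue
      eq : ∀ a → + 2 * a ≡ a - (-1ℤ * a)
      eq = solve-∀

    correlation : ℤ → ℤ
    correlation c = ∑ₚ (λ r → ψ r * ψ (r + c))

    ∑ₚ-δ : ∑ₚ δ ≡ 1ℤ
    ∑ₚ-δ = trans (∑-cong-≡ p λ k → cong δ (sym (ℤ.+-identityʳ (+ k)))) (∑ₚδ 0ℤ)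

    ∑ₚ-1 : ∑ₚ (λ _ → 1ℤ) ≡ P
    ∑ₚ-1 = trans (∑-const p 1ℤ) (ℤ.*-identityʳ P)

    ∑ₚψ*ψ : ∑ₚ (λ x → ψ x * ψ x) ≡ P - 1ℤ
    ∑ₚψ*ψ = trans (∑-cong-≡ p λ k → ψ*ψ≡1-δ (+ k)) (trans (∑-minus p _ _) (cong₂ _-_ ∑ₚ-1 ∑ₚ-δ))

    correlation-cong : ∀ {c d} → c ≈ d [ P ] → correlation c ≡ correlation d
    correlation-cong {c} {d} e = ∑-cong-≡ p λ k → cong (ψ (+ k) *_) (ψ-cong (+-cong (≈-refl {x = + k}) e))

    correlation-∣ : ∀ {c} → P ∣ c → correlation c ≡ P - 1ℤ
    correlation-∣ P∣c = trans (correlation-cong (∣⇒≈0 P∣c))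
      (trans (∑-cong-≡ p λ k → cong (λ x → ψ (+ k) * ψ x) (ℤ.+-identityʳ (+ k))) ∑ₚψ*ψ)

    -- The substitution r ↦ c r pulls out ψ(c)² = 1.
    correlation-∤ : ∀ {c} → ¬ P ∣ c → correlation c ≡ correlation 1ℤ
    correlation-∤ {c} P∤c = begin
      ∑ₚ (λ r → ψ r * ψ (r + c))
        ≡⟨ sym (≈[0]⇒≡ (∑ₚ-scale {h = λ r → ψ r * ψ (r + c)}
             (λ e → *-cong (ψ-periodic e) (ψ-periodic (+-cong e (≈-refl {x = c})))) P∤c)) ⟩
      ∑ₚ (λ r → ψ (c * r) * ψ (c * r + c))
        ≡⟨ ∑-cong-≡ p (λ k → trans (cong₂ _*_ (ψ-* c (+ k)) (trans (cong ψ (eq₁ c (+ k))) (ψ-* c (+ k + 1ℤ))))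
             (trans (eq₂ (ψ c) (ψ (+ k)) (ψ (+ k + 1ℤ)))
               (trans (cong (_* (ψ (+ k) * ψ (+ k + 1ℤ))) (ψ*ψ≡1 P∤c)) (ℤ.*-identityˡ (ψ (+ k) * ψ (+ k + 1ℤ)))))) ⟩
      ∑ₚ (λ r → ψ r * ψ (r + 1ℤ)) ∎
      where
      open ≡-Reasoning
      eq₁ : ∀ c r → c * r + c ≡ c * (r + 1ℤ)
      eq₁ = solve-∀
      eq₂ : ∀ a b d → a * b * (a * d) ≡ a * a * (b * d)
      eq₂ = solve-∀

    ∑ₚ-correlation : ∑ₚ correlation ≡ 0ℤ
    ∑ₚ-correlation = begin
      ∑ₚ (λ c → ∑ₚ (λ r → ψ r * ψ (r + c)))
        ≡⟨ ∑-swap p p _ ⟩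
      ∑ₚ (λ r → ∑ₚ (λ c → ψ r * ψ (r + c)))
        ≡⟨ ∑-cong-≡ p (λ k → trans (∑-*ˡ p (ψ (+ k)) _) (trans (cong (ψ (+ k) *_)
             (trans (trans (∑-cong-≡ p λ j → cong ψ (ℤ.+-comm (+ k) (+ j))) (≈[0]⇒≡ (∑ₚ-shift {h = ψ} ψ-periodic (+ k)))) ∑ₚψ≡0))
             (ℤ.*-zeroʳ (ψ (+ k))))) ⟩
      ∑ₚ (λ r → 0ℤ)
        ≡⟨ ∑-zero p ⟩
      0ℤ ∎
      where open ≡-Reasoning

    -- The correlations over all shifts add up to 0; the shift 0 contributes p - 1 and the other p -
    -- 1 shifts contribute one common value.
    correlation-1 : correlation 1ℤ ≡ -1ℤ
    correlation-1 = ℤ.*-cancelˡ-≡ (+ (m ℕ.+ m)) (correlation 1ℤ) -1ℤ {{ℤ.≢-nonZero (p-1≢0 ∘ ℤ.+-injective)}} (begin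
      + (m ℕ.+ m) * correlation 1ℤ
        ≡⟨ eq₁ (+ (m ℕ.+ m)) (+ (m ℕ.+ m) * correlation 1ℤ) ⟩
      + (m ℕ.+ m) * -1ℤ + ((1ℤ + + (m ℕ.+ m) - 1ℤ) + + (m ℕ.+ m) * correlation 1ℤ)
        ≡⟨ cong (λ u → + (m ℕ.+ m) * -1ℤ + u) (cong₂ _+_ (sym (correlation-∣ P∣0)) (sym (∑-const (m ℕ.+ m) (correlation 1ℤ)))) ⟩
      + (m ℕ.+ m) * -1ℤ + (correlation 0ℤ + ∑ (m ℕ.+ m) (λ _ → correlation 1ℤ))
        ≡⟨ cong (λ u → + (m ℕ.+ m) * -1ℤ + (correlation 0ℤ + u))
             (∑-cong-≡-< (m ℕ.+ m) λ k k<p-1 → sym (correlation-∤ (P∤small k (ℕ.s<s k<p-1)))) ⟩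
      + (m ℕ.+ m) * -1ℤ + (correlation 0ℤ + ∑ (m ℕ.+ m) (λ k → correlation (+ suc k)))
        ≡⟨ cong (λ u → + (m ℕ.+ m) * -1ℤ + u) (trans (sym (∑-suc (m ℕ.+ m) _)) ∑ₚ-correlation) ⟩
      + (m ℕ.+ m) * -1ℤ + 0ℤ
        ≡⟨ ℤ.+-identityʳ _ ⟩
      + (m ℕ.+ m) * -1ℤ ∎)
      where
      open ≡-Reasoning
      eq₁ : ∀ q a → a ≡ q * -1ℤ + ((1ℤ + q - 1ℤ) + a)
      eq₁ = solve-∀

    correlation≡ : ∀ c → correlation c ≡ P * δ c - 1ℤ
    correlation≡ c with P∣? c
    ... | yes P∣c = trans (correlation-∣ P∣c) (cong (_- 1ℤ) (sym (trans (cong (P *_) (δ-∣ P∣c)) (ℤ.*-identityʳ P))))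
    ... | no  P∤c = trans (correlation-∤ P∤c) (trans correlation-1
      (cong (_- 1ℤ) (sym (trans (cong (P *_) (δ-∤ P∤c)) (ℤ.*-zeroʳ P)))))

  -- Jacobsthal sums and their second moment

  0≤i*i : ∀ i → 0ℤ ℤ.≤ i * i
  0≤i*i (+ k)    = subst (0ℤ ℤ.≤_) (ℤ.pos-* k k) (ℤ.+≤+ ℕ.z≤n)
  0≤i*i -[1+ k ] = ℤ.+≤+ ℕ.z≤n

  i*i≡0⇒i≡0 : ∀ i → i * i ≡ 0ℤ → i ≡ 0ℤ
  i*i≡0⇒i≡0 i e = Sum.[ id , id ]′ (ℤ.i*j≡0⇒i≡0∨j≡0 i e)

  0≤i,j∧i+j≡0⇒i≡0 : ∀ i j → 0ℤ ℤ.≤ i → 0ℤ ℤ.≤ j → i + j ≡ 0ℤ → i ≡ 0ℤ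
  0≤i,j∧i+j≡0⇒i≡0 i j 0≤i 0≤j e = ℤ.≤-antisym
    (subst (i ℤ.≤_) e (subst (ℤ._≤ i + j) (ℤ.+-identityʳ i) (ℤ.+-monoʳ-≤ i 0≤j))) 0≤i

  ∑-squares≥0 : ∀ n (f : ℕ → ℤ) → 0ℤ ℤ.≤ ∑ n (λ k → f k * f k)
  ∑-squares≥0 zero    f = subst (0ℤ ℤ.≤_) (sym (∑-0 _)) ℤ.≤-refl
  ∑-squares≥0 (suc n) f = subst (0ℤ ℤ.≤_) (sym (∑-suc n (λ k → f k * f k)))
    (ℤ.+-mono-≤ {0ℤ} {f 0 * f 0} {0ℤ} (0≤i*i (f 0)) (∑-squares≥0 n (f ∘ suc)))

  ∑-squares≡0 : ∀ n (f : ℕ → ℤ) → ∑ n (λ k → f k * f k) ≡ 0ℤ → ∀ k → k ℕ.< n → f k ≡ 0ℤ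
  ∑-squares≡0 (suc n) f e = λ
    { zero    _           → i*i≡0⇒i≡0 (f 0) (0≤i,j∧i+j≡0⇒i≡0 (f 0 * f 0) tail (0≤i*i (f 0)) (∑-squares≥0 n (f ∘ suc)) e′)
    ; (suc k) (ℕ.s≤s k<n) → ∑-squares≡0 n (f ∘ suc)
        (0≤i,j∧i+j≡0⇒i≡0 tail (f 0 * f 0) (∑-squares≥0 n (f ∘ suc)) (0≤i*i (f 0)) (trans (ℤ.+-comm tail (f 0 * f 0)) e′)) k k<n
    }
    where
    tail : ℤ
    tail = ∑ n (λ k → f (suc k) * f (suc k))
    e′ : f 0 * f 0 + tail ≡ 0ℤ
    e′ = trans (sym (∑-suc n (λ k → f k * f k))) e

  module JacobsthalSums (n : ℕ) (prime : Prime (suc ((n ℕ.+ n) ℕ.+ (n ℕ.+ n)))) where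

    private
      m = n ℕ.+ n
      p = suc (m ℕ.+ m)

    open PrimeModulus (m ℕ.+ m) prime
    open ResidueSums (m ℕ.+ m) prime
    open LegendreSymbol n prime

    -- For r prime to p this is minus the trace of Frobenius of the elliptic curve y² = x³ - r x.
    jacobsthal : ℤ → ℤ
    jacobsthal r = ∑ₚ (λ x → ψ x * ψ (x * x - r))

    jacobsthal-cong : ∀ {r s} → r ≈ s [ P ] → jacobsthal r ≡ jacobsthal s
    jacobsthal-cong e = ∑-cong-≡ p λ k → cong (ψ (+ k) *_)
      (ψ-cong (minus-cong (≈-refl {x = + k * + k}) e))

    -- Inclusion and exclusion for y² - x² = (y - x)(y + x): as p is odd, both factors vanish only
    -- when x and y do, and the product term removes that double count.
    δ-squares : ∀ x y → δ (y * y - x * x) ≡ δ (y - x) + δ (y - - x) - δ x * δ y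
    δ-squares x y with P∣? x | P∣? y
    ... | yes P∣x | yes P∣y = trans (δ-∣ (subst (P ∣_) (eq₁ x y) (P∣x∧P∣y⇒P∣x+c*y (- x) (P∣⇒P∣* y P∣y) P∣x)))
      (sym (cong₂ _-_ (cong₂ _+_
        (δ-∣ (subst (P ∣_) (eq₂ x y) (P∣x∧P∣y⇒P∣x+c*y -1ℤ P∣y P∣x)))
        (δ-∣ (subst (P ∣_) (eq₃ x y) (P∣x∧P∣y⇒P∣x+c*y 1ℤ P∣y P∣x))))
        (cong₂ _*_ (δ-∣ P∣x) (δ-∣ P∣y))))
      where
      eq₁ : ∀ x y → y * y + (- x) * x ≡ y * y - x * x
      eq₁ = solve-∀
      eq₂ : ∀ x y → y + -1ℤ * x ≡ y - x
      eq₂ = solve-∀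
      eq₃ : ∀ x y → y + 1ℤ * x ≡ y - - x
      eq₃ = solve-∀
    ... | yes P∣x | no P∤y = trans
      (δ-∤ λ d → P∤y (P∣x*x⇒P∣x (subst (P ∣_) (eq₁ x y) (P∣x∧P∣y⇒P∣x+c*y x d P∣x))))
      (sym (trans (cong₂ (λ u v → u + v - δ x * δ y)
        (δ-∤ λ d → P∤y (subst (P ∣_) (eq₂ x y) (P∣x∧P∣y⇒P∣x+c*y 1ℤ d P∣x)))
        (δ-∤ λ d → P∤y (subst (P ∣_) (eq₃ x y) (P∣x∧P∣y⇒P∣x+c*y -1ℤ d P∣x))))
        (trans (cong (λ u → 0ℤ - δ x * u) (δ-∤ P∤y)) (eq₄ (δ x)))))
      where
      eq₁ : ∀ x y → y * y - x * x + x * x ≡ y * y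
      eq₁ = solve-∀
      eq₂ : ∀ x y → y - x + 1ℤ * x ≡ y
      eq₂ = solve-∀
      eq₃ : ∀ x y → y - - x + -1ℤ * x ≡ y
      eq₃ = solve-∀
      eq₄ : ∀ d → 0ℤ - d * 0ℤ ≡ 0ℤ
      eq₄ = solve-∀
    ... | no P∤x | _ with P∣? y - x | P∣? y - - x
    ...   | yes d | yes d′ = contradiction (subst (P ∣_) (eq x y) (P∣x∧P∣y⇒P∣x+c*y -1ℤ d′ d)) (P∤* P∤2 P∤x)
      where
      eq : ∀ x y → y - - x + -1ℤ * (y - x) ≡ + 2 * x
      eq = solve-∀
    ...   | yes d | no ¬d′ = trans
      (δ-∣ (subst (P ∣_) (eq₁ x y) (P∣⇒P∣* (y + x) d)))
      (sym (trans (cong₂ (λ u v → u + v - δ x * δ y) (δ-∣ d) (δ-∤ ¬d′))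
        (trans (cong (λ u → 1ℤ + 0ℤ - u * δ y) (δ-∤ P∤x)) (eq₂ (δ y)))))
      where
      eq₁ : ∀ x y → (y + x) * (y - x) ≡ y * y - x * x
      eq₁ = solve-∀
      eq₂ : ∀ d → 1ℤ + 0ℤ - 0ℤ * d ≡ 1ℤ
      eq₂ = solve-∀
    ...   | no ¬d | yes d′ = trans
      (δ-∣ (subst (P ∣_) (eq₁ x y) (P∣⇒P∣* (y - x) d′)))
      (sym (trans (cong₂ (λ u v → u + v - δ x * δ y) (δ-∤ ¬d) (δ-∣ d′))
        (trans (cong (λ u → 0ℤ + 1ℤ - u * δ y) (δ-∤ P∤x)) (eq₂ (δ y)))))
      where
      eq₁ : ∀ x y → (y - x) * (y - - x) ≡ y * y - x * x
      eq₁ = solve-∀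
      eq₂ : ∀ d → 0ℤ + 1ℤ - 0ℤ * d ≡ 1ℤ
      eq₂ = solve-∀
    ...   | no ¬d | no ¬d′ = trans
      (δ-∤ (P∤* ¬d ¬d′ ∘ subst (P ∣_) (eq₁ x y)))
      (sym (trans (cong₂ (λ u v → u + v - δ x * δ y) (δ-∤ ¬d) (δ-∤ ¬d′))
        (trans (cong (λ u → 0ℤ - u * δ y) (δ-∤ P∤x)) (eq₂ (δ y)))))
      where
      eq₁ : ∀ x y → y * y - x * x ≡ (y - x) * (y - - x)
      eq₁ = solve-∀
      eq₂ : ∀ d → 0ℤ - 0ℤ * d ≡ 0ℤ
      eq₂ = solve-∀

    ∑ₚ-ψ*δ-squares : ∀ x → ∑ₚ (λ y → ψ y * δ (y * y - x * x)) ≡ + 2 * ψ x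
    ∑ₚ-ψ*δ-squares x = begin
      ∑ₚ (λ y → ψ y * δ (y * y - x * x))
        ≡⟨ ∑-cong-≡ p (λ k → trans (cong (ψ (+ k) *_) (δ-squares x (+ k)))
             (trans (eq₁ (ψ (+ k)) (δ (+ k - x)) (δ (+ k - - x)) (δ x) (δ (+ k)))
               (cong (λ u → ψ (+ k) * δ (+ k - x) + ψ (+ k) * δ (+ k - - x) - δ x * (ψ (+ k) * δ u))
                 (sym (ℤ.+-identityʳ (+ k)))))) ⟩
      ∑ₚ (λ y → ψ y * δ (y - x) + ψ y * δ (y - - x) - δ x * (ψ y * δ (y - 0ℤ)))
        ≡⟨ trans (∑-minus p _ _) (cong₂ _-_ (∑-+ p _ _) (∑-*ˡ p (δ x) _)) ⟩
      ∑ₚ (λ y → ψ y * δ (y - x)) + ∑ₚ (λ y → ψ y * δ (y - - x)) - δ x * ∑ₚ (λ y → ψ y * δ (y - 0ℤ))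
        ≡⟨ cong₂ _-_ (cong₂ _+_ (∑ₚ-δ-filter ψ-periodic x) (trans (∑ₚ-δ-filter ψ-periodic (- x)) (ψ-neg x)))
             (cong (δ x *_) (trans (∑ₚ-δ-filter ψ-periodic 0ℤ) (ψ-∣ P∣0))) ⟩
      ψ x + ψ x - δ x * 0ℤ
        ≡⟨ eq₂ (ψ x) (δ x) ⟩
      + 2 * ψ x ∎
      where
      open ≡-Reasoning
      eq₁ : ∀ s a b c d → s * (a + b - c * d) ≡ s * a + s * b - c * (s * d)
      eq₁ = solve-∀
      eq₂ : ∀ s d → s + s - d * 0ℤ ≡ + 2 * s
      eq₂ = solve-∀

    private
      ∑ₚ³-rotate : ∀ (F : ℤ → ℤ → ℤ → ℤ) →
                   ∑ₚ (λ r → ∑ₚ (λ x → ∑ₚ (λ y → F r x y))) ≡ ∑ₚ (λ x → ∑ₚ (λ y → ∑ₚ (λ r → F r x y)))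
      ∑ₚ³-rotate F = trans (∑-swap p p _) (∑-cong-≡ p λ j → ∑-swap p p _)

    ∑ₚ-ψ-translates : ∀ c d → ∑ₚ (λ r → ψ (c - r) * ψ (d - r)) ≡ correlation (d - c)
    ∑ₚ-ψ-translates c d = trans
      (∑-cong-≡ p λ k → cong (λ x → ψ (c - + k) * ψ x) (eq c d (+ k)))
      (≈[0]⇒≡ (∑ₚ-reflect {h = λ r → ψ r * ψ (r + (d - c))}
        (λ e → *-cong (ψ-periodic e) (ψ-periodic (+-cong e (≈-refl {x = d - c})))) c))
      where
      eq : ∀ c d r → d - r ≡ c - r + (d - c)
      eq = solve-∀

    -- Expand the square and sum over r first: the inner sum is the correlation at y² - x², that is
    -- P δ(y² - x²) - 1. The -1 is killed by the vanishing sum of ψ, and the δ leaves only y = x and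
    -- y = -x, where ψ agrees.
    ∑ₚ-jacobsthal² : ∑ₚ (λ r → jacobsthal r * jacobsthal r) ≡ + 2 * P * (P - 1ℤ)
    ∑ₚ-jacobsthal² = begin
      ∑ₚ (λ r → jacobsthal r * jacobsthal r)
        ≡⟨ ∑-cong-≡ p (λ k → ∑ₚ-* (λ x → ψ x * ψ (x * x - + k)) (λ y → ψ y * ψ (y * y - + k))) ⟩
      ∑ₚ (λ r → ∑ₚ (λ x → ∑ₚ (λ y → ψ x * ψ (x * x - r) * (ψ y * ψ (y * y - r)))))
        ≡⟨ ∑ₚ³-rotate (λ r x y → ψ x * ψ (x * x - r) * (ψ y * ψ (y * y - r))) ⟩
      ∑ₚ (λ x → ∑ₚ (λ y → ∑ₚ (λ r → ψ x * ψ (x * x - r) * (ψ y * ψ (y * y - r)))))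
        ≡⟨ ∑-cong-≡ p (λ j → ∑-cong-≡ p λ k → inner (+ j) (+ k)) ⟩
      ∑ₚ (λ x → ∑ₚ (λ y → ψ x * P * (ψ y * δ (y * y - x * x)) - ψ x * ψ y))
        ≡⟨ ∑-cong-≡ p (λ j → outer (+ j)) ⟩
      ∑ₚ (λ x → + 2 * P * (ψ x * ψ x))
        ≡⟨ trans (∑-*ˡ p (+ 2 * P) _) (cong (+ 2 * P *_) ∑ₚψ*ψ) ⟩
      + 2 * P * (P - 1ℤ) ∎
      where
      open ≡-Reasoning
      eq₁ : ∀ a b c d → a * b * (c * d) ≡ a * c * (b * d)
      eq₁ = solve-∀
      eq₂ : ∀ a c q d → a * c * (q * d - 1ℤ) ≡ a * q * (c * d) - a * c
      eq₂ = solve-∀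
      eq₃ : ∀ s q → s * q * (+ 2 * s) - s * 0ℤ ≡ + 2 * q * (s * s)
      eq₃ = solve-∀
      inner : ∀ x y → ∑ₚ (λ r → ψ x * ψ (x * x - r) * (ψ y * ψ (y * y - r))) ≡
                      ψ x * P * (ψ y * δ (y * y - x * x)) - ψ x * ψ y
      inner x y = begin
        ∑ₚ (λ r → ψ x * ψ (x * x - r) * (ψ y * ψ (y * y - r)))
          ≡⟨ trans (∑-cong-≡ p λ k → eq₁ (ψ x) (ψ (x * x - + k)) (ψ y) (ψ (y * y - + k)))
               (∑-*ˡ p (ψ x * ψ y) _) ⟩
        ψ x * ψ y * ∑ₚ (λ r → ψ (x * x - r) * ψ (y * y - r))
          ≡⟨ cong (ψ x * ψ y *_) (trans (∑ₚ-ψ-translates (x * x) (y * y)) (correlation≡ (y * y - x * x))) ⟩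
        ψ x * ψ y * (P * δ (y * y - x * x) - 1ℤ)
          ≡⟨ eq₂ (ψ x) (ψ y) P (δ (y * y - x * x)) ⟩
        ψ x * P * (ψ y * δ (y * y - x * x)) - ψ x * ψ y ∎
      outer : ∀ x → ∑ₚ (λ y → ψ x * P * (ψ y * δ (y * y - x * x)) - ψ x * ψ y) ≡ + 2 * P * (ψ x * ψ x)
      outer x = begin
        ∑ₚ (λ y → ψ x * P * (ψ y * δ (y * y - x * x)) - ψ x * ψ y)
          ≡⟨ trans (∑-minus p _ _) (cong₂ _-_ (∑-*ˡ p (ψ x * P) _) (∑-*ˡ p (ψ x) _)) ⟩
        ψ x * P * ∑ₚ (λ y → ψ y * δ (y * y - x * x)) - ψ x * ∑ₚ ψ
          ≡⟨ cong₂ (λ u v → ψ x * P * u - ψ x * v) (∑ₚ-ψ*δ-squares x) ∑ₚψ≡0 ⟩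
        ψ x * P * (+ 2 * ψ x) - ψ x * 0ℤ
          ≡⟨ eq₃ (ψ x) P ⟩
        + 2 * P * (ψ x * ψ x) ∎

  -- The norm equation J(1)² + J(g)² = 4p

  module JacobsthalNorm (n : ℕ) (prime : Prime (suc ((n ℕ.+ n) ℕ.+ (n ℕ.+ n)))) where

    private
      m = n ℕ.+ n
      p = suc (m ℕ.+ m)

    open PrimeModulus (m ℕ.+ m) prime
    open ResidueSums (m ℕ.+ m) prime
    open LegendreSymbol n prime
    open JacobsthalSums n prime

    jacobsthal-0 : ∀ {r} → P ∣ r → jacobsthal r ≡ 0ℤ
    jacobsthal-0 {r} P∣r = trans (∑-cong-≡ p λ k → pointwise (+ k)) ∑ₚψ≡0
      where
      pointwise : ∀ x → ψ x * ψ (x * x - r) ≡ ψ x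
      pointwise x = trans (cong (ψ x *_) (trans (ψ-cong (≈-linear -1ℤ (eq₁ (x * x) r) (∣⇒≈0 P∣r))) (ψ-* x x)))
        (trans (cong (ψ x *_) (ψ*ψ≡1-δ x)) (cube x))
        where
        eq₁ : ∀ a r → a - r - a ≡ -1ℤ * (r - 0ℤ)
        eq₁ = solve-∀
        cube : ∀ x → ψ x * (1ℤ - δ x) ≡ ψ x
        cube x with P∣? x
        ... | yes P∣x = trans (cong (_* (1ℤ - δ x)) (ψ-∣ P∣x)) (trans (ℤ.*-zeroˡ (1ℤ - δ x)) (sym (ψ-∣ P∣x)))
        ... | no  P∤x = trans (cong (λ d → ψ x * (1ℤ - d)) (δ-∤ P∤x)) (ℤ.*-identityʳ (ψ x))

    -- By the substitution x ↦ t x. Consequently J(r)² depends only on the square class of r.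
    jacobsthal-*square : ∀ {t} r → ¬ P ∣ t → jacobsthal (r * (t * t)) ≡ ψ t * jacobsthal r
    jacobsthal-*square {t} r P∤t = begin
      ∑ₚ (λ x → ψ x * ψ (x * x - r * (t * t)))
        ≡⟨ sym (≈[0]⇒≡ (∑ₚ-scale {h = λ x → ψ x * ψ (x * x - r * (t * t))}
             (λ e → *-cong (ψ-periodic e) (ψ-periodic (minus-cong (*-cong e e) (≈-refl {x = r * (t * t)})))) P∤t)) ⟩
      ∑ₚ (λ x → ψ (t * x) * ψ (t * x * (t * x) - r * (t * t)))
        ≡⟨ ∑-cong-≡ p (λ k → pointwise (+ k)) ⟩
      ∑ₚ (λ x → ψ t * (ψ x * ψ (x * x - r)))
        ≡⟨ ∑-*ˡ p (ψ t) _ ⟩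
      ψ t * jacobsthal r ∎
      where
      open ≡-Reasoning
      eq₁ : ∀ t x r → t * x * (t * x) - r * (t * t) ≡ t * (t * (x * x - r))
      eq₁ = solve-∀
      eq₂ : ∀ a b c → a * b * (a * (a * c)) ≡ a * a * (a * (b * c))
      eq₂ = solve-∀
      pointwise : ∀ x → ψ (t * x) * ψ (t * x * (t * x) - r * (t * t)) ≡ ψ t * (ψ x * ψ (x * x - r))
      pointwise x = begin
        ψ (t * x) * ψ (t * x * (t * x) - r * (t * t))
          ≡⟨ cong₂ _*_ (ψ-* t x) (trans (cong ψ (eq₁ t x r)) (trans (ψ-* t (t * (x * x - r))) (cong (ψ t *_) (ψ-* t (x * x - r))))) ⟩
        ψ t * ψ x * (ψ t * (ψ t * ψ (x * x - r)))
          ≡⟨ eq₂ (ψ t) (ψ x) (ψ (x * x - r)) ⟩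
        ψ t * ψ t * (ψ t * (ψ x * ψ (x * x - r)))
          ≡⟨ trans (cong (_* (ψ t * (ψ x * ψ (x * x - r)))) (ψ*ψ≡1 P∤t)) (ℤ.*-identityˡ (ψ t * (ψ x * ψ (x * x - r)))) ⟩
        ψ t * (ψ x * ψ (x * x - r)) ∎

    module _ (g : ℤ) (ψg≡-1 : ψ g ≡ -1ℤ) where

      P∤g : ¬ P ∣ g
      P∤g = ψ≡-1⇒∤ ψg≡-1

      δ-twisted-squares : ∀ x y → δ (x * x - g * (y * y)) ≡ δ x * δ y
      δ-twisted-squares x y with P∣? x | P∣? y
      ... | yes P∣x | yes P∣y = trans
        (δ-∣ (subst (P ∣_) (eq x y g) (P∣x∧P∣y⇒P∣x+c*y (- (g * y)) (P∣⇒P∣* x P∣x) P∣y)))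
        (sym (cong₂ _*_ (δ-∣ P∣x) (δ-∣ P∣y)))
        where
        eq : ∀ x y g → x * x + (- (g * y)) * y ≡ x * x - g * (y * y)
        eq = solve-∀
      ... | no P∤x | _ = trans (δ-∤ λ d → contradiction (trans (sym (ψ-square P∤x)) (trans (ψ-cong (∣⇒≈ d)) (ψ-g* y))) (1≢-ψ² y))
        (sym (cong (_* δ y) (δ-∤ P∤x)))
        where
        ψ-square : ∀ {x} → ¬ P ∣ x → ψ (x * x) ≡ 1ℤ
        ψ-square {x} P∤x = trans (ψ-* x x) (ψ*ψ≡1 P∤x)
        ψ-g* : ∀ y → ψ (g * (y * y)) ≡ -1ℤ * (1ℤ - δ y)
        ψ-g* y = trans (ψ-* g (y * y)) (cong₂ _*_ ψg≡-1 (trans (ψ-* y y) (ψ*ψ≡1-δ y)))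
        1≢-ψ² : ∀ y → ¬ 1ℤ ≡ -1ℤ * (1ℤ - δ y)
        1≢-ψ² y with P∣? y
        ... | yes P∣y = λ e → contradiction (trans e (cong (λ d → -1ℤ * (1ℤ - d)) (δ-∣ P∣y))) λ ()
        ... | no  P∤y = λ e → contradiction (trans e (cong (λ d → -1ℤ * (1ℤ - d)) (δ-∤ P∤y))) λ ()
      ... | yes P∣x | no P∤y = trans
        (δ-∤ λ d → P∤* P∤g (P∤* P∤y P∤y) (subst (P ∣_) (eq x y g) (P∣x∧P∣y⇒P∣x+c*y -1ℤ (P∣⇒P∣* x P∣x) d)))
        (sym (trans (cong (δ x *_) (δ-∤ P∤y)) (ℤ.*-zeroʳ (δ x))))
        where
        eq : ∀ x y g → x * x + -1ℤ * (x * x - g * (y * y)) ≡ g * (y * y)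
        eq = solve-∀

      -- ∑ₚ (λ t → roots t r) counts the solutions t of t² = r and of g t² = r.
      roots : ℤ → ℤ → ℤ
      roots t r = δ (r - t * t) + δ (r - g * (t * t))

      private
        δ-cong : ∀ {x y} → x ≈ y [ P ] → δ x ≡ δ y
        δ-cong e = δ-⇔ (λ d → ≈0⇒∣ (≈-trans (≈-sym e) (∣⇒≈0 d))) (λ d → ≈0⇒∣ (≈-trans e (∣⇒≈0 d)))

      roots-periodic : ∀ t → Periodic 0ℤ (roots t)
      roots-periodic t e = ≈-reflexive (cong₂ _+_
        (δ-cong (minus-cong e (≈-refl {x = t * t}))) (δ-cong (minus-cong e (≈-refl {x = g * (t * t)}))))

      ∑ₚ-*roots : ∀ {h} → Periodic 0ℤ h → ∀ t → ∑ₚ (λ r → h r * roots t r) ≡ h (t * t) + h (g * (t * t))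
      ∑ₚ-*roots {h} periodic t = trans
        (∑-cong-≡ p λ k → ℤ.*-distribˡ-+ (h (+ k)) (δ (+ k - t * t)) (δ (+ k - g * (t * t))))
        (trans (∑-+ p _ _) (cong₂ _+_ (∑ₚ-δ-filter periodic (t * t)) (∑ₚ-δ-filter periodic (g * (t * t)))))

      ∑ₚ-roots : ∀ t → ∑ₚ (roots t) ≡ + 2
      ∑ₚ-roots t = trans (∑-+ p _ _) (cong₂ _+_ (∑ₚδ (t * t)) (∑ₚδ (g * (t * t))))

      roots-roots : ∀ t u → roots u (t * t) + roots u (g * (t * t)) ≡ + 2 * (δ (t - u) + δ (t - - u))
      roots-roots t u = begin
        δ (t * t - u * u) + δ (t * t - g * (u * u)) + (δ (g * (t * t) - u * u) + δ (g * (t * t) - g * (u * u)))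
          ≡⟨ cong₂ (λ a b → δ (t * t - u * u) + δ (t * t - g * (u * u)) + (a + b))
               (δ-⇔ (subst (P ∣_) (eq₁ t u g) ∘ P∣⇒P∣* -1ℤ) (subst (P ∣_) (eq₁′ t u g) ∘ P∣⇒P∣* -1ℤ))
               (δ-⇔ (P∣*⇒P∣ P∤g ∘ subst (P ∣_) (eq₂ t u g)) (subst (P ∣_) (sym (eq₂ t u g)) ∘ P∣⇒P∣* g)) ⟩
        δ (t * t - u * u) + δ (t * t - g * (u * u)) + (δ (u * u - g * (t * t)) + δ (t * t - u * u))
          ≡⟨ cong₂ (λ a b → δ (t * t - u * u) + a + (b + δ (t * t - u * u))) (δ-twisted-squares t u) (δ-twisted-squares u t) ⟩
        δ (t * t - u * u) + δ t * δ u + (δ u * δ t + δ (t * t - u * u))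
          ≡⟨ cong (λ a → a + δ t * δ u + (δ u * δ t + a)) (δ-squares u t) ⟩
        δ (t - u) + δ (t - - u) - δ u * δ t + δ t * δ u + (δ u * δ t + (δ (t - u) + δ (t - - u) - δ u * δ t))
          ≡⟨ eq₃ (δ (t - u)) (δ (t - - u)) (δ t) (δ u) ⟩
        + 2 * (δ (t - u) + δ (t - - u)) ∎
        where
        open ≡-Reasoning
        eq₁ : ∀ t u g → -1ℤ * (g * (t * t) - u * u) ≡ u * u - g * (t * t)
        eq₁ = solve-∀
        eq₁′ : ∀ t u g → -1ℤ * (u * u - g * (t * t)) ≡ g * (t * t) - u * u
        eq₁′ = solve-∀
        eq₂ : ∀ t u g → g * (t * t) - g * (u * u) ≡ g * (t * t - u * u)
        eq₂ = solve-∀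
        eq₃ : ∀ a b c d → a + b - d * c + c * d + (d * c + (a + b - d * c)) ≡ + 2 * (a + b)
        eq₃ = solve-∀

      rootCount : ℤ → ℤ
      rootCount r = ∑ₚ (λ t → roots t r)

      ∑ₚ-rootCount : ∑ₚ rootCount ≡ + 2 * P
      ∑ₚ-rootCount = trans (∑-swap p p (λ k j → roots (+ j) (+ k))) (trans (∑-cong-≡ p λ j → ∑ₚ-roots (+ j))
        (trans (∑-const p (+ 2)) (ℤ.*-comm P (+ 2))))

      ∑ₚ-rootCount² : ∑ₚ (λ r → rootCount r * rootCount r) ≡ + 4 * P
      ∑ₚ-rootCount² = begin
        ∑ₚ (λ r → rootCount r * rootCount r)
          ≡⟨ ∑-cong-≡ p (λ k → ∑ₚ-* (λ u → roots u (+ k)) (λ t → roots t (+ k))) ⟩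
        ∑ₚ (λ r → ∑ₚ (λ u → ∑ₚ (λ t → roots u r * roots t r)))
          ≡⟨ trans (∑-swap p p (λ i j → ∑ₚ (λ t → roots (+ j) (+ i) * roots t (+ i))))
               (∑-cong-≡ p λ j → ∑-swap p p (λ i k → roots (+ j) (+ i) * roots (+ k) (+ i))) ⟩
        ∑ₚ (λ u → ∑ₚ (λ t → ∑ₚ (λ r → roots u r * roots t r)))
          ≡⟨ ∑-cong-≡ p (λ j → ∑-cong-≡ p λ k → trans (∑ₚ-*roots (roots-periodic (+ j)) (+ k)) (roots-roots (+ k) (+ j))) ⟩
        ∑ₚ (λ u → ∑ₚ (λ t → + 2 * (δ (t - u) + δ (t - - u))))
          ≡⟨ ∑-cong-≡ p (λ j → trans (∑-*ˡ p (+ 2) _) (cong (+ 2 *_) (trans (∑-+ p _ _)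
               (cong₂ _+_ (∑ₚδ (+ j)) (∑ₚδ (- (+ j))))))) ⟩
        ∑ₚ (λ u → + 4)
          ≡⟨ trans (∑-const p (+ 4)) (ℤ.*-comm P (+ 4)) ⟩
        + 4 * P ∎
        where open ≡-Reasoning

      -- Shown without extracting square roots: over the p residues the counts have mean 2 and mean
      -- square 4, so their variance is 0 and each count equals the mean.
      rootCount≡2 : ∀ k → k ℕ.< p → rootCount (+ k) ≡ + 2
      rootCount≡2 k k<p = ℤ.i-j≡0⇒i≡j (rootCount (+ k)) (+ 2)
        (∑-squares≡0 p (λ k → rootCount (+ k) - + 2) variance≡0 k k<p)
        where
        open ≡-Reasoning
        eq₁ : ∀ c → (c - + 2) * (c - + 2) ≡ c * c - (+ 4 * c - + 4)
        eq₁ = solve-∀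
        eq₂ : ∀ q → + 4 * q - (+ 4 * (+ 2 * q) - q * + 4) ≡ 0ℤ
        eq₂ = solve-∀
        variance≡0 : ∑ₚ (λ r → (rootCount r - + 2) * (rootCount r - + 2)) ≡ 0ℤ
        variance≡0 = begin
          ∑ₚ (λ r → (rootCount r - + 2) * (rootCount r - + 2))
            ≡⟨ ∑-cong-≡ p (λ k → eq₁ (rootCount (+ k))) ⟩
          ∑ₚ (λ r → rootCount r * rootCount r - (+ 4 * rootCount r - + 4))
            ≡⟨ trans (∑-minus p _ _) (cong₂ _-_ ∑ₚ-rootCount² (trans (∑-minus p _ _)
                 (cong₂ _-_ (trans (∑-*ˡ p (+ 4) _) (cong (+ 4 *_) ∑ₚ-rootCount)) (∑-const p (+ 4))))) ⟩
          + 4 * P - (+ 4 * (+ 2 * P) - P * + 4)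
            ≡⟨ eq₂ P ⟩
          0ℤ ∎

      ∑ₚ-squares : ∀ {h} → Periodic 0ℤ h → ∑ₚ (λ t → h (t * t) + h (g * (t * t))) ≡ + 2 * ∑ₚ h
      ∑ₚ-squares {h} periodic = begin
        ∑ₚ (λ t → h (t * t) + h (g * (t * t)))
          ≡⟨ ∑-cong-≡ p (λ k → sym (∑ₚ-*roots periodic (+ k))) ⟩
        ∑ₚ (λ t → ∑ₚ (λ r → h r * roots t r))
          ≡⟨ ∑-swap p p (λ j k → h (+ k) * roots (+ j) (+ k)) ⟩
        ∑ₚ (λ r → ∑ₚ (λ t → h r * roots t r))
          ≡⟨ ∑-cong-≡-< p (λ k k<p → trans (∑-*ˡ p (h (+ k)) _)
               (trans (cong (h (+ k) *_) (rootCount≡2 k k<p)) (ℤ.*-comm (h (+ k)) (+ 2)))) ⟩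
        ∑ₚ (λ r → + 2 * h r)
          ≡⟨ ∑-*ˡ p (+ 2) _ ⟩
        + 2 * ∑ₚ h ∎
        where open ≡-Reasoning

      -- By `∑ₚ-squares` the pairs t², g t² run through every residue twice, so the second moment
      -- can be summed over t. Each of the p - 1 units t contributes the same norm and t = 0
      -- contributes 0; the total is 2 · 2p (p - 1).
      jacobsthal-norm : jacobsthal 1ℤ * jacobsthal 1ℤ + jacobsthal g * jacobsthal g ≡ + 4 * P
      jacobsthal-norm = ℤ.*-cancelˡ-≡ (+ (m ℕ.+ m)) norm (+ 4 * P) {{ℤ.≢-nonZero (p-1≢0 ∘ ℤ.+-injective)}} (begin
        + (m ℕ.+ m) * norm
          ≡⟨ trans (sym (∑-const (m ℕ.+ m) norm)) (sym (ℤ.+-identityˡ _)) ⟩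
        0ℤ + ∑ (m ℕ.+ m) (λ _ → norm)
          ≡⟨ cong₂ _+_ (sym at-0) (∑-cong-≡-< (m ℕ.+ m) λ k k<p-1 → sym (at-unit (P∤small k (ℕ.s<s k<p-1)))) ⟩
        (square 0ℤ + square (g * 0ℤ)) + ∑ (m ℕ.+ m) (λ k → square (+ suc k * + suc k) + square (g * (+ suc k * + suc k)))
          ≡⟨ sym (∑-suc (m ℕ.+ m) (λ k → square (+ k * + k) + square (g * (+ k * + k)))) ⟩
        ∑ₚ (λ t → square (t * t) + square (g * (t * t)))
          ≡⟨ ∑ₚ-squares (λ e → ≈-reflexive (cong₂ _*_ (jacobsthal-cong e) (jacobsthal-cong e))) ⟩
        + 2 * ∑ₚ square
          ≡⟨ cong (+ 2 *_) ∑ₚ-jacobsthal² ⟩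
        + 2 * (+ 2 * P * (P - 1ℤ))
          ≡⟨ eq₁ P (+ (m ℕ.+ m)) ⟩
        + (m ℕ.+ m) * (+ 4 * P) ∎)
        where
        open ≡-Reasoning
        square : ℤ → ℤ
        square r = jacobsthal r * jacobsthal r
        norm : ℤ
        norm = square 1ℤ + square g
        eq₁ : ∀ P q → + 2 * (+ 2 * P * (1ℤ + q - 1ℤ)) ≡ q * (+ 4 * P)
        eq₁ = solve-∀
        eq₂ : ∀ a b → a * b * (a * b) ≡ a * a * (b * b)
        eq₂ = solve-∀
        at-0 : square 0ℤ + square (g * 0ℤ) ≡ 0ℤ
        at-0 = cong₂ (λ a b → a * a + b * b) (jacobsthal-0 P∣0) (jacobsthal-0 (P∣⇒P∣* g P∣0))
        square-*square : ∀ {t} r → ¬ P ∣ t → square (r * (t * t)) ≡ square r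
        square-*square {t} r P∤t = trans (cong (λ a → a * a) (jacobsthal-*square r P∤t))
          (trans (eq₂ (ψ t) (jacobsthal r)) (trans (cong (_* square r) (ψ*ψ≡1 P∤t)) (ℤ.*-identityˡ (square r))))
        at-unit : ∀ {t} → ¬ P ∣ t → square (t * t) + square (g * (t * t)) ≡ norm
        at-unit {t} P∤t = cong₂ _+_ (trans (cong square (sym (ℤ.*-identityˡ (t * t)))) (square-*square 1ℤ P∤t)) (square-*square g P∤t)

  -- The exact value of J(1)

  ±1-triple-product : ∀ {u v w} → u ≡ 1ℤ ⊎ u ≡ -1ℤ → v ≡ 1ℤ ⊎ v ≡ -1ℤ → w ≡ 1ℤ ⊎ w ≡ -1ℤ →
                      u * (v * w) ≈ u + v + w - + 2 [ + 4 ]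
  -- With each sign written as 1 - 2e, e being 0 or 1, all terms of the product with two or more
  -- factors 2e vanish modulo 4; the cases confirm it.
  ±1-triple-product (inj₁ refl) (inj₁ refl) (inj₁ refl) = mod 0ℤ refl
  ±1-triple-product (inj₁ refl) (inj₁ refl) (inj₂ refl) = mod 0ℤ refl
  ±1-triple-product (inj₁ refl) (inj₂ refl) (inj₁ refl) = mod 0ℤ refl
  ±1-triple-product (inj₁ refl) (inj₂ refl) (inj₂ refl) = mod 1ℤ refl
  ±1-triple-product (inj₂ refl) (inj₁ refl) (inj₁ refl) = mod 0ℤ refl
  ±1-triple-product (inj₂ refl) (inj₁ refl) (inj₂ refl) = mod 1ℤ refl
  ±1-triple-product (inj₂ refl) (inj₂ refl) (inj₁ refl) = mod 1ℤ refl
  ±1-triple-product (inj₂ refl) (inj₂ refl) (inj₂ refl) = mod 1ℤ refl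

  -1^n≡±1 : ∀ n → -1ℤ ^ n ≡ 1ℤ ⊎ -1ℤ ^ n ≡ -1ℤ
  -1^n≡±1 zero    = inj₁ refl
  -1^n≡±1 (suc n) = Sum.[ inj₂ ∘ cong (-1ℤ *_) , inj₁ ∘ cong (-1ℤ *_) ]′ (-1^n≡±1 n)

  ∑-reverse : ∀ k (f : ℤ → ℤ) → ∑ k (λ i → f (+ k - + i)) ≡ ∑ k (λ i → f (+ suc i))
  ∑-reverse zero    f = trans (∑-0 _) (sym (∑-0 _))
  ∑-reverse (suc k) f = begin
    ∑ (suc k) (λ i → f (+ suc k - + i))
      ≡⟨ ∑-suc k _ ⟩
    f (+ suc k - 0ℤ) + ∑ k (λ i → f (+ suc k - + suc i))
      ≡⟨ cong₂ _+_ (cong f (ℤ.+-identityʳ (+ suc k))) (trans (∑-cong-≡ k λ i → cong f (eq (+ k) (+ i))) (∑-reverse k f)) ⟩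
    f (+ suc k) + ∑ k (λ i → f (+ suc i))
      ≡⟨ ℤ.+-comm (f (+ suc k)) (∑ k (λ i → f (+ suc i))) ⟩
    ∑ k (λ i → f (+ suc i)) + f (+ suc k)
      ≡⟨ sym (∑-last k (λ i → f (+ suc i))) ⟩
    ∑ (suc k) (λ i → f (+ suc i)) ∎
    where
    open ≡-Reasoning
    eq : ∀ κ ι → 1ℤ + κ - (1ℤ + ι) ≡ κ - ι
    eq = solve-∀

  u²+w²≡1⇒u≡0∨w≡0 : ∀ u w → u * u + w * w ≡ 1ℤ → u ≡ 0ℤ ⊎ w ≡ 0ℤ
  u²+w²≡1⇒u≡0∨w≡0 (+ zero)  w _ = inj₁ refl
  u²+w²≡1⇒u≡0∨w≡0 (+ suc k) w e = inj₂ (nonzero k w e)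
    where
    nonzero : ∀ k w → + suc k * + suc k + w * w ≡ 1ℤ → w ≡ 0ℤ
    nonzero k w e = i*i≡0⇒i≡0 w (0≤i,j∧i+j≡0⇒i≡0 (w * w) (+ (k ℕ.* suc (suc k))) (0≤i*i w) (ℤ.+≤+ ℕ.z≤n)
      (trans (cong (_+_ (w * w)) (ℤ.pos-* k (suc (suc k)))) (trans (eq (+ k) w) (cong (_- 1ℤ) e))))
      where
      eq : ∀ κ w → w * w + κ * (1ℤ + (1ℤ + κ)) ≡ (1ℤ + κ) * (1ℤ + κ) + w * w - 1ℤ
      eq = solve-∀
  u²+w²≡1⇒u≡0∨w≡0 -[1+ k ]  w e with u²+w²≡1⇒u≡0∨w≡0 (+ suc k) w e
  ... | inj₂ w≡0 = inj₂ w≡0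

  i*i≡j*j⇒i≡±j : ∀ i j → i * i ≡ j * j → i ≡ j ⊎ i ≡ - j
  i*i≡j*j⇒i≡±j i j e = Sum.map (ℤ.i-j≡0⇒i≡j i j) (ℤ.i-j≡0⇒i≡j i (- j))
    (ℤ.i*j≡0⇒i≡0∨j≡0 (i - j) (trans (eq i j) (trans (cong (_- j * j) e) (ℤ.+-inverseʳ (j * j)))))
    where
    eq : ∀ i j → (i - j) * (i - - j) ≡ i * i - j * j
    eq = solve-∀

  module JacobsthalEvaluation (n : ℕ) (prime : Prime (suc ((n ℕ.+ n) ℕ.+ (n ℕ.+ n)))) where

    private
      m = n ℕ.+ n
      p = suc (m ℕ.+ m)

    open PrimeModulus (m ℕ.+ m) prime
    open ResidueSums (m ℕ.+ m) prime
    open LegendreSymbol n prime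
    open JacobsthalSums n prime
    open JacobsthalNorm n prime

    0<m : 0 ℕ.< m
    0<m = ℕ.≤-trans 0<n (ℕ.m≤m+n n n)

    -- Modulo p = 2m + 1 the residues m + 1, ..., 2m are the negatives of m, ..., 1.
    ∑ₚ-even : ∀ {f} → Periodic 0ℤ f → (∀ x → f (- x) ≡ f x) → f 0ℤ ≡ 0ℤ →
              ∑ₚ f ≡ + 2 * ∑ m (λ i → f (+ suc i))
    ∑ₚ-even {f} periodic even f0≡0 = begin
      ∑ₚ f
        ≡⟨ trans (∑-suc (m ℕ.+ m) (f ∘ +_)) (cong₂ _+_ f0≡0 (∑-split m m (λ i → f (+ suc i)))) ⟩
      0ℤ + (∑ m (λ i → f (+ suc i)) + ∑ m (λ i → f (+ suc (m ℕ.+ i))))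
        ≡⟨ cong (λ u → 0ℤ + (∑ m (λ i → f (+ suc i)) + u)) (trans (∑-cong-≡ m reflect) (∑-reverse m f)) ⟩
      0ℤ + (∑ m (λ i → f (+ suc i)) + ∑ m (λ i → f (+ suc i)))
        ≡⟨ eq (∑ m (λ i → f (+ suc i))) ⟩
      + 2 * ∑ m (λ i → f (+ suc i)) ∎
      where
      open ≡-Reasoning
      eq : ∀ a → 0ℤ + (a + a) ≡ + 2 * a
      eq = solve-∀
      eq₁ : ∀ μ ι → - (1ℤ + (μ + ι)) - (μ - ι) ≡ -1ℤ * (1ℤ + (μ + μ))
      eq₁ = solve-∀
      reflect : ∀ i → f (+ suc (m ℕ.+ i)) ≡ f (+ m - + i)
      reflect i = trans (sym (even (+ suc (m ℕ.+ i))))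
        (≡-periodic {h = f} periodic (mod -1ℤ (eq₁ (+ m) (+ i))))

    -- J itself is even, so the sign is read off from its half: at r = 1 this half is odd, and its
    -- class modulo 4 distinguishes it from its negative.
    halfJacobsthal : ℤ → ℤ
    halfJacobsthal r = ∑ m (λ i → ψ (+ suc i) * ψ (+ suc i * + suc i - r))

    jacobsthal≡2*half : ∀ r → jacobsthal r ≡ + 2 * halfJacobsthal r
    jacobsthal≡2*half r = ∑ₚ-even {f = λ x → ψ x * ψ (x * x - r)}
      (λ e → *-cong (ψ-periodic e) (ψ-periodic (minus-cong (*-cong e e) (≈-refl {x = r}))))
      (λ x → cong₂ _*_ (ψ-neg x) (cong (λ s → ψ (s - r)) (eq x)))
      (trans (cong (_* ψ (0ℤ - r)) (ψ-∣ P∣0)) (ℤ.*-zeroˡ (ψ (0ℤ - r))))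
      where
      eq : ∀ x → (- x) * (- x) ≡ x * x
      eq = solve-∀

    ∑-halfψ : ∑ m (λ i → ψ (+ suc i)) ≡ 0ℤ
    ∑-halfψ = ℤ.*-cancelˡ-≡ (+ 2) (∑ m (λ i → ψ (+ suc i))) 0ℤ
      (trans (sym (∑ₚ-even ψ-periodic ψ-neg (ψ-∣ P∣0))) ∑ₚψ≡0)

    -- x² - 1 = (x - 1) (x + 1), and a product of three signs is congruent mod 4
    -- to their sum minus 2, so the sum collapses to linear sums of ψ.
    halfJacobsthal-1 : halfJacobsthal 1ℤ ≈ - ψ (+ 2) [ + 4 ]
    halfJacobsthal-1 = go (ℕ.pred m) (sym (ℕ.suc-pred m {{ℕ.>-nonZero 0<m}}))
      where
      term : ℕ → ℤ
      term i = ψ (+ suc i) * ψ (+ suc i * + suc i - 1ℤ)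

      go : ∀ k → m ≡ suc k → halfJacobsthal 1ℤ ≈ - ψ (+ 2) [ + 4 ]
      go k m≡1+k = begin
        ∑ m term
          ≡⟨ cong (λ j → ∑ j term) m≡1+k ⟩
        ∑ (suc k) term
          ≡⟨ ∑-suc k term ⟩
        ψ 1ℤ * ψ 0ℤ + ∑ k (λ i → term (suc i))
          ≈⟨ +-cong {x = ψ 1ℤ * ψ 0ℤ} (≈-reflexive (trans (cong (ψ 1ℤ *_) (ψ-∣ P∣0)) (ℤ.*-zeroʳ (ψ 1ℤ)))) (∑-cong-< k term≈) ⟩
        0ℤ + ∑ k (λ i → ψ (+ suc i) + ψ (+ suc (suc i)) + ψ (+ suc (suc (suc i))) - + 2)
          ≡⟨ cong (_+_ 0ℤ) (trans (∑-minus k _ _) (cong₂ _-_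
               (trans (∑-+ k _ _) (cong (_+ ∑₃) (∑-+ k _ _))) (∑-const k (+ 2)))) ⟩
        0ℤ + (∑₁ + ∑₂ + ∑₃ - + k * + 2)
          -- With k + 1 = m = 2n the three shifted sums leave -ψ(m) - 2 + ψ(m + 1) - ψ(2) - 2k. Here
          -- ψ(m) and ψ(m + 1) cancel, and -2 - 2k = -4n accounts for the quotient -n.
          ≈⟨ mod (- (+ n)) (trans
               (eq ∑₁ ∑₂ ∑₃ (+ k) (ψ (+ 2)) (+ n) (ψ 1ℤ) (ψ (+ suc k)) (ψ (+ suc (suc k))))
               (cancel ∑₁+last first+∑₂ first+∑₃ 2n≡1+k ψ-symmetric ψ-1)) ⟩
        - ψ (+ 2) ∎
        where
        open ≈-Reasoning (+ 4)
        ∑₁ = ∑ k (λ i → ψ (+ suc i))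
        ∑₂ = ∑ k (λ i → ψ (+ suc (suc i)))
        ∑₃ = ∑ k (λ i → ψ (+ suc (suc (suc i))))

        ∑₁+last : ∑₁ + ψ (+ suc k) ≡ 0ℤ
        ∑₁+last = trans (sym (∑-last k _)) (trans (cong (λ j → ∑ j (λ i → ψ (+ suc i))) (sym m≡1+k)) ∑-halfψ)
        first+∑₂ : ψ 1ℤ + ∑₂ ≡ 0ℤ
        first+∑₂ = trans (sym (∑-suc k (λ i → ψ (+ suc i)))) (trans (cong (λ j → ∑ j (λ i → ψ (+ suc i))) (sym m≡1+k)) ∑-halfψ)
        first+∑₃ : ψ (+ 2) + ∑₃ ≡ ∑₂ + ψ (+ suc (suc k))
        first+∑₃ = trans (sym (∑-suc k (λ i → ψ (+ suc (suc i))))) (∑-last k (λ i → ψ (+ suc (suc i))))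
        2n≡1+k : + n + + n ≡ 1ℤ + + k
        2n≡1+k = cong +_ m≡1+k
        -- m + 1 ≡ -m modulo p = 2m + 1, and ψ is even.
        ψ-symmetric : ψ (+ suc (suc k)) ≡ ψ (+ suc k)
        ψ-symmetric = trans (ψ-cong (≈-trans
          (≈-reflexive (cong (λ j → + suc j) (sym m≡1+k)))
          (≈-trans (mod 1ℤ (eq₀ (+ m))) (≈-reflexive (cong (λ j → - (+ j)) m≡1+k))))) (ψ-neg (+ suc k))
          where
          eq₀ : ∀ μ → (1ℤ + μ) - (- μ) ≡ 1ℤ * (1ℤ + (μ + μ))
          eq₀ = solve-∀

        eq : ∀ a b c κ t ν o u v →
          0ℤ + (a + b + c - κ * + 2) - (- t) ≡
          (- ν) * + 4 + ((a + u) + + 2 * (o + b) + (t + c - (b + v)) + + 2 * (ν + ν - (1ℤ + κ)) + (v - u) - + 2 * (o - 1ℤ))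
        eq = solve-∀
        cancel : ∀ {a b c d e f g h i j z} → a ≡ 0ℤ → b ≡ 0ℤ → c ≡ d → e ≡ f → g ≡ h → i ≡ j →
          z + (a + + 2 * b + (c - d) + + 2 * (e - f) + (g - h) - + 2 * (i - j)) ≡ z
        cancel {d = d} {f = f} {h = h} {j = j} {z = z} refl refl refl refl refl refl = eq′ d f h j z
          where
          eq′ : ∀ d f h j z → z + (0ℤ + + 2 * 0ℤ + (d - d) + + 2 * (f - f) + (h - h) - + 2 * (j - j)) ≡ z
          eq′ = solve-∀

        term≈ : ∀ i → i ℕ.< k →
          term (suc i) ≈ ψ (+ suc i) + ψ (+ suc (suc i)) + ψ (+ suc (suc (suc i))) - + 2 [ + 4 ]
        term≈ i i<k = ≈-trans
          (≈-reflexive (trans (cong (ψ (+ suc (suc i)) *_) (trans (cong ψ (eq₁ (+ i))) (ψ-* (+ suc i) (+ suc (suc (suc i))))))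
            (eq₂ (ψ (+ suc i)) (ψ (+ suc (suc i))) (ψ (+ suc (suc (suc i)))))))
          (±1-triple-product (ψ-∤ (P∤small i (ℕ.<-trans (ℕ.n<1+n _) (ℕ.<-trans (ℕ.n<1+n _) 3+i<p))))
            (ψ-∤ (P∤small (suc i) (ℕ.<-trans (ℕ.n<1+n _) 3+i<p))) (ψ-∤ (P∤small (suc (suc i)) 3+i<p)))
          where
          3+i<p : suc (suc (suc i)) ℕ.< p
          3+i<p = ℕ.s<s (ℕ.<-≤-trans (ℕ.s<s (subst (suc i ℕ.<_) (sym m≡1+k) (ℕ.s<s i<k))) (ℕ.+-monoˡ-≤ m 0<m))
          eq₁ : ∀ ι → (1ℤ + (1ℤ + ι)) * (1ℤ + (1ℤ + ι)) - 1ℤ ≡ (1ℤ + ι) * (1ℤ + (1ℤ + (1ℤ + ι)))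
          eq₁ = solve-∀
          eq₂ : ∀ a b c → b * (a * c) ≡ a * (b * c)
          eq₂ = solve-∀

    P≈1[4] : P ≈ 1ℤ [ + 4 ]
    P≈1[4] = mod (+ n) (eq (+ n))
      where
      eq : ∀ ν → 1ℤ + (ν + ν + (ν + ν)) - 1ℤ ≡ ν * + 4
      eq = solve-∀

    module _ {a b : ℤ} (P≡a²+b² : P ≡ a * a + b * b) where

      a²≈-b² : a * a ≈ - (b * b) [ P ]
      a²≈-b² = mod 1ℤ (trans (eq (a * a) (b * b)) (trans (sym P≡a²+b²) (sym (ℤ.*-identityˡ P))))
        where
        eq : ∀ a b → a - (- b) ≡ a + b
        eq = solve-∀

      P∤b : ¬ P ∣ b
      P∤b P∣b =
        let divides u a≡uP = P∣a
            divides v b≡vP = P∣b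
        in P∤1 (divides (u * u + v * v) (ℤ.*-cancelʳ-≡ 1ℤ ((u * u + v * v) * P) P
             (trans (ℤ.*-identityˡ P) (trans P≡a²+b² (trans (cong₂ (λ a b → a * a + b * b) a≡uP b≡vP) (eq u v P))))))
        where
        P∣a : P ∣ a
        P∣a = P∣x*x⇒P∣x (≈0⇒∣ (≈-trans a²≈-b² (neg-cong (∣⇒≈0 (P∣⇒P∣* b P∣b)))))
        eq : ∀ u v q → u * q * (u * q) + v * q * (v * q) ≡ (u * u + v * v) * q * q
        eq = solve-∀

      -- Since a² ≡ -b², the power (ab)^m = (a² b²)^n is (-1)^n b^(4n), and 4n = p - 1.
      ψ-ab : ψ (a * b) ≡ -1ℤ ^ n
      ψ-ab = ψ-unique (a * b) (ternary-sign (-1^n≡±1 n)) (begin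
        (a * b) ^ m                          ≡⟨ ℤ.^-distribˡ-+-* (a * b) n n ⟩
        (a * b) ^ n * (a * b) ^ n            ≡⟨ sym (^-distrib-* (a * b) (a * b) n) ⟩
        (a * b * (a * b)) ^ n                ≈⟨ ^-cong n (≈-linear (b * b) (eq₁ a b) a²≈-b²) ⟩
        (-1ℤ * (b * b * (b * b))) ^ n        ≡⟨ trans (^-distrib-* -1ℤ (b * b * (b * b)) n) (cong (-1ℤ ^ n *_) (b⁴ⁿ b)) ⟩
        -1ℤ ^ n * b ^ (m ℕ.+ m)              ≈⟨ *-congˡ (-1ℤ ^ n) (x^[p-1]≈1 P∤b) ⟩
        -1ℤ ^ n * 1ℤ                         ≡⟨ ℤ.*-identityʳ (-1ℤ ^ n) ⟩
        -1ℤ ^ n ∎)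
        where
        open ≈-Reasoning P
        eq₁ : ∀ a b → a * b * (a * b) - -1ℤ * (b * b * (b * b)) ≡ b * b * (a * a - (- (b * b)))
        eq₁ = solve-∀
        square^ : ∀ x k → (x * x) ^ k ≡ x ^ (k ℕ.+ k)
        square^ x k = trans (^-distrib-* x x k) (sym (ℤ.^-distribˡ-+-* x k k))
        b⁴ⁿ : ∀ b → (b * b * (b * b)) ^ n ≡ b ^ (m ℕ.+ m)
        b⁴ⁿ b = trans (square^ (b * b) n) (square^ b m)
        ternary-sign : ∀ {u} → u ≡ 1ℤ ⊎ u ≡ -1ℤ → Ternary u
        ternary-sign (inj₁ refl) = one
        ternary-sign (inj₂ refl) = minus

      -- (a + b)² ≡ 2 a b, so 2 and a b have the same character.
      ψ-2 : ψ (+ 2) ≡ -1ℤ ^ n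
      ψ-2 = begin
        ψ (+ 2)                               ≡⟨ sym (ℤ.*-identityʳ (ψ (+ 2))) ⟩
        ψ (+ 2) * 1ℤ                          ≡⟨ cong (ψ (+ 2) *_) (sym (-1^n*-1^n≡1 n)) ⟩
        ψ (+ 2) * (-1ℤ ^ n * -1ℤ ^ n)         ≡⟨ cong (λ s → ψ (+ 2) * (s * -1ℤ ^ n)) (sym ψ-ab) ⟩
        ψ (+ 2) * (ψ (a * b) * -1ℤ ^ n)       ≡⟨ sym (ℤ.*-assoc (ψ (+ 2)) (ψ (a * b)) (-1ℤ ^ n)) ⟩
        ψ (+ 2) * ψ (a * b) * -1ℤ ^ n         ≡⟨ cong (_* -1ℤ ^ n) (trans (sym (ψ-* (+ 2) (a * b))) ψ-2ab) ⟩
        1ℤ * -1ℤ ^ n                          ≡⟨ ℤ.*-identityˡ (-1ℤ ^ n) ⟩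
        -1ℤ ^ n ∎
        where
        open ≡-Reasoning
        eq₁ : ∀ a b → + 2 * (a * b) - (a + b) * (a + b) ≡ -1ℤ * (a * a - (- (b * b)))
        eq₁ = solve-∀
        2ab≈[a+b]² : + 2 * (a * b) ≈ (a + b) * (a + b) [ P ]
        2ab≈[a+b]² = ≈-linear -1ℤ (eq₁ a b) a²≈-b²
        P∤a : ¬ P ∣ a
        P∤a P∣a = P∤b (P∣x*x⇒P∣x (≈0⇒∣ (≈-linear₂ 1ℤ (- a) (eq₂ a b) a²≈-b² (∣⇒≈0 P∣a))))
          where
          eq₂ : ∀ a b → b * b - 0ℤ ≡ 1ℤ * (a * a - (- (b * b))) + (- a) * (a - 0ℤ)
          eq₂ = solve-∀
        P∤a+b : ¬ P ∣ a + b
        P∤a+b d = P∤-resp-≈ 2ab≈[a+b]² (P∤* P∤2 (P∤* P∤a P∤b)) (P∣⇒P∣* (a + b) d)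
        ψ-2ab : ψ (+ 2 * (a * b)) ≡ 1ℤ
        ψ-2ab = trans (ψ-cong 2ab≈[a+b]²) (trans (ψ-* (a + b) (a + b)) (ψ*ψ≡1 P∤a+b))

      private
        ε = -1ℤ ^ n

      module _ {A B : ℤ} (P≡A²+B² : P ≡ A * A + B * B) where

        -- The two-square identity (Ab - aB)² + (Aa + Bb)² = P² forces one of the
        -- two squares to vanish.
        P∣Ab-aB⇒ : P ∣ A * b - a * B → A * A ≡ a * a ⊎ A * A + a * a ≡ P
        P∣Ab-aB⇒ (divides u X≡uP) =
          let divides w Z≡wP = P∣Z
          in Sum.map (X≡0⇒ ∘ vanish X≡uP) (Z≡0⇒ ∘ vanish Z≡wP)
               (u²+w²≡1⇒u≡0∨w≡0 u w (ℤ.*-cancelʳ-≡ (u * u + w * w) 1ℤ (P * P) (u²+w²P² w Z≡wP)))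
          where
          open ≡-Reasoning
          X Z : ℤ
          X = A * b - a * B
          Z = A * a + B * b
          X²+Z²≡P² : X * X + Z * Z ≡ P * P
          X²+Z²≡P² = trans (eq A B a b) (cong₂ _*_ (sym P≡A²+B²) (sym P≡a²+b²))
            where
            eq : ∀ A B a b → (A * b - a * B) * (A * b - a * B) + (A * a + B * b) * (A * a + B * b) ≡
                             (A * A + B * B) * (a * a + b * b)
            eq = solve-∀
          P∣Z : P ∣ Z
          P∣Z = P∣x*x⇒P∣x (divides (P - u * u * P) (begin
            Z * Z                            ≡⟨ eq₁ (X * X) (Z * Z) ⟩
            X * X + Z * Z - X * X            ≡⟨ cong₂ (λ s t → s - t * t) X²+Z²≡P² X≡uP ⟩
            P * P - u * P * (u * P)          ≡⟨ eq₂ P u ⟩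
            (P - u * u * P) * P ∎))
            where
            eq₁ : ∀ s t → t ≡ s + t - s
            eq₁ = solve-∀
            eq₂ : ∀ P u → P * P - u * P * (u * P) ≡ (P - u * u * P) * P
            eq₂ = solve-∀
          u²+w²P² : ∀ w → Z ≡ w * P → (u * u + w * w) * (P * P) ≡ 1ℤ * (P * P)
          u²+w²P² w Z≡wP = trans (eq u w P) (trans (cong₂ (λ s t → s * s + t * t) (sym X≡uP) (sym Z≡wP))
            (trans X²+Z²≡P² (sym (ℤ.*-identityˡ (P * P)))))
            where
            eq : ∀ u w P → (u * u + w * w) * (P * P) ≡ u * P * (u * P) + w * P * (w * P)
            eq = solve-∀
          vanish : ∀ {x q} → x ≡ q * P → q ≡ 0ℤ → x ≡ 0ℤ
          vanish x≡qP refl = x≡qP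
          X≡0⇒ : X ≡ 0ℤ → A * A ≡ a * a
          X≡0⇒ X≡0 = ℤ.*-cancelˡ-≡ P (A * A) (a * a) (begin
            P * (A * A)                                   ≡⟨ cong (_* (A * A)) P≡a²+b² ⟩
            (a * a + b * b) * (A * A)                     ≡⟨ eq A B a b ⟩
            (A * A + B * B) * (a * a) + X * (A * b + a * B)
              ≡⟨ cong₂ (λ s t → s * (a * a) + t * (A * b + a * B)) (sym P≡A²+B²) X≡0 ⟩
            P * (a * a) + 0ℤ * (A * b + a * B)            ≡⟨ ℤ.+-identityʳ (P * (a * a)) ⟩
            P * (a * a) ∎)
            where
            eq : ∀ A B a b → (a * a + b * b) * (A * A) ≡
                             (A * A + B * B) * (a * a) + (A * b - a * B) * (A * b + a * B)
            eq = solve-∀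
          Z≡0⇒ : Z ≡ 0ℤ → A * A + a * a ≡ P
          Z≡0⇒ Z≡0 = ℤ.*-cancelˡ-≡ P (A * A + a * a) P (begin
            P * (A * A + a * a)                           ≡⟨ ℤ.*-distribˡ-+ P (A * A) (a * a) ⟩
            P * (A * A) + P * (a * a)
              ≡⟨ cong₂ (λ s t → s * (A * A) + t * (a * a)) P≡a²+b² P≡A²+B² ⟩
            (a * a + b * b) * (A * A) + (A * A + B * B) * (a * a)
              ≡⟨ eq A B a b ⟩
            (A * A + B * B) * (a * a + b * b) + Z * (A * a - B * b)
              ≡⟨ cong₂ (λ s t → s + t * (A * a - B * b)) (cong₂ _*_ (sym P≡A²+B²) (sym P≡a²+b²)) Z≡0 ⟩
            P * P + 0ℤ * (A * a - B * b)                  ≡⟨ ℤ.+-identityʳ (P * P) ⟩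
            P * P ∎)
            where
            eq : ∀ A B a b → (a * a + b * b) * (A * A) + (A * A + B * B) * (a * a) ≡
                             (A * A + B * B) * (a * a + b * b) + (A * a + B * b) * (A * a - B * b)
            eq = solve-∀

      module _ (a≈1 : a ≈ 1ℤ [ + 4 ]) where

        -- Excludes the representation with its two squares exchanged: A and a are both odd, so A² +
        -- a² ≡ 2 modulo 4, while p ≡ 1.
        odd-squares-sum : ∀ {A} → A ≈ - ε [ + 4 ] → ¬ A * A + a * a ≡ P
        odd-squares-sum {A} A≈-ε A²+a²≡P = contradiction (∣⇒∣ᵤ (≈⇒∣ 2≈1)) λ 4∣1 → contradiction (ℕ.∣1⇒≡1 4∣1) λ ()
          where
          open ≈-Reasoning (+ 4)
          eq : ∀ ε → (- ε) * (- ε) ≡ ε * ε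
          eq = solve-∀
          2≈1 : + 2 ≈ 1ℤ [ + 4 ]
          2≈1 = begin
            1ℤ + 1ℤ              ≡⟨ cong (_+ 1ℤ) (sym (trans (eq ε) (-1^n*-1^n≡1 n))) ⟩
            (- ε) * (- ε) + 1ℤ * 1ℤ
              ≈⟨ +-cong {x = (- ε) * (- ε)} (*-cong (≈-sym A≈-ε) (≈-sym A≈-ε)) (*-cong (≈-sym a≈1) (≈-sym a≈1)) ⟩
            A * A + a * a        ≡⟨ A²+a²≡P ⟩
            P                    ≈⟨ P≈1[4] ⟩
            1ℤ ∎

        private
          1≉-1 : ¬ 1ℤ ≈ -1ℤ [ + 4 ]
          1≉-1 e = contradiction (ℕ.∣⇒≤ (∣⇒∣ᵤ (≈⇒∣ e))) λ { (ℕ.s≤s (ℕ.s≤s ())) }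

        sign-normalised : ∀ {A} → A ≈ - ε [ + 4 ] → A * A ≡ a * a → A ≡ - (ε * a)
        sign-normalised {A} A≈-ε A²≡a² = cases (-1^n≡±1 n) (i*i≡j*j⇒i≡±j A a A²≡a²)
          where
          cases : ε ≡ 1ℤ ⊎ ε ≡ -1ℤ → A ≡ a ⊎ A ≡ - a → A ≡ - (ε * a)
          cases (inj₁ ε≡1)  (inj₂ A≡-a) = trans A≡-a (cong -_ (sym (trans (cong (_* a) ε≡1) (ℤ.*-identityˡ a))))
          cases (inj₂ ε≡-1) (inj₁ A≡a)  = trans A≡a (sym (trans (cong (λ s → - (s * a)) ε≡-1) (eq a)))
            where
            eq : ∀ a → - (-1ℤ * a) ≡ a
            eq = solve-∀
          cases (inj₁ ε≡1)  (inj₁ A≡a)  = contradiction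
            (≈-trans (≈-sym a≈1) (≈-trans (≈-reflexive (sym A≡a)) (≈-trans A≈-ε (≈-reflexive (cong -_ ε≡1))))) 1≉-1
          cases (inj₂ ε≡-1) (inj₂ A≡-a) = contradiction
            (≈-trans (≈-sym (≈-trans A≈-ε (≈-reflexive (cong -_ ε≡-1)))) (≈-trans (≈-reflexive A≡-a) (neg-cong a≈1))) 1≉-1

        -- Uniqueness of the sum of two squares: (Ab - aB)(Ab + aB) = (A² - a²) p, so p divides a
        -- factor, and `P∣Ab-aB⇒` applies with B or with -B. It gives A² = a²; the residues of A and
        -- a modulo 4 then fix the sign.
        halfJacobsthal-1≡ : halfJacobsthal 1ℤ ≡ - (ε * a)
        halfJacobsthal-1≡ = sign-normalised A≈-ε (Sum.[ plus , minus′ ]′ (P∣*⇒P∣⊎P∣ (divides (A * A - a * a) product)))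
          where
          open ≡-Reasoning
          g = proj₁ nonresidue
          A B : ℤ
          A = halfJacobsthal 1ℤ
          B = halfJacobsthal g
          A≈-ε : A ≈ - ε [ + 4 ]
          A≈-ε = ≈-trans halfJacobsthal-1 (≈-reflexive (cong -_ ψ-2))
          P≡A²+B² : P ≡ A * A + B * B
          P≡A²+B² = ℤ.*-cancelˡ-≡ (+ 4) P (A * A + B * B) (begin
            + 4 * P                                        ≡⟨ sym (jacobsthal-norm g (proj₂ nonresidue)) ⟩
            jacobsthal 1ℤ * jacobsthal 1ℤ + jacobsthal g * jacobsthal g
              ≡⟨ cong₂ (λ s t → s * s + t * t) (jacobsthal≡2*half 1ℤ) (jacobsthal≡2*half g) ⟩
            + 2 * A * (+ 2 * A) + + 2 * B * (+ 2 * B)      ≡⟨ eq A B ⟩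
            + 4 * (A * A + B * B) ∎)
            where
            eq : ∀ A B → + 2 * A * (+ 2 * A) + + 2 * B * (+ 2 * B) ≡ + 4 * (A * A + B * B)
            eq = solve-∀
          P≡A²+[-B]² : P ≡ A * A + (- B) * (- B)
          P≡A²+[-B]² = trans P≡A²+B² (cong (_+_ (A * A)) (eq B))
            where
            eq : ∀ B → B * B ≡ (- B) * (- B)
            eq = solve-∀
          product : (A * b - a * B) * (A * b - a * - B) ≡ (A * A - a * a) * P
          product = begin
            (A * b - a * B) * (A * b - a * - B)            ≡⟨ eq A B a b ⟩
            A * A * (a * a + b * b) - a * a * (A * A + B * B)
              ≡⟨ cong₂ (λ s t → A * A * s - a * a * t) (sym P≡a²+b²) (sym P≡A²+B²) ⟩
            A * A * P - a * a * P                          ≡⟨ eq₂ (A * A) (a * a) P ⟩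
            (A * A - a * a) * P ∎
            where
            eq : ∀ A B a b → (A * b - a * B) * (A * b - a * - B) ≡
                             A * A * (a * a + b * b) - a * a * (A * A + B * B)
            eq = solve-∀
            eq₂ : ∀ s t P → s * P - t * P ≡ (s - t) * P
            eq₂ = solve-∀
          resolve : A * A ≡ a * a ⊎ A * A + a * a ≡ P → A * A ≡ a * a
          resolve (inj₁ e) = e
          resolve (inj₂ e) = contradiction e (odd-squares-sum A≈-ε)
          plus : P ∣ A * b - a * B → A * A ≡ a * a
          plus d = resolve (P∣Ab-aB⇒ {A} {B} P≡A²+B² d)
          minus′ : P ∣ A * b - a * - B → A * A ≡ a * a
          minus′ d = resolve (P∣Ab-aB⇒ {A} { - B} P≡A²+[-B]² d)

        jacobsthal-1≡ : jacobsthal 1ℤ ≡ - (+ 2 * (ε * a))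
        jacobsthal-1≡ = trans (jacobsthal≡2*half 1ℤ) (trans (cong (+ 2 *_) halfJacobsthal-1≡) (eq (ε * a)))
          where
          eq : ∀ x → + 2 * (- x) ≡ - (+ 2 * x)
          eq = solve-∀

  -- Jacobsthal sums as binomial coefficients modulo p²

  binom-sym : ∀ j k → binom (j ℕ.+ k) j ≡ binom (j ℕ.+ k) k
  binom-sym j k = trans (binom≡C (j ℕ.+ k) j) (trans (cong +_ (trans (nCk≡nC[n∸k] (ℕ.m≤m+n j k))
    (cong ((j ℕ.+ k) C_) (ℕ.m+n∸m≡n j k)))) (sym (binom≡C (j ℕ.+ k) k)))

  module JacobsthalExpansion (n : ℕ) (prime : Prime (suc ((n ℕ.+ n) ℕ.+ (n ℕ.+ n)))) where

    private
      m = n ℕ.+ n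
      3m = m ℕ.+ (m ℕ.+ m)
      p = suc (m ℕ.+ m)

    open PrimeModulus (m ℕ.+ m) prime
    open ResidueSums (m ℕ.+ m) prime
    open LegendreSymbol n prime
    open JacobsthalSums n prime

    private
      0<m : 0 ℕ.< m
      0<m = ℕ.≤-trans 0<n (ℕ.m≤m+n n n)

      nonmultiple : ∀ s q {r} → 0 ℕ.< s → s ℕ.< m ℕ.+ m → r ≡ s ℕ.+ q ℕ.* (m ℕ.+ m) → teichmüllerSum r ≈ 0ℤ [ P² ]
      nonmultiple (suc s) q _ s<p-1 refl = teichmüllerSum-nonmultiple s q s<p-1

    -- The exponent is that of X^m (X²)^k. It is a multiple of p - 1 = 2m exactly when k ≡ n (mod
    -- m), so only these k survive modulo p².
    τ : ℕ → ℤ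
    τ k = teichmüllerSum (m ℕ.+ (k ℕ.+ k))

    τ-main : ∀ j → τ (j ℕ.* m ℕ.+ n) ≈ + (m ℕ.+ m) [ P² ]
    τ-main j = ≈-trans (≈-reflexive (cong teichmüllerSum (eq j n))) (teichmüllerSum-multiple j)
      where
      eq : ∀ j n → (n ℕ.+ n) ℕ.+ ((j ℕ.* (n ℕ.+ n) ℕ.+ n) ℕ.+ (j ℕ.* (n ℕ.+ n) ℕ.+ n)) ≡
                   (n ℕ.+ n ℕ.+ (n ℕ.+ n)) ℕ.+ j ℕ.* (n ℕ.+ n ℕ.+ (n ℕ.+ n))
      eq = ℕSolver.solve-∀

    τ-zero : ∀ j i → i ℕ.< m → ¬ i ≡ n → τ (j ℕ.* m ℕ.+ i) ≈ 0ℤ [ P² ]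
    τ-zero j i i<m i≢n with ℕ.<-cmp i n
    ... | tri≈ _ i≡n _ = contradiction i≡n i≢n
    ... | tri< i<n _ _ = nonmultiple (m ℕ.+ (i ℕ.+ i)) j (ℕ.≤-trans 0<m (ℕ.m≤m+n m (i ℕ.+ i)))
      (ℕ.+-monoʳ-< m (ℕ.+-mono-< i<n i<n)) (eq j m i)
      where
      eq : ∀ j m i → m ℕ.+ ((j ℕ.* m ℕ.+ i) ℕ.+ (j ℕ.* m ℕ.+ i)) ≡ (m ℕ.+ (i ℕ.+ i)) ℕ.+ j ℕ.* (m ℕ.+ m)
      eq = ℕSolver.solve-∀
    ... | tri> _ _ n<i = above (i ℕ.∸ suc n) (sym (ℕ.m+[n∸m]≡n n<i))
      where
      eq : ∀ j n d → (n ℕ.+ n) ℕ.+ ((j ℕ.* (n ℕ.+ n) ℕ.+ suc (n ℕ.+ d)) ℕ.+ (j ℕ.* (n ℕ.+ n) ℕ.+ suc (n ℕ.+ d))) ≡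
                     (suc d ℕ.+ suc d) ℕ.+ ((n ℕ.+ n ℕ.+ (n ℕ.+ n)) ℕ.+ j ℕ.* (n ℕ.+ n ℕ.+ (n ℕ.+ n)))
      eq = ℕSolver.solve-∀
      above : ∀ d → i ≡ suc n ℕ.+ d → τ (j ℕ.* m ℕ.+ i) ≈ 0ℤ [ P² ]
      above d refl = nonmultiple (suc d ℕ.+ suc d) (suc j) ℕ.z<s
        (ℕ.<-≤-trans (ℕ.+-mono-< d<n d<n) (ℕ.m≤m+n m m)) (eq j n d)
        where
        d<n : suc d ℕ.< n
        d<n = ℕ.+-cancelˡ-< n (suc d) n (subst (ℕ._< m) (sym (ℕ.+-suc n d)) i<m)

    -- Among m consecutive indices exactly one survives. The offset function `o` admits the indices
    -- i, m + i and m + (m + i) in the shape in which `∑-split` produces them.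
    block : ∀ (c : ℕ → ℤ) j (o : ℕ → ℕ) → (∀ i → o i ≡ j ℕ.* m ℕ.+ i) →
            ∑ m (λ i → c (o i) * τ (o i)) ≈ c (o n) * + (m ℕ.+ m) [ P² ]
    block c j o o≡ = ≈-trans
      (∑-single m n (ℕ.m<m+n n 0<n) λ i i<m i≢n → ≈-trans
        (*-congˡ (c (o i)) (≈-trans (≈-reflexive (cong τ (o≡ i))) (τ-zero j i i<m i≢n)))
        (≈-reflexive (ℤ.*-zeroʳ (c (o i)))))
      (*-congˡ (c (o n)) (≈-trans (≈-reflexive (cong τ (o≡ n))) (τ-main j)))

    boundary : ∀ (c : ℕ → ℤ) j k → k ≡ j ℕ.* m ℕ.+ 0 → c k * τ k ≈ 0ℤ [ P² ]
    boundary c j k refl = ≈-trans (*-congˡ (c k) (τ-zero j 0 0<m λ 0≡n → contradiction (subst (0 ℕ.<_) (sym 0≡n) 0<n) λ ()))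
      (≈-reflexive (ℤ.*-zeroʳ (c k)))

    ∑-τ-m : ∀ (c : ℕ → ℤ) → ∑ (suc m) (λ k → c k * τ k) ≈ c n * + (m ℕ.+ m) [ P² ]
    ∑-τ-m c = begin
      ∑ (suc m) (λ k → c k * τ k)              ≡⟨ ∑-last m (λ k → c k * τ k) ⟩
      ∑ m (λ k → c k * τ k) + c m * τ m
        ≈⟨ +-cong {x = ∑ m (λ k → c k * τ k)} (block c 0 (λ i → i) (λ i → refl)) (boundary c 1 m (eq m)) ⟩
      c n * + (m ℕ.+ m) + 0ℤ                   ≡⟨ ℤ.+-identityʳ _ ⟩
      c n * + (m ℕ.+ m) ∎
      where
      open ≈-Reasoning P²
      eq : ∀ m → m ≡ 1 ℕ.* m ℕ.+ 0
      eq = ℕSolver.solve-∀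

    ∑-τ-3m : ∀ (c : ℕ → ℤ) → ∑ (suc 3m) (λ k → c k * τ k) ≈
             (c n + (c (m ℕ.+ n) + c (m ℕ.+ (m ℕ.+ n)))) * + (m ℕ.+ m) [ P² ]
    ∑-τ-3m c = begin
      ∑ (suc 3m) (λ k → c k * τ k)
        ≡⟨ trans (∑-last 3m f) (cong (_+ f 3m) (trans (∑-split m (m ℕ.+ m) f) (cong (_+_ (∑ m f)) (∑-split m m (λ k → f (m ℕ.+ k)))))) ⟩
      ∑ m f + (∑ m (λ k → f (m ℕ.+ k)) + ∑ m (λ k → f (m ℕ.+ (m ℕ.+ k)))) + f 3m
        ≈⟨ +-cong {x = ∑ m f + (∑ m (λ k → f (m ℕ.+ k)) + ∑ m (λ k → f (m ℕ.+ (m ℕ.+ k))))}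
             (+-cong (block c 0 (λ i → i) (λ i → refl))
               (+-cong (block c 1 (m ℕ.+_) (eq₁ m)) (block c 2 (λ i → m ℕ.+ (m ℕ.+ i)) (eq₂ m))))
             (boundary c 3 3m (eq₃ m)) ⟩
      c n * q + (c (m ℕ.+ n) * q + c (m ℕ.+ (m ℕ.+ n)) * q) + 0ℤ
        ≡⟨ eq₄ (c n) (c (m ℕ.+ n)) (c (m ℕ.+ (m ℕ.+ n))) q ⟩
      (c n + (c (m ℕ.+ n) + c (m ℕ.+ (m ℕ.+ n)))) * q ∎
      where
      open ≈-Reasoning P²
      q = + (m ℕ.+ m)
      f : ℕ → ℤ
      f k = c k * τ k
      eq₁ : ∀ m i → m ℕ.+ i ≡ 1 ℕ.* m ℕ.+ i
      eq₁ = ℕSolver.solve-∀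
      eq₂ : ∀ m i → m ℕ.+ (m ℕ.+ i) ≡ 2 ℕ.* m ℕ.+ i
      eq₂ = ℕSolver.solve-∀
      eq₃ : ∀ m → m ℕ.+ (m ℕ.+ m) ≡ 3 ℕ.* m ℕ.+ 0
      eq₃ = ℕSolver.solve-∀
      eq₄ : ∀ a b d q → a * q + (b * q + d * q) + 0ℤ ≡ (a + (b + d)) * q
      eq₄ = solve-∀

    ∑ₚ-expand : ∀ ρ e → ∑ₚ (λ x → (x ^ p) ^ m * (x ^ p * x ^ p + ρ) ^ e) ≡
                        ∑ (suc e) (λ k → binom e k * ρ ^ (e ℕ.∸ k) * τ k)
    ∑ₚ-expand ρ e = begin
      ∑ₚ (λ x → (x ^ p) ^ m * (x ^ p * x ^ p + ρ) ^ e)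
        ≡⟨ ∑-cong-≡ p (λ j → expand ((+ j) ^ p)) ⟩
      ∑ₚ (λ x → ∑ (suc e) (λ k → binom e k * ρ ^ (e ℕ.∸ k) * (x ^ p) ^ (m ℕ.+ (k ℕ.+ k))))
        ≡⟨ ∑-swap p (suc e) (λ j k → binom e k * ρ ^ (e ℕ.∸ k) * ((+ j) ^ p) ^ (m ℕ.+ (k ℕ.+ k))) ⟩
      ∑ (suc e) (λ k → ∑ₚ (λ x → binom e k * ρ ^ (e ℕ.∸ k) * (x ^ p) ^ (m ℕ.+ (k ℕ.+ k))))
        ≡⟨ ∑-cong-≡ (suc e) (λ k → ∑-*ˡ p (binom e k * ρ ^ (e ℕ.∸ k)) _) ⟩
      ∑ (suc e) (λ k → binom e k * ρ ^ (e ℕ.∸ k) * τ k) ∎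
      where
      open ≡-Reasoning
      eq : ∀ a b c d → a * (b * (c * d)) ≡ b * d * (a * c)
      eq = solve-∀
      expand : ∀ X → X ^ m * (X * X + ρ) ^ e ≡
                     ∑ (suc e) (λ k → binom e k * ρ ^ (e ℕ.∸ k) * X ^ (m ℕ.+ (k ℕ.+ k)))
      expand X = begin
        X ^ m * (X * X + ρ) ^ e
          ≡⟨ cong (X ^ m *_) (trans (binomial-theorem e (X * X) ρ) (binomSum≡∑ e _)) ⟩
        X ^ m * ∑ (suc e) (λ k → binom e k * ((X * X) ^ k * ρ ^ (e ℕ.∸ k)))
          ≡⟨ sym (∑-*ˡ (suc e) (X ^ m) _) ⟩
        ∑ (suc e) (λ k → X ^ m * (binom e k * ((X * X) ^ k * ρ ^ (e ℕ.∸ k))))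
          ≡⟨ ∑-cong-≡ (suc e) (λ k → trans (eq (X ^ m) (binom e k) ((X * X) ^ k) (ρ ^ (e ℕ.∸ k)))
               (cong (binom e k * ρ ^ (e ℕ.∸ k) *_)
                 (trans (cong (X ^ m *_) (trans (^-distrib-* X X k) (sym (ℤ.^-distribˡ-+-* X k k))))
                        (sym (ℤ.^-distribˡ-+-* X m (k ℕ.+ k)))))) ⟩
        ∑ (suc e) (λ k → binom e k * ρ ^ (e ℕ.∸ k) * X ^ (m ℕ.+ (k ℕ.+ k))) ∎

    -- The p-th power lifts Euler's criterion from p to p², and ψ(x) is fixed by it because p is
    -- odd.
    ψ≈[x^p]^m : ∀ x → ψ x ≈ (x ^ p) ^ m [ P² ]
    ψ≈[x^p]^m x = begin
      ψ x          ≡⟨ sym (ternary^p (ψ-ternary x)) ⟩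
      ψ x ^ p      ≈⟨ ^P-lift (ψ≈^m x) ⟩
      (x ^ m) ^ p  ≡⟨ ^-swap x m p ⟩
      (x ^ p) ^ m ∎
      where
      open ≈-Reasoning P²
      ternary^p : ∀ {u} → Ternary u → u ^ p ≡ u
      ternary^p zero  = refl
      ternary^p one   = ℤ.^-zeroˡ p
      ternary^p minus = cong (-1ℤ *_) (-1^[n+n]≡1 m)

    -- Newton's iteration u ↦ (3u - u³) / 2 for the square roots of 1.
    2ψ≈3y^m-y^3m : ∀ {x} y → y ≈ x [ P ] → + 2 * ψ x ≈ + 3 * y ^ m - y ^ 3m [ P² ]
    2ψ≈3y^m-y^3m {x} y y≈x = ≈-trans (cases (P∣? x))
      (≈-reflexive (cong (λ c → + 3 * y ^ m - c)
        (trans (cong (y ^ m *_) (sym (ℤ.^-distribˡ-+-* y m m))) (sym (ℤ.^-distribˡ-+-* y m (m ℕ.+ m))))))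
      where
      u v : ℤ
      u = ψ x
      v = y ^ m
      v≈u : v ≈ u [ P ]
      v≈u = ≈-trans (^-cong m y≈x) (≈-sym (ψ≈^m x))
      cases : Dec (P ∣ x) → + 2 * u ≈ + 3 * v - v * (v * v) [ P² ]
      -- At a zero of ψ the iteration does not help; there y^m = (y^n)² is divisible by p² outright.
      cases (yes P∣x) = ≈-linear₂ 0ℤ (v * v - + 3) (trans (cong (λ u → + 2 * u - (+ 3 * v - v * (v * v))) (ψ-∣ P∣x)) (eq v))
        (≈-refl {x = 0ℤ}) v≈0
        where
        eq : ∀ v → + 2 * 0ℤ - (+ 3 * v - v * (v * v)) ≡ 0ℤ * (0ℤ - 0ℤ) + (v * v - + 3) * (v - 0ℤ)
        eq = solve-∀
        square≈0 : ∀ {z} → z ≈ 0ℤ [ P ] → z * z ≈ 0ℤ [ P² ]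
        square≈0 {z} (mod q e) = mod (q * q) (trans (ℤ.+-identityʳ (z * z))
          (trans (cong₂ _*_ z≡qP z≡qP) (eq′ q P)))
          where
          z≡qP = trans (sym (ℤ.+-identityʳ z)) e
          eq′ : ∀ q P → q * P * (q * P) ≡ q * q * (P * P)
          eq′ = solve-∀
        0^≈0 : ∀ k → 0 ℕ.< k → y ^ k ≈ 0ℤ [ P ]
        0^≈0 (suc k) _ = ≈-trans (*-congʳ (y ^ k) (≈-trans y≈x (∣⇒≈0 P∣x))) (≈-reflexive (ℤ.*-zeroˡ (y ^ k)))
        v≈0 : v ≈ 0ℤ [ P² ]
        v≈0 = ≈-trans (≈-reflexive (ℤ.^-distribˡ-+-* y n n)) (square≈0 (0^≈0 n 0<n))
      -- The fixed points u = 1 and u = -1 are superattracting: once u² = 1, the error is (v - u)²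
      -- times an integer, and v - u is a multiple of p.
      cases (no P∤x) = let mod q v-u≡qP = v≈u in mod (q * q * (+ 3 * u + (v - u))) (begin
        + 2 * u - (+ 3 * v - v * (v * v))
          ≡⟨ eq₁ u v ⟩
        (v - u) * (v - u) * (+ 3 * u + (v - u)) + (u * u - 1ℤ) * (u + + 3 * (v - u))
          ≡⟨ cong₂ (λ d s → d * d * (+ 3 * u + (v - u)) + (s - 1ℤ) * (u + + 3 * (v - u))) v-u≡qP (ψ*ψ≡1 P∤x) ⟩
        q * P * (q * P) * (+ 3 * u + (v - u)) + (1ℤ - 1ℤ) * (u + + 3 * (v - u))
          ≡⟨ eq₂ q P (+ 3 * u + (v - u)) (u + + 3 * (v - u)) ⟩
        q * q * (+ 3 * u + (v - u)) * (P * P) ∎)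
        where
        open ≡-Reasoning
        eq₁ : ∀ u v → + 2 * u - (+ 3 * v - v * (v * v)) ≡
              (v - u) * (v - u) * (+ 3 * u + (v - u)) + (u * u - 1ℤ) * (u + + 3 * (v - u))
        eq₁ = solve-∀
        eq₂ : ∀ q P a b → q * P * (q * P) * a + (1ℤ - 1ℤ) * b ≡ q * q * a * (P * P)
        eq₂ = solve-∀

    -- The surviving indices are k = n in y^m and k = n, m + n, 2m + n in y^(3m). They carry ρ^n
    -- times powers of ρ^m, where ρ = (-r)^p and ρ^m ≡ ψ(-r) = ψ(r). The two outer binomials
    -- coincide by symmetry and have ψ(r)² = 1 or nothing attached, hence the 2; only the middle one
    -- keeps the sign ψ(r). The last factor p - 1 counts the units.
    jacobsthal≈ : ∀ {r} → ¬ P ∣ r →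
      + 2 * jacobsthal r ≈
      ((- r) ^ p) ^ n * (+ 3 * binom m n - + 2 * binom 3m n - ψ r * binom 3m (m ℕ.+ n)) * + (m ℕ.+ m) [ P² ]
    jacobsthal≈ {r} P∤r = begin
      + 2 * jacobsthal r
        ≡⟨ sym (∑-*ˡ p (+ 2) _) ⟩
      ∑ₚ (λ x → + 2 * (ψ x * ψ (x * x - r)))
        ≈⟨ ∑-cong p (λ j → pointwise (+ j)) ⟩
      ∑ₚ (λ x → + 3 * ((x ^ p) ^ m * Y x ^ m) - (x ^ p) ^ m * Y x ^ 3m)
        ≡⟨ trans (∑-minus p _ _) (cong₂ _-_ (trans (∑-*ˡ p (+ 3) _) (cong (+ 3 *_) (∑ₚ-expand ρ m))) (∑ₚ-expand ρ 3m)) ⟩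
      + 3 * ∑ (suc m) (λ k → binom m k * ρ ^ (m ℕ.∸ k) * τ k) - ∑ (suc 3m) (λ k → binom 3m k * ρ ^ (3m ℕ.∸ k) * τ k)
        ≈⟨ minus-cong (*-congˡ (+ 3) (∑-τ-m (λ k → binom m k * ρ ^ (m ℕ.∸ k)))) (∑-τ-3m (λ k → binom 3m k * ρ ^ (3m ℕ.∸ k))) ⟩
      + 3 * (binom m n * ρ ^ (m ℕ.∸ n) * q) -
        (binom 3m n * ρ ^ (3m ℕ.∸ n) + (binom 3m (m ℕ.+ n) * ρ ^ (3m ℕ.∸ (m ℕ.+ n)) +
          binom 3m (m ℕ.+ (m ℕ.+ n)) * ρ ^ (3m ℕ.∸ (m ℕ.+ (m ℕ.+ n))))) * q
        ≡⟨ cong₂ (λ i j → + 3 * (binom m n * ρ ^ i * q) - (binom 3m n * ρ ^ j +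
             (binom 3m (m ℕ.+ n) * ρ ^ (3m ℕ.∸ (m ℕ.+ n)) + binom 3m (m ℕ.+ (m ℕ.+ n)) * ρ ^ (3m ℕ.∸ (m ℕ.+ (m ℕ.+ n))))) * q)
             (∸-from n n refl) (∸-from n (m ℕ.+ (m ℕ.+ n)) (eqℕ₁ n)) ⟩
      + 3 * (binom m n * t * q) -
        (binom 3m n * ρ ^ (m ℕ.+ (m ℕ.+ n)) + (binom 3m (m ℕ.+ n) * ρ ^ (3m ℕ.∸ (m ℕ.+ n)) +
          binom 3m (m ℕ.+ (m ℕ.+ n)) * ρ ^ (3m ℕ.∸ (m ℕ.+ (m ℕ.+ n))))) * q
        ≡⟨ cong₂ (λ i j → + 3 * (binom m n * t * q) - (binom 3m n * ρ ^ (m ℕ.+ (m ℕ.+ n)) +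
             (binom 3m (m ℕ.+ n) * ρ ^ i + binom 3m (m ℕ.+ (m ℕ.+ n)) * ρ ^ j)) * q)
             (∸-from (m ℕ.+ n) (m ℕ.+ n) (eqℕ₂ n)) (∸-from (m ℕ.+ (m ℕ.+ n)) n (eqℕ₃ n)) ⟩
      + 3 * (binom m n * t * q) -
        (binom 3m n * ρ ^ (m ℕ.+ (m ℕ.+ n)) + (binom 3m (m ℕ.+ n) * ρ ^ (m ℕ.+ n) +
          binom 3m (m ℕ.+ (m ℕ.+ n)) * t)) * q
        ≡⟨ cong₂ (λ a b → + 3 * (binom m n * t * q) - (binom 3m n * a + (binom 3m (m ℕ.+ n) * b +
             binom 3m (m ℕ.+ (m ℕ.+ n)) * t)) * q)
             (trans (ℤ.^-distribˡ-+-* ρ m (m ℕ.+ n)) (cong (ρ ^ m *_) (ℤ.^-distribˡ-+-* ρ m n)))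
             (ℤ.^-distribˡ-+-* ρ m n) ⟩
      + 3 * (binom m n * t * q) -
        (binom 3m n * (σ * (σ * t)) + (binom 3m (m ℕ.+ n) * (σ * t) + binom 3m (m ℕ.+ (m ℕ.+ n)) * t)) * q
        ≡⟨ cong (λ b → + 3 * (binom m n * t * q) - (binom 3m n * (σ * (σ * t)) + (binom 3m (m ℕ.+ n) * (σ * t) + b * t)) * q)
             symmetric ⟩
      + 3 * (binom m n * t * q) -
        (binom 3m n * (σ * (σ * t)) + (binom 3m (m ℕ.+ n) * (σ * t) + binom 3m n * t)) * q
        ≈⟨ ≈-linear₂ (- ((binom 3m n * t * (σ + s) + binom 3m (m ℕ.+ n) * t) * q)) (- (binom 3m n * t * q))
             (eq (binom m n) (binom 3m n) (binom 3m (m ℕ.+ n)) s σ t q) σ≈s (≈-reflexive (ψ*ψ≡1 P∤r)) ⟩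
      t * (+ 3 * binom m n - + 2 * binom 3m n - s * binom 3m (m ℕ.+ n)) * q ∎
      where
      open ≈-Reasoning P²
      q ρ σ s t : ℤ
      q = + (m ℕ.+ m)
      ρ = (- r) ^ p
      σ = ρ ^ m
      s = ψ r
      t = ρ ^ n
      Y : ℤ → ℤ
      Y x = x ^ p * x ^ p + ρ
      σ≈s : σ ≈ s [ P² ]
      σ≈s = ≈-trans (≈-sym (ψ≈[x^p]^m (- r))) (≈-reflexive (ψ-neg r))
      pointwise : ∀ x → + 2 * (ψ x * ψ (x * x - r)) ≈ + 3 * ((x ^ p) ^ m * Y x ^ m) - (x ^ p) ^ m * Y x ^ 3m [ P² ]
      pointwise x = begin
        + 2 * (ψ x * ψ (x * x - r))
          ≡⟨ eq₁ (ψ x) (ψ (x * x - r)) ⟩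
        ψ x * (+ 2 * ψ (x * x - r))
          ≈⟨ *-cong (ψ≈[x^p]^m x) (2ψ≈3y^m-y^3m (Y x) (+-cong (*-cong (x^p≈x x) (x^p≈x x)) (x^p≈x (- r)))) ⟩
        (x ^ p) ^ m * (+ 3 * Y x ^ m - Y x ^ 3m)
          ≡⟨ eq₂ ((x ^ p) ^ m) (Y x ^ m) (Y x ^ 3m) ⟩
        + 3 * ((x ^ p) ^ m * Y x ^ m) - (x ^ p) ^ m * Y x ^ 3m ∎
        where
        eq₁ : ∀ a b → + 2 * (a * b) ≡ a * (+ 2 * b)
        eq₁ = solve-∀
        eq₂ : ∀ a b c → a * (+ 3 * b - c) ≡ + 3 * (a * b) - a * c
        eq₂ = solve-∀
      ∸-from : ∀ k l {e} → e ≡ l ℕ.+ k → e ℕ.∸ k ≡ l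
      ∸-from k l refl = ℕ.m+n∸n≡m l k
      eqℕ₁ : ∀ n → (n ℕ.+ n) ℕ.+ ((n ℕ.+ n) ℕ.+ (n ℕ.+ n)) ≡ ((n ℕ.+ n) ℕ.+ ((n ℕ.+ n) ℕ.+ n)) ℕ.+ n
      eqℕ₁ = ℕSolver.solve-∀
      eqℕ₂ : ∀ n → (n ℕ.+ n) ℕ.+ ((n ℕ.+ n) ℕ.+ (n ℕ.+ n)) ≡ ((n ℕ.+ n) ℕ.+ n) ℕ.+ ((n ℕ.+ n) ℕ.+ n)
      eqℕ₂ = ℕSolver.solve-∀
      eqℕ₃ : ∀ n → (n ℕ.+ n) ℕ.+ ((n ℕ.+ n) ℕ.+ (n ℕ.+ n)) ≡ n ℕ.+ ((n ℕ.+ n) ℕ.+ ((n ℕ.+ n) ℕ.+ n))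
      eqℕ₃ = ℕSolver.solve-∀
      symmetric : binom 3m (m ℕ.+ (m ℕ.+ n)) ≡ binom 3m n
      symmetric = subst (λ e → binom e (m ℕ.+ (m ℕ.+ n)) ≡ binom e n) (sym (eqℕ₁ n)) (binom-sym (m ℕ.+ (m ℕ.+ n)) n)
      eq : ∀ C₂ C₆ W s σ t q →
        (+ 3 * (C₂ * t * q) - (C₆ * (σ * (σ * t)) + (W * (σ * t) + C₆ * t)) * q) -
        t * (+ 3 * C₂ - + 2 * C₆ - s * W) * q ≡
        (- ((C₆ * t * (σ + s) + W * t) * q)) * (σ - s) + (- (C₆ * t * q)) * (s * s - 1ℤ)
      eq = solve-∀

  -- Eliminating the binomial coefficients modulo p²

  module Congruence (n : ℕ) (prime : Prime (suc ((n ℕ.+ n) ℕ.+ (n ℕ.+ n)))) where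

    private
      m = n ℕ.+ n
      3m = m ℕ.+ (m ℕ.+ m)
      p = suc (m ℕ.+ m)

    open PrimeModulus (m ℕ.+ m) prime
    open ResidueSums (m ℕ.+ m) prime
    open LegendreSymbol n prime
    open JacobsthalSums n prime
    open JacobsthalNorm n prime
    open JacobsthalEvaluation n prime
    open JacobsthalExpansion n prime
    open Delannoy n prime

    private
      -- The indices 2 and 6 refer to binom(2n, n) and binom(6n, n). U is what the expansions of
      -- J(1) and J(g) share, and V is what the Delannoy number produces.
      ε q C₂ C₆ K W U V : ℤ
      ε  = -1ℤ ^ n
      q  = + (m ℕ.+ m)
      C₂  = binom m n
      C₆ = binom 3m n
      K  = binom (m ℕ.+ p) n
      W  = binom 3m (m ℕ.+ n)
      U  = + 3 * C₂ - + 2 * C₆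
      V  = + 3 * C₂ - K

      n<p : n ℕ.< p
      n<p = ℕ.≤-<-trans (ℕ.m≤m+n n n) m<p

      m+n<p : m ℕ.+ n ℕ.< p
      m+n<p = ℕ.s≤s (ℕ.+-monoʳ-≤ m (ℕ.m≤m+n n n))

      P∤+ : ∀ k → 0 ℕ.< k → k ℕ.< p → ¬ P ∣ + k
      P∤+ (suc k) _ = P∤small k

      P∤4 : ¬ P ∣ + 4
      P∤4 = P∤* {+ 2} {+ 2} P∤2 P∤2

    K≈C₂ : K ≈ C₂ [ P ]
    K≈C₂ = ≈-trans (≈-reflexive (cong (λ e → binom e n) (ℕ.+-comm m p))) (binom-p+≈ m n n<p)

    -- Here P + n = 5n + 1 and P + m = 6n + 1. Written in terms of P, the relation reads n K ≡ 2n C₆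
    -- modulo p and keeps the first-order correction for p².
    [P+n]*K≡[P+m]*C₆ : (P + + n) * K ≡ (P + + m) * C₆
    [P+n]*K≡[P+m]*C₆ = trans (cong₂ (λ a e → a * binom e n) (eq₁ (+ n)) (ℕ.+-suc m (m ℕ.+ m)))
      (trans (binom-suc-upper 3m n) (cong (_* C₆) (eq₂ (+ m))))
      where
      eq₁ : ∀ ν → 1ℤ + (ν + ν + (ν + ν)) + ν ≡ 1ℤ + (ν + ν + (ν + ν + (ν + ν))) - ν
      eq₁ = solve-∀
      eq₂ : ∀ μ → 1ℤ + (μ + (μ + μ)) ≡ 1ℤ + (μ + μ) + μ
      eq₂ = solve-∀

    K≈2C₆ : K ≈ + 2 * C₆ [ P ]
    K≈2C₆ = ≈P-cancelˡ {c = + n} (P∤+ n 0<n n<p)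
      (≈-linear₂ (C₆ - K) 1ℤ (eq P (+ n) K C₆) (modulus≈0 P) (≈-reflexive [P+n]*K≡[P+m]*C₆))
      where
      eq : ∀ P ν K C₆ → ν * K - ν * (+ 2 * C₆) ≡
                        (C₆ - K) * (P - 0ℤ) + 1ℤ * ((P + ν) * K - (P + (ν + ν)) * C₆)
      eq = solve-∀

    -- 6n = p + (2n - 1), and the lower index 3n exceeds 2n - 1.
    W≈0 : W ≈ 0ℤ [ P ]
    W≈0 = go (ℕ.pred m) (sym (ℕ.suc-pred m {{ℕ.>-nonZero 0<m}}))
      where
      go : ∀ k → m ≡ suc k → W ≈ 0ℤ [ P ]
      go k m≡1+k = begin
        binom (m ℕ.+ (m ℕ.+ m)) (m ℕ.+ n)
          ≡⟨ cong (λ j → binom j (m ℕ.+ n)) (trans (cong (ℕ._+ (m ℕ.+ m)) m≡1+k) (cong suc (ℕ.+-comm k (m ℕ.+ m)))) ⟩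
        binom (p ℕ.+ k) (m ℕ.+ n)
          ≈⟨ binom-p+≈ k (m ℕ.+ n) m+n<p ⟩
        binom k (m ℕ.+ n)
          ≡⟨ binom-> (ℕ.≤-trans (ℕ.≤-reflexive (sym m≡1+k)) (ℕ.m≤m+n m n)) ⟩
        0ℤ ∎
        where open ≈-Reasoning P

    PW≈0 : P * W ≈ 0ℤ [ P² ]
    PW≈0 = ≈-trans (≈P⇒*P≈P² W≈0) (≈-reflexive (ℤ.*-zeroʳ P))

    W²≈0 : W * W ≈ 0ℤ [ P² ]
    W²≈0 = let divides w W≡wP = ≈0⇒∣ W≈0 in
      mod (w * w) (trans (ℤ.+-identityʳ (W * W)) (trans (cong₂ _*_ W≡wP W≡wP) (eq w P)))
      where
      eq : ∀ w P → w * P * (w * P) ≡ w * w * (P * P)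
      eq = solve-∀

    -- U - V = K - 2 C₆, and the exact relation gives (P + m)(K - 2 C₆) = -P K. As 2m ≡ -1 (mod p),
    -- this means U - V ≡ 2 P K; and P U ≡ 2 P K because U ≡ 3K - K modulo p. Hence V ≡ U - P U = -q
    -- U.
    -qU≈V : - (q * U) ≈ V [ P² ]
    -qU≈V = ≈P²-cancelˡ {c = P + + m} P∤P+m (≈-linear₃ (+ 3 * (P + + m)) (- (P + + m)) (- (+ 3 * K))
      -- Twice the exact relation between K and C₆ is subtracted as a zero, so that the solver is
      -- left with an identity in free variables.
      (trans (minus-2*0 ((P + + m) * - (q * U) - (P + + m) * V) (ℤ.i≡j⇒i-j≡0 {i = (P + + n) * K} {j = (P + + m) * C₆} [P+n]*K≡[P+m]*C₆)) (eq (+ n) K C₂ C₆))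
      (≈P⇒*P≈P² K≈C₂) (≈P⇒*P≈P² K≈2C₆) (modulus≈0 P²))
      where
      P∤P+m : ¬ P ∣ P + + m
      P∤P+m = P∤-resp-≈ (≈-sym (≈-linear 1ℤ (eq₁ P (+ m)) (modulus≈0 P))) (P∤+ m 0<m m<p)
        where
        eq₁ : ∀ P μ → P + μ - μ ≡ 1ℤ * (P - 0ℤ)
        eq₁ = solve-∀
      minus-2*0 : ∀ x {z} → z ≡ 0ℤ → x ≡ x - + 2 * z
      minus-2*0 x refl = sym (ℤ.+-identityʳ x)
      eq : ∀ ν K C₂ C₆ → let μ = ν + ν ; P = 1ℤ + (μ + μ) in
        (P + μ) * - ((μ + μ) * (+ 3 * C₂ - + 2 * C₆)) - (P + μ) * (+ 3 * C₂ - K) - + 2 * ((P + ν) * K - (P + μ) * C₆) ≡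
        + 3 * (P + μ) * (P * K - P * C₂) + (- (P + μ)) * (P * K - P * (+ 2 * C₆)) + (- (+ 3 * K)) * (P * P - 0ℤ)
      eq = solve-∀

    -- The outer factor t of J(g) has t² ≡ ψ(-g) = -1 and that of J(1) has ε² = 1, so the norm
    -- equation becomes 16 P ≡ q² ((U - W)² - (U + W)²) = -4 q² U W. Finally q² W ≡ W, because q² -
    -- 1 is a multiple of p and so is W.
    4P≈-UW : + 4 * P ≈ - (U * W) [ P² ]
    4P≈-UW = ≈P²-cancelˡ {c = + 4} P∤4 (begin
      + 4 * (+ 4 * P)
        ≡⟨ cong (+ 4 *_) (sym (jacobsthal-norm g ψg≡-1)) ⟩
      + 4 * (J₁ * J₁ + Jg * Jg)
        ≡⟨ eq₁ J₁ Jg ⟩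
      + 2 * J₁ * (+ 2 * J₁) + + 2 * Jg * (+ 2 * Jg)
        ≈⟨ +-cong {x = + 2 * J₁ * (+ 2 * J₁)} (*-cong J₁≈ J₁≈) (*-cong Jg≈ Jg≈) ⟩
      ε * (U - 1ℤ * W) * q * (ε * (U - 1ℤ * W) * q) + t * (U - -1ℤ * W) * q * (t * (U - -1ℤ * W) * q)
        ≈⟨ ≈-linear₂ ((U - W) * (U - W) * (q * q)) ((U + W) * (U + W) * (q * q)) (eq₂ ε t U W q)
             (≈-reflexive (-1^n*-1^n≡1 n)) t²≈-1 ⟩
      - (+ 4 * (q * q * (U * W)))
        ≈⟨ ≈-linear (+ 4 * U * (1ℤ - q)) (eq₃ q U W) PW≈0 ⟩
      + 4 * (- (U * W)) ∎)
      where
      open ≈-Reasoning P²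
      g J₁ Jg t : ℤ
      g  = proj₁ nonresidue
      J₁ = jacobsthal 1ℤ
      Jg = jacobsthal g
      t  = ((- g) ^ p) ^ n
      ψg≡-1 : ψ g ≡ -1ℤ
      ψg≡-1 = proj₂ nonresidue
      J₁≈ : + 2 * J₁ ≈ ε * (U - 1ℤ * W) * q [ P² ]
      J₁≈ = ≈-trans (jacobsthal≈ P∤1) (≈-reflexive (cong₂ (λ e s → e ^ n * (U - s * W) * q)
        (cong (-1ℤ *_) (-1^[n+n]≡1 m)) ψ-1))
      Jg≈ : + 2 * Jg ≈ t * (U - -1ℤ * W) * q [ P² ]
      Jg≈ = ≈-trans (jacobsthal≈ (ψ≡-1⇒∤ ψg≡-1)) (≈-reflexive (cong (λ s → t * (U - s * W) * q) ψg≡-1))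
      t²≈-1 : t * t ≈ -1ℤ [ P² ]
      t²≈-1 = ≈-trans (≈-reflexive (sym (ℤ.^-distribˡ-+-* ((- g) ^ p) n n)))
        (≈-trans (≈-sym (ψ≈[x^p]^m (- g))) (≈-reflexive (trans (ψ-neg g) ψg≡-1)))
      eq₁ : ∀ x y → + 4 * (x * x + y * y) ≡ + 2 * x * (+ 2 * x) + + 2 * y * (+ 2 * y)
      eq₁ = solve-∀
      eq₂ : ∀ ε t U W q →
        ε * (U - 1ℤ * W) * q * (ε * (U - 1ℤ * W) * q) + t * (U - -1ℤ * W) * q * (t * (U - -1ℤ * W) * q) -
        (- (+ 4 * (q * q * (U * W)))) ≡
        (U - W) * (U - W) * (q * q) * (ε * ε - 1ℤ) + (U + W) * (U + W) * (q * q) * (t * t - -1ℤ)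
      eq₂ = solve-∀
      eq₃ : ∀ q U W → - (+ 4 * (q * q * (U * W))) - + 4 * (- (U * W)) ≡
                      + 4 * U * (1ℤ - q) * ((1ℤ + q) * W - 0ℤ)
      eq₃ = solve-∀

    VW≈-4P : V * W ≈ - (+ 4 * P) [ P² ]
    VW≈-4P = ≈-linear₃ (- W) (- q) (+ 4) (eq V W U q) -qU≈V 4P≈-UW (modulus≈0 P²)
      where
      eq : ∀ V W U q → let P = 1ℤ + q in
        V * W - - (+ 4 * P) ≡
        (- W) * (- (q * U) - V) + (- q) * (+ 4 * P - - (U * W)) + + 4 * (P * P - 0ℤ)
      eq = solve-∀

    ∑-weights : ℤ
    ∑-weights = ∑ (suc n) (λ k → weight (k ℕ.+ k))

    module _ {a b : ℤ} (P≡a²+b² : P ≡ a * a + b * b) (a≈1 : a ≈ 1ℤ [ + 4 ]) where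

      -- Compares the exact J(1) = -2εa with its expansion; multiplication by -q takes U to V and
      -- fixes W up to a sign it already has, as P W ≡ 0.
      4a≈V-W : + 4 * a ≈ V - W [ P² ]
      4a≈V-W = ≈-trans
        (≈-linear₂ (- ε) (- (+ 4 * a + q * (U - W))) (eq₁ ε a q U W) 2J₁≈ (≈-reflexive (-1^n*-1^n≡1 n)))
        (≈-linear₂ 1ℤ 1ℤ (eq₂ q U W V) -qU≈V PW≈0)
        where
        2J₁≈ : + 2 * - (+ 2 * (ε * a)) ≈ ε * (U - 1ℤ * W) * q [ P² ]
        2J₁≈ = ≈-trans (≈-reflexive (cong (+ 2 *_) (sym (jacobsthal-1≡ {a} {b} P≡a²+b² a≈1))))
          (≈-trans (jacobsthal≈ P∤1) (≈-reflexive (cong₂ (λ e s → e ^ n * (U - s * W) * q)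
            (cong (-1ℤ *_) (-1^[n+n]≡1 m)) ψ-1)))
        eq₁ : ∀ ε a q U W → + 4 * a - (- (q * (U - W))) ≡
          (- ε) * (+ 2 * - (+ 2 * (ε * a)) - ε * (U - 1ℤ * W) * q) + (- (+ 4 * a + q * (U - W))) * (ε * ε - 1ℤ)
        eq₁ = solve-∀
        eq₂ : ∀ q U W V → - (q * (U - W)) - (V - W) ≡ 1ℤ * (- (q * U) - V) + 1ℤ * ((1ℤ + q) * W - 0ℤ)
        eq₂ = solve-∀

      -- From 4aW ≡ (V - W) W ≡ -4p comes 4aV ≡ 4a (4a + W) ≡ 16a² - 4p. The factor 4a stays on the
      -- left, so that the later term p/(4a) is still an integer here.
      4a*∑-weights≈ : + 4 * a * ∑-weights ≈ + 2 * a + + 4 * (ε * (a * a)) - ε * P [ P² ]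
      4a*∑-weights≈ = ≈P²-cancelˡ {c = + 4} P∤4
        (≈-linear₃ (+ 8 * a) (+ 4 * a) ε (eq₂ a ∑-weights delannoy ε V P)
          (≈-reflexive 2*∑-weight) 2*delannoy≈ 4aV≈)
        where
        4aV≈ : + 4 * a * V ≈ + 16 * (a * a) - + 4 * P [ P² ]
        4aV≈ = ≈-linear₃ (W - + 4 * a) -1ℤ 1ℤ (eq₁ a V W P) 4a≈V-W W²≈0 VW≈-4P
          where
          eq₁ : ∀ a V W P → + 4 * a * V - (+ 16 * (a * a) - + 4 * P) ≡
            (W - + 4 * a) * (+ 4 * a - (V - W)) + -1ℤ * (W * W - 0ℤ) + 1ℤ * (V * W - - (+ 4 * P))
          eq₁ = solve-∀
        eq₂ : ∀ a E D ε V P →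
          + 4 * (+ 4 * a * E) - + 4 * (+ 2 * a + + 4 * (ε * (a * a)) - ε * P) ≡
          + 8 * a * (+ 2 * E - (1ℤ + D)) + + 4 * a * (+ 2 * D - ε * V) +
          ε * (+ 4 * a * V - (+ 16 * (a * a) - + 4 * P))
        eq₂ = solve-∀

-- Transfer from integers to rational numbers

open IntegerCongruences
open import Data.Fin.Base using (toℕ)
open import Data.Nat.Coprimality using (coprime-divisor)
import Data.Nat.Coprimality as Coprimality
open import Data.Rational.Base as ℚ using (ℚ; mkℚ; ½; _+_; _-_; _*_; -_; 1/_)
open import Data.Rational.Literals using (fromℤ)
import Data.Rational.Properties as ℚ
open import Data.Rational.Solver using (module +-*-Solver)
open import Data.Rational.Unnormalised.Base as ℚᵘ using (mkℚᵘ; *≡*)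
import Data.Rational.Unnormalised.Properties as ℚᵘ
open import Defs

fromℤ-+ : ∀ x y → fromℤ (x ℤ.+ y) ≡ fromℤ x + fromℤ y
fromℤ-+ x y = ℚ.toℚᵘ-injective (ℚᵘ.≃-trans (*≡* (eq x y)) (ℚᵘ.≃-sym (ℚ.toℚᵘ-homo-+ (fromℤ x) (fromℤ y))))
  where
  eq : ∀ x y → (x ℤ.+ y) ℤ.* 1ℤ ≡ (x ℤ.* 1ℤ ℤ.+ y ℤ.* 1ℤ) ℤ.* 1ℤ
  eq = solve-∀

fromℤ-* : ∀ x y → fromℤ (x ℤ.* y) ≡ fromℤ x * fromℤ y
fromℤ-* x y = ℚ.toℚᵘ-injective (ℚᵘ.≃-trans (*≡* refl) (ℚᵘ.≃-sym (ℚ.toℚᵘ-homo-* (fromℤ x) (fromℤ y))))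

fromℤ-neg : ∀ x → fromℤ (ℤ.- x) ≡ - fromℤ x
fromℤ-neg (+ zero)  = refl
fromℤ-neg (+ suc n) = refl
fromℤ-neg -[1+ n ]  = refl

/-*-cancel : ∀ i n .{{_ : ℕ.NonZero n}} → (i ℚ./ n) * fromℤ (+ n) ≡ fromℤ i
/-*-cancel i (suc n) = ℚ.toℚᵘ-injective (ℚᵘ.≃-trans (ℚ.toℚᵘ-homo-* (i ℚ./ suc n) (fromℤ (+ suc n)))
  (ℚᵘ.≃-trans (ℚᵘ.*-congʳ {x = mkℚᵘ (+ suc n) 0} (ℚ.toℚᵘ-fromℚᵘ (mkℚᵘ i n))) (*≡* (eq i (+ suc n)))))
  where
  eq : ∀ i d → i ℤ.* d ℤ.* 1ℤ ≡ i ℤ.* (d ℤ.* 1ℤ)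
  eq = solve-∀

cross-multiply : ∀ q {d N} → q * fromℤ d ≡ fromℤ N → ℚ.↥ q ℤ.* d ≡ N ℤ.* ℚ.↧ q
cross-multiply q@record{} {d} {N} e with ℚᵘ.≃-trans (ℚᵘ.≃-sym (ℚ.toℚᵘ-homo-* q (fromℤ d))) (ℚ.toℚᵘ-cong e)
... | *≡* e′ = trans (sym (ℤ.*-identityʳ (ℚ.↥ q ℤ.* d))) (trans e′ (cong (N ℤ.*_) (ℤ.*-identityʳ (ℚ.↧ q))))

module Localisation (p-1 : ℕ) (prime : Prime (suc p-1)) where

  open PrimeModulus p-1 prime

  private
    p = suc p-1

  -- The denominator in lowest terms divides every d that clears q, and a common divisor with the
  -- prime p is 1 or p.
  integral : ∀ q {d N} → ¬ P ∣ d → q * fromℤ d ≡ fromℤ N → Integral p q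
  integral q@(mkℚ n d-1 coprime) {d} {N} P∤d e {i} (i∣den , i∣p) with prime⇒irreducible prime i∣p
  ... | inj₁ i≡1 = i≡1
  ... | inj₂ refl = contradiction (∣ᵤ⇒∣ (ℕ.∣-trans i∣den den∣d)) P∤d
    where
    den∣d : suc d-1 ℕ.∣ ℤ.∣ d ∣
    den∣d = coprime-divisor (Coprimality.sym (Coprimality.recompute coprime))
      (subst (suc d-1 ℕ.∣_) (ℤ.abs-* n d) (subst (λ z → suc d-1 ℕ.∣ ℤ.∣ z ∣) (sym (cross-multiply q e))
        (subst (suc d-1 ℕ.∣_) (sym (ℤ.abs-* N (+ suc d-1))) (ℕ.n∣m*n ℤ.∣ N ∣))))

  infix 4 _∼_
  -- Says that q reduces to x modulo p², witnessed by any fraction N/d with d prime to p. The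
  -- fraction may be unreduced, so sums only multiply denominators and no gcd has to be followed.
  _∼_ : ℚ → ℤ → Set
  q ∼ x = ∃[ d ] ∃[ N ] (¬ P ∣ d × q * fromℤ d ≡ fromℤ N × N ≈ d ℤ.* x [ P² ])

  ∼-0 : ℚ.0ℚ ∼ 0ℤ
  ∼-0 = 1ℤ , 0ℤ , P∤1 , refl , ≈-refl

  ∼-+ : ∀ {q r x y} → q ∼ x → r ∼ y → q + r ∼ x ℤ.+ y
  ∼-+ {q} {r} {x} {y} (d , N , P∤d , qd≡N , N≈dx) (e , M , P∤e , re≡M , M≈ey) =
    d ℤ.* e , N ℤ.* e ℤ.+ M ℤ.* d , P∤* P∤d P∤e , [q+r]de , ≈-linear₂ e d (eq d e x y N M) N≈dx M≈ey
    where
    open ≡-Reasoning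
    eq : ∀ d e x y N M → N ℤ.* e ℤ.+ M ℤ.* d ℤ.- d ℤ.* e ℤ.* (x ℤ.+ y) ≡
                         e ℤ.* (N ℤ.- d ℤ.* x) ℤ.+ d ℤ.* (M ℤ.- e ℤ.* y)
    eq = solve-∀
    [q+r]de : (q + r) * fromℤ (d ℤ.* e) ≡ fromℤ (N ℤ.* e ℤ.+ M ℤ.* d)
    [q+r]de = begin
      (q + r) * fromℤ (d ℤ.* e)
        ≡⟨ cong ((q + r) *_) (fromℤ-* d e) ⟩
      (q + r) * (fromℤ d * fromℤ e)
        ≡⟨ solve 4 (λ q r d e → (q :+ r) :* (d :* e) := q :* d :* e :+ r :* e :* d) refl q r (fromℤ d) (fromℤ e) ⟩
      q * fromℤ d * fromℤ e + r * fromℤ e * fromℤ d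
        ≡⟨ cong₂ (λ u v → u * fromℤ e + v * fromℤ d) qd≡N re≡M ⟩
      fromℤ N * fromℤ e + fromℤ M * fromℤ d
        ≡⟨ cong₂ _+_ (sym (fromℤ-* N e)) (sym (fromℤ-* M d)) ⟩
      fromℤ (N ℤ.* e) + fromℤ (M ℤ.* d)
        ≡⟨ sym (fromℤ-+ (N ℤ.* e) (M ℤ.* d)) ⟩
      fromℤ (N ℤ.* e ℤ.+ M ℤ.* d) ∎
      where open +-*-Solver

  ∼-∑ : ∀ n {f : ℕ → ℚ} {g : ℕ → ℤ} → (∀ k → k ℕ.≤ n → f k ∼ g k) →
        (∑[ k ≤ n ] f (toℕ k)) ∼ ∑ (suc n) g
  ∼-∑ zero    {f} {g} f∼g = subst (∑[ k ≤ 0 ] f (toℕ k) ∼_)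
    (sym (trans (∑-suc 0 g) (cong (ℤ._+_ (g 0)) (∑-0 _)))) (∼-+ {q = f 0} (f∼g 0 ℕ.z≤n) ∼-0)
  ∼-∑ (suc n) {f} {g} f∼g = subst (∑[ k ≤ suc n ] f (toℕ k) ∼_) (sym (∑-suc (suc n) g))
    (∼-+ {q = f 0} (f∼g 0 ℕ.z≤n) (∼-∑ n {f ∘ suc} {g ∘ suc} λ k k≤n → f∼g (suc k) (ℕ.s≤s k≤n)))

  -- The two rationals are compared through a common integer. The cofactor z is (q - r)/p², and its
  -- integrality follows because the product d e of the two denominators clears it.
  ∼⇒≡mod : ∀ {q r x} → q ∼ x → r ∼ x → q ≡ r [mod p ^ 2 ]
  ∼⇒≡mod {q} {r} {x} (d , N , P∤d , qd≡N , N≈dx) (e , M , P∤e , re≡M , M≈ex) =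
    integral q P∤d qd≡N , integral r P∤e re≡M , z , integral z {d ℤ.* e} {w} (P∤* P∤d P∤e) zde≡w , q-r≡P²z
    where
    open ≡-Reasoning
    π : ℚ
    π = fromℤ (+ (p ℕ.^ 2))
    z : ℚ
    z = (q - r) * 1/ π
    difference≈0 : N ℤ.* e ℤ.- M ℤ.* d ≈ 0ℤ [ P² ]
    difference≈0 = ≈-linear₂ e (ℤ.- d) (eq d e x N M) N≈dx M≈ex
      where
      eq : ∀ d e x N M → N ℤ.* e ℤ.- M ℤ.* d ℤ.- 0ℤ ≡
                         e ℤ.* (N ℤ.- d ℤ.* x) ℤ.+ (ℤ.- d) ℤ.* (M ℤ.- e ℤ.* x)
      eq = solve-∀
    w : ℤ
    w = _∣_.quotient (≈0⇒∣ difference≈0)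
    difference≡wP² : N ℤ.* e ℤ.- M ℤ.* d ≡ w ℤ.* + (p ℕ.^ 2)
    difference≡wP² = trans (_∣_.equality (≈0⇒∣ difference≈0))
      (cong (λ k → w ℤ.* + (p ℕ.* k)) (sym (ℕ.*-identityʳ p)))
    q-r≡P²z : q - r ≡ π * z
    q-r≡P²z = begin
      q - r                    ≡⟨ sym (ℚ.*-identityʳ (q - r)) ⟩
      (q - r) * ℚ.1ℚ           ≡⟨ cong ((q - r) *_) (sym (ℚ.*-inverseʳ π)) ⟩
      (q - r) * (π * 1/ π)     ≡⟨ solve 3 (λ a b c → a :* (b :* c) := b :* (a :* c)) refl (q - r) π (1/ π) ⟩
      π * ((q - r) * 1/ π) ∎
      where open +-*-Solver
    zde≡w : z * fromℤ (d ℤ.* e) ≡ fromℤ w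
    zde≡w = begin
      (q - r) * 1/ π * fromℤ (d ℤ.* e)
        ≡⟨ cong ((q - r) * 1/ π *_) (fromℤ-* d e) ⟩
      (q - r) * 1/ π * (fromℤ d * fromℤ e)
        ≡⟨ solve 5 (λ q r i d e → (q :- r) :* i :* (d :* e) := (q :* d :* e :- r :* e :* d) :* i) refl
             q r (1/ π) (fromℤ d) (fromℤ e) ⟩
      (q * fromℤ d * fromℤ e - r * fromℤ e * fromℤ d) * 1/ π
        ≡⟨ cong₂ (λ u v → (u * fromℤ e - v * fromℤ d) * 1/ π) qd≡N re≡M ⟩
      (fromℤ N * fromℤ e - fromℤ M * fromℤ d) * 1/ π
        ≡⟨ cong (_* 1/ π) (trans (cong₂ _-_ (sym (fromℤ-* N e)) (sym (fromℤ-* M d)))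
             (trans (cong (_+_ (fromℤ (N ℤ.* e))) (sym (fromℤ-neg (M ℤ.* d))))
               (sym (fromℤ-+ (N ℤ.* e) (ℤ.- (M ℤ.* d)))))) ⟩
      fromℤ (N ℤ.* e ℤ.- M ℤ.* d) * 1/ π
        ≡⟨ cong (λ u → fromℤ u * 1/ π) difference≡wP² ⟩
      fromℤ (w ℤ.* + (p ℕ.^ 2)) * 1/ π
        ≡⟨ cong (_* 1/ π) (fromℤ-* w (+ (p ℕ.^ 2))) ⟩
      fromℤ w * π * 1/ π
        ≡⟨ trans (ℚ.*-assoc (fromℤ w) π (1/ π)) (trans (cong (fromℤ w *_) (ℚ.*-inverseʳ π)) (ℚ.*-identityʳ (fromℤ w))) ⟩
      fromℤ w ∎
      where open +-*-Solver

module _ (n : ℕ) (prime : Prime (suc ((n ℕ.+ n) ℕ.+ (n ℕ.+ n)))) where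

  private
    m = n ℕ.+ n
    p = suc (m ℕ.+ m)

  open PrimeModulus (m ℕ.+ m) prime
  open Localisation (m ℕ.+ m) prime
  open LegendreSymbol n prime using (P∤2)
  open Delannoy n prime using (weight; 16^j*weight≈; m<p)
  open JacobsthalEvaluation n prime using (P∤b)
  open Congruence n prime using (∑-weights; 4a*∑-weights≈)

  -- `16^j*weight≈` at j = 2k, where the sign (-1)^j is 1.
  term∼weight : ∀ k → k ℕ.≤ n → term k ∼ weight (k ℕ.+ k)
  term∼weight k k≤n = + (16 ℕ.^ (2 ℕ.* k)) , + (((4 ℕ.* k) C (2 ℕ.* k)) ℕ.^ 2) ,
    subst (¬_ ∘ (P ∣_)) (sym (pos-^ 16 (2 ℕ.* k))) (P∤^ (2 ℕ.* k) P∤16) ,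
    /-*-cancel (+ (((4 ℕ.* k) C (2 ℕ.* k)) ℕ.^ 2)) (16 ℕ.^ (2 ℕ.* k)) {{ℕ.m^n≢0 16 (2 ℕ.* k)}} ,
    ≈-sym (begin
      + (16 ℕ.^ (2 ℕ.* k)) ℤ.* weight (k ℕ.+ k)
        ≡⟨ cong (ℤ._* weight (k ℕ.+ k)) (trans (cong (λ j → + (16 ℕ.^ j)) 2*k≡k+k) (pos-^ 16 (k ℕ.+ k))) ⟩
      (+ 16) ℤ.^ (k ℕ.+ k) ℤ.* weight (k ℕ.+ k)
        ≈⟨ 16^j*weight≈ (k ℕ.+ k) (ℕ.+-mono-≤ k≤n k≤n) ⟩
      -1ℤ ℤ.^ (k ℕ.+ k) ℤ.* (B ℤ.* B)
        ≡⟨ trans (cong (ℤ._* (B ℤ.* B)) (-1^[n+n]≡1 k)) (ℤ.*-identityˡ (B ℤ.* B)) ⟩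
      B ℤ.* B
        ≡⟨ cong (λ b → b ℤ.* b) (trans (binom≡C (k ℕ.+ k ℕ.+ (k ℕ.+ k)) (k ℕ.+ k))
             (cong₂ (λ i j → + (i C j)) (sym (4*k≡ k)) (sym 2*k≡k+k))) ⟩
      + C₄ₖ ℤ.* + C₄ₖ
        ≡⟨ trans (sym (ℤ.pos-* C₄ₖ C₄ₖ)) (cong (λ j → + (C₄ₖ ℕ.* j)) (sym (ℕ.*-identityʳ C₄ₖ))) ⟩
      + (C₄ₖ ℕ.^ 2) ∎)
    where
    open ≈-Reasoning P²
    B = binom (k ℕ.+ k ℕ.+ (k ℕ.+ k)) (k ℕ.+ k)
    C₄ₖ = (4 ℕ.* k) C (2 ℕ.* k)
    P∤16 : ¬ P ∣ + 16
    P∤16 = P∤^ {+ 2} 4 P∤2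
    2*k≡k+k : 2 ℕ.* k ≡ k ℕ.+ k
    2*k≡k+k = cong (k ℕ.+_) (ℕ.+-identityʳ k)
    4*k≡ : ∀ k → 4 ℕ.* k ≡ k ℕ.+ k ℕ.+ (k ℕ.+ k)
    4*k≡ = ℕSolver.solve-∀
    pos-^ : ∀ b k → + (b ℕ.^ k) ≡ (+ b) ℤ.^ k
    pos-^ b zero    = refl
    pos-^ b (suc k) = trans (ℤ.pos-* b (b ℕ.^ k)) (cong ((+ b) ℤ.*_) (pos-^ b k))

  module _ (a b : ℤ) (p≡a²+b² : + p ≡ a ℤ.^ 2 ℤ.+ b ℤ.^ 2) (a≡1 : a %ℕ 4 ≡ 1) where

    private
      ε : ℤ
      ε = -1ℤ ℤ.^ n

      P≡a²+b² : P ≡ a ℤ.* a ℤ.+ b ℤ.* b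
      P≡a²+b² = trans p≡a²+b² (eq a b)
        where
        eq : ∀ a b → a ℤ.* (a ℤ.* 1ℤ) ℤ.+ b ℤ.* (b ℤ.* 1ℤ) ≡ a ℤ.* a ℤ.+ b ℤ.* b
        eq = solve-∀

      a≈1 : a ≈ 1ℤ [ + 4 ]
      a≈1 = mod (a ℤ./ℕ 4) (trans (cong (ℤ._- 1ℤ) (trans (ℤ.a≡a%ℕn+[a/ℕn]*n a 4)
        (cong (λ r → + r ℤ.+ a ℤ./ℕ 4 ℤ.* + 4) a≡1))) (eq (a ℤ./ℕ 4)))
        where
        eq : ∀ q → 1ℤ ℤ.+ q ℤ.* + 4 ℤ.- 1ℤ ≡ q ℤ.* + 4
        eq = solve-∀

      P∤4a : ¬ P ∣ + 4 ℤ.* a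
      -- The representation is symmetric, so `P∤b` with a and b exchanged shows that p does not
      -- divide a.
      P∤4a = P∤* (P∤^ {+ 2} 2 P∤2) (P∤b {b} {a} (trans P≡a²+b² (ℤ.+-comm (a ℤ.* a) (b ℤ.* b))))

    -- Clearing the denominator 4a turns the right side of the theorem into exactly the integer of
    -- `4a*∑-weights≈`.
    rhs∼ : ½ + ([-1]^ n) * fromℤ a - ([-1]^ n) * p/[4a] p a a≡1 ∼ ∑-weights
    rhs∼ = + 4 ℤ.* a , N , P∤4a , rhs*4a , ≈-sym (4a*∑-weights≈ {a} {b} P≡a²+b² a≈1)
      where
      open ≡-Reasoning
      open +-*-Solver
      N : ℤ
      N = + 2 ℤ.* a ℤ.+ + 4 ℤ.* (ε ℤ.* (a ℤ.* a)) ℤ.- ε ℤ.* P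
      instance
        4a≢0 : ℚ.NonZero (fromℤ (+ 4 ℤ.* a))
        4a≢0 = 4a-nonZero a a≡1
      s f4a inv : ℚ
      s = fromℤ ε
      f4a = fromℤ (+ 4 ℤ.* a)
      inv = 1/ f4a
      4a≡4*a : f4a ≡ fromℤ (+ 4) * fromℤ a
      4a≡4*a = fromℤ-* (+ 4) a
      rhs*4a : (½ + s * fromℤ a - s * (fromℤ P * inv)) * f4a ≡ fromℤ N
      rhs*4a = begin
        (½ + s * fromℤ a - s * (fromℤ P * inv)) * f4a
          ≡⟨ solve 6 (λ h s a P i f → (h :+ s :* a :- s :* (P :* i)) :* f := (h :+ s :* a) :* f :- s :* P :* (i :* f)) refl
               ½ s (fromℤ a) (fromℤ P) inv f4a ⟩
        (½ + s * fromℤ a) * f4a - s * fromℤ P * (inv * f4a)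
          ≡⟨ cong₂ (λ u v → (½ + s * fromℤ a) * u - s * fromℤ P * v) 4a≡4*a (ℚ.*-inverseˡ f4a) ⟩
        (½ + s * fromℤ a) * (fromℤ (+ 4) * fromℤ a) - s * fromℤ P * ℚ.1ℚ
          ≡⟨ solve 5 (λ h s a P f → (h :+ s :* a) :* (f :* a) :- s :* P :* con ℚ.1ℚ :=
               h :* f :* a :+ f :* (s :* (a :* a)) :- s :* P) refl ½ s (fromℤ a) (fromℤ P) (fromℤ (+ 4)) ⟩
        fromℤ (+ 2) * fromℤ a + fromℤ (+ 4) * (s * (fromℤ a * fromℤ a)) - s * fromℤ P
          ≡⟨ cong₂ (λ u v → fromℤ (+ 2) * fromℤ a + fromℤ (+ 4) * u - v)
               (trans (cong (s *_) (sym (fromℤ-* a a))) (sym (fromℤ-* ε (a ℤ.* a)))) (sym (fromℤ-* ε P)) ⟩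
        fromℤ (+ 2) * fromℤ a + fromℤ (+ 4) * fromℤ (ε ℤ.* (a ℤ.* a)) - fromℤ (ε ℤ.* P)
          ≡⟨ cong₂ _+_ (cong₂ _+_ (sym (fromℤ-* (+ 2) a)) (sym (fromℤ-* (+ 4) (ε ℤ.* (a ℤ.* a)))))
               (sym (fromℤ-neg (ε ℤ.* P))) ⟩
        fromℤ (+ 2 ℤ.* a) + fromℤ (+ 4 ℤ.* (ε ℤ.* (a ℤ.* a))) + fromℤ (ℤ.- (ε ℤ.* P))
          ≡⟨ trans (cong (_+ fromℤ (ℤ.- (ε ℤ.* P))) (sym (fromℤ-+ (+ 2 ℤ.* a) (+ 4 ℤ.* (ε ℤ.* (a ℤ.* a))))))
               (sym (fromℤ-+ (+ 2 ℤ.* a ℤ.+ + 4 ℤ.* (ε ℤ.* (a ℤ.* a))) (ℤ.- (ε ℤ.* P)))) ⟩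
        fromℤ N ∎

    congruence : (∑[ k ≤ n ] term (toℕ k)) ≡ ½ + ([-1]^ n) * fromℤ a - ([-1]^ n) * p/[4a] p a a≡1 [mod p ^ 2 ]
    congruence = ∼⇒≡mod {q = ∑[ k ≤ n ] term (toℕ k)}
      {r = ½ + ([-1]^ n) * fromℤ a - ([-1]^ n) * p/[4a] p a a≡1} (∼-∑ n {f = term} {g = λ k → weight (k ℕ.+ k)} term∼weight) rhs∼

theorem2p10 : (p : ℕ) → Prime p → p % 4 ≡ 1 →
    (a b : ℤ) → + p ≡ (a ℤ.^ 2) ℤ.+ (b ℤ.^ 2) → (a≡1 : a %ℕ 4 ≡ 1) →
    let n = (p ∸ 1) ℕ./ 4 in
    (∑[ k ≤ n ] term (toℕ k))
    ≡ ½ + ([-1]^ n) * fromℤ a - ([-1]^ n) * p/[4a] p a a≡1 [mod p ^ 2 ]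
theorem2p10 p isPrime p%4≡1 = split p isPrime ((p ∸ 1) ℕ./ 4) p≡
  where
  -- With p generalised to q and n a free variable, the equation q = 4n + 1 can be matched with
  -- `refl`.
  split : ∀ q → Prime q → ∀ n → q ≡ suc ((n ℕ.+ n) ℕ.+ (n ℕ.+ n)) →
    (a b : ℤ) → + q ≡ (a ℤ.^ 2) ℤ.+ (b ℤ.^ 2) → (a≡1 : a %ℕ 4 ≡ 1) →
    (∑[ k ≤ n ] term (toℕ k)) ≡ ½ + ([-1]^ n) * fromℤ a - ([-1]^ n) * p/[4a] q a a≡1 [mod q ^ 2 ]
  split _ isPrime n refl = congruence n isPrime
  4n : ℕ → ℕ
  4n n = (n ℕ.+ n) ℕ.+ (n ℕ.+ n)
  p≡1+r*4 : p ≡ suc (p ℕ./ 4 ℕ.* 4)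
  p≡1+r*4 = trans (ℕ.m≡m%n+[m/n]*n p 4) (cong (ℕ._+ p ℕ./ 4 ℕ.* 4) p%4≡1)
  p≡ : p ≡ suc (4n ((p ∸ 1) ℕ./ 4))
  p≡ = trans p≡1+r*4 (cong suc (trans (eq (p ℕ./ 4)) (cong 4n (sym (trans (cong (λ q → (q ∸ 1) ℕ./ 4) p≡1+r*4)
    (ℕ.m*n/n≡m (p ℕ./ 4) 4))))))
    where
    eq : ∀ r → r ℕ.* 4 ≡ (r ℕ.+ r) ℕ.+ (r ℕ.+ r)
    eq = ℕSolver.solve-∀
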